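{- Fix a subexponential function $f\colon\mathbb{N}\to\mathbb{N}$ and $\Delta\in\mathbb{N}$. There is a deterministic $\mathsf{LOCAL}$ algorithm that, given an $n$-vertex graph $G \in \mathbb{G}_{\Delta,f}$, finds a proper $(\Delta+1)$-edge-coloring of $G$ in at most $C_f \log^\ast n$ rounds, where $C_f>0$ depends only on $f$.
   Context: A function $f\colon \mathbb{N}\to\mathbb{N}$ is subexponential if for every $\epsilon>0$ there is $R(\epsilon)\in\mathbb{N}$ such that $f(R) < \exp(\epsilon R)$ for all $R \geq R(\epsilon)$. For a vertex $v$ of a graph $G$ and $R\in\mathbb{N}$, $N^R_G[v]$ is the set of vertices reachable from $v$ by a path of at most $R$ edges; $f$ bounds the growth of $G$ if $|N^R_G[v]|\le f(R)$ for all $v$ and $R$. $\mathbb{G}_{\Delta,f}$ is the class of all finite graphs of maximum degree at most $\Delta$ whose growth is bounded by $f$. A proper $q$-edge-coloring assigns to each edge a color in $\{0,\ldots,q-1\}$ so that edges sharing an endpoint get distinct colors. $\log^\ast n$ is the number of times the logarithm must be iterated starting from $n$ until the result is at most $1$. Deterministic $\mathsf{LOCAL}$ model: each vertex of an $n$-vertex graph is a processor with a unique identifier in $\{1,\ldots,n\}$ known to it; computation proceeds in synchronous rounds, in each of which every vertex performs arbitrary local computation and then sends messages of unbounded size to its neighbors; after the final round each vertex outputs its part of the solution (here, the colors of its incident edges). The algorithm must produce a valid solution for every assignment of identifiers; its complexity is the number of rounds. -}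

module Defs where

open import Data.Nat using (ℕ; zero; suc; _+_; _*_; _^_; _≤_; _<_; _≥_; _≤ᵇ_)
open import Data.Nat.Logarithm using (⌈log₂_⌉)
open import Data.Fin using (Fin; toℕ)
open import Data.Bool using (Bool; true; false; _∧_; _∨_; if_then_else_)
open import Data.List using (List; []; _∷_; allFin; filterᵇ; length)
open import Data.Bool.ListAction using (any)
open import Data.Maybe using (Maybe; just; nothing)
import Data.Maybe as Maybe
open import Data.Product using (Σ; _×_; _,_)
open import Relation.Binary.PropositionalEquality using (_≡_; _≢_)
open import Function.Definitions using (Injective)
open import Level using (Level) renaming (suc to lsuc; zero to lzero)

-- Subexponential functions.
-- Paper: ∀ ε>0 ∃ R(ε) ∀ R ≥ R(ε), f R < exp(ε R).
-- Without reals we use the exactly equivalent form: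
-- ∀ k ≥ 1 ∃ R₀ ∀ R ≥ R₀, (f R)^k < 2^R.

Subexponential : (ℕ → ℕ) → Set
Subexponential f =
  (k : ℕ) → 1 ≤ k → Σ ℕ λ R₀ → (R : ℕ) → R₀ ≤ R → f R ^ k < 2 ^ R

logStarFuel : ℕ → ℕ → ℕ
logStarFuel zero    m = zero
logStarFuel (suc k) m = if m ≤ᵇ 1 then zero else suc (logStarFuel k ⌈log₂ m ⌉)

logStar : ℕ → ℕ
logStar n = logStarFuel n n

_==_ : {n : ℕ} → Fin n → Fin n → Bool
i == j = Data.Nat._≡ᵇ_ (toℕ i) (toℕ j)

record Graph (n : ℕ) : Set where
  field
    adj     : Fin n → Fin n → Bool
    symm    : ∀ u v → adj u v ≡ adj v u
    irrefl  : ∀ v → adj v v ≡ false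
open Graph public

degree : {n : ℕ} → Graph n → Fin n → ℕ
degree {n} G v = length (filterᵇ (adj G v) (allFin n))

ball : {n : ℕ} → Graph n → ℕ → Fin n → Fin n → Bool
ball     G zero    v u = v == u
ball {n} G (suc R) v u =
  ball G R v u ∨ any (λ w → ball G R v w ∧ adj G w u) (allFin n)

ballSize : {n : ℕ} → Graph n → ℕ → Fin n → ℕ
ballSize {n} G R v = length (filterᵇ (ball G R v) (allFin n))

InClass : {n : ℕ} → ℕ → (ℕ → ℕ) → Graph n → Set
InClass Δ f G = (∀ v → degree G v ≤ Δ) × (∀ R v → ballSize G R v ≤ f R)

-- Deterministic LOCAL algorithms outputting (Δ+1)-edge-colorings.
-- A vertex initially knows n and its own identifier.  In each round it
-- sends a message (of arbitrary type) to all its neighbours and updates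
-- its state from its old state and the messages received, indexed by the
-- identifier of the sender (nothing = no neighbour with that identifier).
-- At the end it outputs, for each identifier j, the colour of the edge to
-- the neighbour with identifier j (ignored for non-neighbours).

record Algorithm (Δ : ℕ) : Set₁ where
  field
    State  : ℕ → Set
    Msg    : ℕ → Set
    init   : (n : ℕ) → Fin n → State n
    send   : (n : ℕ) → State n → Msg n
    step   : (n : ℕ) → State n → (Fin n → Maybe (Msg n)) → State n
    output : (n : ℕ) → State n → Fin n → Fin (suc Δ)
open Algorithm public

findFirst : {n : ℕ} → (Fin n → Bool) → List (Fin n) → Maybe (Fin n)
findFirst p []       = nothing
findFirst p (x ∷ xs) = if p x then just x else findFirst p xs

nbrWithId : {n : ℕ} → Graph n → (Fin n → Fin n) → Fin n → Fin n → Maybe (Fin n)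
nbrWithId {n} G ident v j = findFirst (λ u → adj G v u ∧ (ident u == j)) (allFin n)

run : {Δ n : ℕ} → (A : Algorithm Δ) → Graph n → (Fin n → Fin n) → ℕ → Fin n → State A n
run {Δ} {n} A G ident zero    v = init A n (ident v)
run {Δ} {n} A G ident (suc t) v =
  step A n (run A G ident t v)
    (λ j → Maybe.map (λ u → send A n (run A G ident t u)) (nbrWithId G ident v j))

edgeColour : {Δ n : ℕ} → Algorithm Δ → Graph n → (Fin n → Fin n) → ℕ →
             Fin n → Fin n → Fin (suc Δ)
edgeColour {Δ} {n} A G ident t v u = output A n (run A G ident t v) (ident u)

ProperEdgeColouring : {m n : ℕ} → Graph n → (Fin n → Fin n → Fin m) → Set
ProperEdgeColouring G c =
  (∀ u v → adj G u v ≡ true → c u v ≡ c v u) ×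
  (∀ v u w → adj G v u ≡ true → adj G v w ≡ true → u ≢ w → c v u ≢ c v w)

{-# OPTIONS --safe #-}

-- Work with the radius-R ball around an uncoloured edge e of a partial proper (d+1)-colouring φ. A Vizing chain
-- at e is a fan followed by an alternating path; if the path is short, e can be coloured, and if it is long,
-- the hole can be moved to any of its first 2q edges.  Let its path start at a vertex that misses one of the
-- two colours in φ: then it can be traced back in φ, so a vertex lies on the chains of boundedly many (≤ c)
-- holes.  Moving the hole from chain to chain is thus a walk in a digraph of out-degree 2q and in-degree ≤ c.
-- Chains of one walk must not interfere: a chain that meets an earlier, non-consecutive one is rare since
-- tracing back loses only a factor c per step, and consecutive chains use different colours or different
-- components.  Choosing each step by conditional expectations yields a walk without interference that would
-- also avoid the whole ball of radius ρK after K steps, as f (ρK) < 2^K and q is large compared to c; so it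
-- must meet a short path within K steps, and every e can be coloured by changing φ within constant distance.
-- Colouring a power of G with O(1) colours in O(log* n) rounds (Linial's colour reduction) then lets
-- the vertices of one colour class at a time have their edges coloured simultaneously, in disjoint balls.

module Submission where

open import Defs
open import Data.Nat using (ℕ; zero; suc; _+_; _*_; _^_; _∸_; _≤_; _<_; _⊓_; z≤n; s≤s; _<?_; _≡ᵇ_; ⌈_/2⌉; ⌊_/2⌋; >-nonZero)
open import Data.Nat.Logarithm using (⌈log₂_⌉; ⌈log₂⌉-mono-≤; ⌈log₂2^n⌉≡n; ⌈log₂⌈n/2⌉⌉≡⌈log₂n⌉∸1)
open import Data.Nat.Solver using (module +-*-Solver)
import Data.Nat.Properties as ℕₚ
open import Data.Fin using (Fin; zero; suc; toℕ; fromℕ<; inject≤; combine; funToFin; finToFun)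
import Data.Fin.Properties as Finₚ
open import Data.Bool using (Bool; true; false; _∧_; _∨_; not; if_then_else_; T)
import Data.Bool.Properties as Boolₚ
open import Data.Bool.ListAction using (any)
open import Data.List using (List; []; _∷_; _++_; map; concatMap; length; allFin; filterᵇ; applyUpTo)
open import Data.List.Properties using (length-++; length-map; length-tabulate; length-applyUpTo)
open import Data.Nat.ListAction using (sum)
open import Data.List.Membership.Propositional using (_∈_; _∉_; find; lose)
open import Data.List.Membership.Propositional.Properties using (∈-++⁺ˡ; ∈-++⁺ʳ; ∈-++⁻; ∈-∃++; ∈-map⁺; ∈-map⁻; ∈-allFin; ∈-concat⁺′; ∈-concat⁻′; ∈-filter⁺; ∈-filter⁻; ∈-applyUpTo⁺; ∈-applyUpTo⁻)
open import Data.List.Relation.Unary.Any using (Any; here; there)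
import Data.List.Relation.Unary.Any as Any
open import Data.List.Relation.Unary.All using (All; []; _∷_)
import Data.List.Relation.Unary.All as All
open import Data.List.Relation.Unary.AllPairs using ([]; _∷_)
open import Data.List.Relation.Unary.Unique.Propositional using (Unique)
import Data.List.Relation.Unary.Unique.Propositional.Properties as Uniqueₚ
open import Data.Vec using (Vec; tabulate; lookup)
import Data.Vec as Vec
import Data.Vec.Properties as Vecₚ
open import Data.Maybe using (Maybe; just; nothing)
import Data.Maybe as Maybe
import Data.Maybe.Properties as Maybeₚ
open import Data.Product using (Σ; ∃; _×_; _,_; proj₁; proj₂)
import Data.Product.Properties as Productₚ
open import Data.Sum using (_⊎_; inj₁; inj₂; [_,_]′)
open import Data.Empty using (⊥; ⊥-elim)
open import Data.Unit using (tt)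
open import Function using (_∘_; id; case_of_)
open import Function.Definitions using (Injective)
open import Relation.Nullary using (¬_; Dec; yes; no; does)
open import Relation.Nullary.Decidable using (_×-dec_; _⊎-dec_; _→-dec_; ¬?; dec-true; dec-false)
open import Relation.Binary.Definitions using (DecidableEquality)
open import Relation.Binary.PropositionalEquality using (_≡_; _≢_; refl; sym; trans; cong; cong₂; subst; subst₂; module ≡-Reasoning)

-- All chains of a walk are read off the fixed colouring `φ`, not the current one: only then is it a
-- walk in a fixed digraph whose in-degree can be bounded. The price is an invariant saying that the
-- next chain can still be carried out in the current colouring `ψ`. This cannot be had by keeping
-- consecutive chains disjoint: a path has about `2q` vertices, each blocking up to `c` states, and
-- then the count no longer shows that one of the `2q` successors is free. So the next chain has to
-- avoid only a few vertices of its predecessor, their number independent of `q`, and fans stop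
-- early enough that its path has either none of the two colours of the preceding path or exactly
-- these two. The constant does not depend on Δ because all neighbours of a vertex lie in its ball
-- of radius 1. Degrees are thus at most `f 1`, min(Δ, `f 1`) + 1 colours are used, and every
-- constant is made from `f 1`. The analysis only shows that a local recolouring exists. The
-- algorithm finds one by exhaustive search, a function of what a centre sees, so that locality
-- reduces to the equality of two windows.

unique-⊆-length : {A : Set} {xs ys : List A} → Unique xs → (∀ {x} → x ∈ xs → x ∈ ys) → length xs ≤ length ys
unique-⊆-length {xs = []} _ _ = z≤n
unique-⊆-length {xs = x ∷ xs} (x# ∷ u) sub with ∈-∃++ (sub (here refl))
... | as , bs , refl =
  ℕₚ.≤-trans (s≤s (unique-⊆-length u sub′))
    (ℕₚ.≤-reflexive (begin
      suc (length (as ++ bs)) ≡⟨ cong suc (length-++ as) ⟩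
      suc (length as + length bs) ≡⟨ sym (ℕₚ.+-suc (length as) (length bs)) ⟩
      length as + length (x ∷ bs) ≡⟨ sym (length-++ as) ⟩
      length (as ++ x ∷ bs) ∎))
  where
  open ≡-Reasoning
  sub′ : ∀ {z} → z ∈ xs → z ∈ as ++ bs
  sub′ z∈ with ∈-++⁻ as (sub (there z∈))
  ... | inj₁ p = ∈-++⁺ˡ p
  ... | inj₂ (here refl) = ⊥-elim (All.lookup x# z∈ refl)
  ... | inj₂ (there p) = ∈-++⁺ʳ as p

∈-concatMap⁺ : {A B : Set} (f : A → List B) (xs : List A) {x : A} {y : B} → x ∈ xs → y ∈ f x → y ∈ concatMap f xs
∈-concatMap⁺ f xs x∈ y∈ = ∈-concat⁺′ y∈ (∈-map⁺ f x∈)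

length-concatMap-≤ : {A B : Set} (f : A → List B) (m : ℕ) (xs : List A) → (∀ x → length (f x) ≤ m) → length (concatMap f xs) ≤ length xs * m
length-concatMap-≤ f m [] h = z≤n
length-concatMap-≤ f m (x ∷ xs) h =
  ℕₚ.≤-trans (ℕₚ.≤-reflexive (length-++ (f x))) (ℕₚ.+-mono-≤ (h x) (length-concatMap-≤ f m xs h))

module _ {n : ℕ} where

  infix 4 _≟ᶠ_

  _≟ᶠ_ : DecidableEquality (Fin n)
  _≟ᶠ_ = Finₚ._≟_

  ==-true : (i j : Fin n) → (i == j) ≡ true → i ≡ j
  ==-true i j e = Finₚ.toℕ-injective (ℕₚ.≡ᵇ⇒≡ (toℕ i) (toℕ j) (subst T (sym e) tt))

  ==-refl : (i : Fin n) → (i == i) ≡ true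
  ==-refl i = T-true (ℕₚ.≡⇒≡ᵇ (toℕ i) (toℕ i) refl)
    where
    T-true : ∀ {b} → T b → b ≡ true
    T-true {true} _ = refl

  ==-sym : (i j : Fin n) → (i == j) ≡ (j == i)
  ==-sym i j with i == j in e | j == i in e′
  ... | true  | true  = refl
  ... | false | false = refl
  ... | true  | false with refl ← ==-true i j e = trans (sym e) e′
  ... | false | true  with refl ← ==-true j i e′ = trans (sym e) e′

∧-true : ∀ {a b} → a ∧ b ≡ true → a ≡ true × b ≡ true
∧-true {true} {true} _ = refl , refl

∨-true : ∀ {a b} → a ∨ b ≡ true → a ≡ true ⊎ b ≡ true
∨-true {true}  _ = inj₁ refl
∨-true {false} e = inj₂ e

∨-trueʳ : ∀ a {b} → b ≡ true → a ∨ b ≡ true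
∨-trueʳ true  _ = refl
∨-trueʳ false e = e

∨-trueˡ : ∀ {a} b → a ≡ true → a ∨ b ≡ true
∨-trueˡ b refl = refl

∧-intro : ∀ {a b} → a ≡ true → b ≡ true → a ∧ b ≡ true
∧-intro refl refl = refl

true-iff : ∀ {a b} → (a ≡ true → b ≡ true) → (b ≡ true → a ≡ true) → a ≡ b
true-iff {true}  {b}     f g = sym (f refl)
true-iff {false} {false} f g = refl
true-iff {false} {true}  f g = g refl

any-true⁺ : {A : Set} (p : A → Bool) {xs : List A} {x : A} → x ∈ xs → p x ≡ true → any p xs ≡ true
any-true⁺ p {x ∷ xs} (here refl) e = ∨-trueˡ _ e
any-true⁺ p {y ∷ xs} (there x∈)  e = ∨-trueʳ (p y) (any-true⁺ p x∈ e)

any-true⁻ : {A : Set} (p : A → Bool) (xs : List A) → any p xs ≡ true → ∃ λ x → x ∈ xs × p x ≡ true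
any-true⁻ p (x ∷ xs) e with ∨-true {p x} e
... | inj₁ px = x , here refl , px
... | inj₂ e′ with any-true⁻ p xs e′
... | y , y∈ , py = y , there y∈ , py

-- Paths and balls, degree and growth

module _ {n : ℕ} where

  ∈-filterᵇ⁺ : (p : Fin n → Bool) {v : Fin n} → p v ≡ true → v ∈ filterᵇ p (allFin n)
  ∈-filterᵇ⁺ p {v} e = ∈-filter⁺ (Boolₚ.T? ∘ p) (∈-allFin v) (subst T (sym e) tt)

  ∈-filterᵇ⁻ : (p : Fin n → Bool) {v : Fin n} → v ∈ filterᵇ p (allFin n) → p v ≡ true
  ∈-filterᵇ⁻ p {v} v∈ with p v | proj₂ (∈-filter⁻ (Boolₚ.T? ∘ p) {xs = allFin n} v∈)
  ... | true | _ = refl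

  unique-filterᵇ : (p : Fin n → Bool) → Unique (filterᵇ p (allFin n))
  unique-filterᵇ p = Uniqueₚ.filter⁺ (Boolₚ.T? ∘ p) (Uniqueₚ.allFin⁺ n)

  data Path (G : Graph n) (v : Fin n) : ℕ → Fin n → Set where
    stop : ∀ {r} → Path G v r v
    snoc : ∀ {r u x} → Path G v r u → adj G u x ≡ true → Path G v (suc r) x

  module _ {G : Graph n} where

    adj-sym : ∀ {u v} → adj G u v ≡ true → adj G v u ≡ true
    adj-sym {u} {v} e = trans (symm G v u) e

    adj-≢ : ∀ {u v} → adj G u v ≡ true → u ≢ v
    adj-≢ {u} e refl with trans (sym e) (irrefl G u)
    ... | ()

    path-mono : ∀ {v r s u} → r ≤ s → Path G v r u → Path G v s u
    path-mono r≤s stop = stop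
    path-mono (s≤s r≤s) (snoc p e) = snoc (path-mono r≤s p) e

    path-trans : ∀ {v u x} r {s} → Path G v r u → Path G u s x → Path G v (r + s) x
    path-trans r p stop = path-mono (ℕₚ.m≤m+n r _) p
    path-trans {v} r {suc s} p (snoc {x = x} q e) = subst (λ k → Path G v k x) (sym (ℕₚ.+-suc r s)) (snoc (path-trans r p q) e)

    path-edge : ∀ {u v} → adj G u v ≡ true → Path G u 1 v
    path-edge e = snoc stop e

    path-sym : ∀ {v r u} → Path G v r u → Path G u r v
    path-sym stop = stop
    path-sym (snoc p e) = path-trans 1 (path-edge (adj-sym e)) (path-sym p)

    ball⇒path : ∀ R {v u} → ball G R v u ≡ true → Path G v R u
    ball⇒path zero {v} {u} e with refl ← ==-true v u e = stop
    ball⇒path (suc R) {v} {u} e with ∨-true {ball G R v u} e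
    ... | inj₁ b = path-mono (ℕₚ.n≤1+n R) (ball⇒path R b)
    ... | inj₂ a with any-true⁻ _ (allFin n) a
    ... | w , _ , bw with ∧-true {ball G R v w} bw
    ... | b , e′ = snoc (ball⇒path R b) e′

    ball-refl : ∀ R v → ball G R v v ≡ true
    ball-refl zero v = ==-refl v
    ball-refl (suc R) v = ∨-trueˡ _ (ball-refl R v)

    path⇒ball : ∀ {R v u} → Path G v R u → ball G R v u ≡ true
    path⇒ball {R} {v} stop = ball-refl R v
    path⇒ball {suc R} {v} {x} (snoc {u = u} p e) =
      ∨-trueʳ (ball G R v x) (any-true⁺ (λ w → ball G R v w ∧ adj G w x) (∈-allFin u) (∧-intro (path⇒ball p) e))

  -- Stated with duplicate-free lists instead of counts, so that the bounds pass to restricted and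
  -- relabelled graphs by mapping the list.
  DegreeAtMost : ℕ → Graph n → Set
  DegreeAtMost d G = ∀ v xs → Unique xs → All (λ u → adj G v u ≡ true) xs → length xs ≤ d

  GrowthAtMost : (ℕ → ℕ) → Graph n → Set
  GrowthAtMost f G = ∀ R v xs → Unique xs → All (Path G v R) xs → length xs ≤ f R

  neighbours : Graph n → Fin n → List (Fin n)
  neighbours G v = filterᵇ (adj G v) (allFin n)

  neighbours⁻ : ∀ {G v u} → u ∈ neighbours G v → adj G v u ≡ true
  neighbours⁻ {G} {v} = ∈-filterᵇ⁻ (adj G v)

  neighbours⁺ : ∀ {G v u} → adj G v u ≡ true → u ∈ neighbours G v
  neighbours⁺ {G} {v} = ∈-filterᵇ⁺ (adj G v)

  length-neighbours : ∀ {d G} → DegreeAtMost d G → ∀ v → length (neighbours G v) ≤ d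
  length-neighbours {d} {G} deg v = deg v _ (unique-filterᵇ (adj G v)) (All.tabulate (neighbours⁻ {G}))

-- Walks with obstacles

sum-map-+ : {A : Set} (F G : A → ℕ) (xs : List A) → sum (map (λ x → F x + G x) xs) ≡ sum (map F xs) + sum (map G xs)
sum-map-+ F G [] = refl
sum-map-+ F G (x ∷ xs) rewrite sum-map-+ F G xs =
  solve 4 (λ a b c d → (a :+ b) :+ (c :+ d) := (a :+ c) :+ (b :+ d)) refl (F x) (G x) (sum (map F xs)) (sum (map G xs))
  where open +-*-Solver

sum-map-mono : {A : Set} {F G : A → ℕ} (xs : List A) → (∀ x → F x ≤ G x) → sum (map F xs) ≤ sum (map G xs)
sum-map-mono [] h = z≤n
sum-map-mono (x ∷ xs) h = ℕₚ.+-mono-≤ (h x) (sum-map-mono xs h)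

below-average : {A : Set} (F : A → ℕ) (b : ℕ) (xs : List A) → sum (map F xs) < length xs * b → ∃ λ x → x ∈ xs × F x < b
below-average F b (x ∷ xs) h with F x <? b
... | yes lt = x , here refl , lt
... | no ge with below-average F b xs (ℕₚ.+-cancelˡ-< b _ _ (ℕₚ.≤-<-trans (ℕₚ.+-monoˡ-≤ _ (ℕₚ.≮⇒≥ ge)) h))
... | y , y∈ , lt = y , there y∈ , lt

-- The method of conditional expectations for walks in a digraph with in-degree at most c and 2q
-- successors per vertex: an obstacle met after t steps has weight q ^ (K ∸ t).  One step halves the
-- expected weight of the present obstacles, which makes room for the new ones.
module Potential {S : Set} (_≟_ : DecidableEquality S) (succs preds : S → List S) (c q : ℕ)
  (length-preds : ∀ x → length (preds x) ≤ c)
  (unique-succs : ∀ s → Unique (succs s))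
  (succs⇒preds : ∀ s x → x ∈ succs s → s ∈ preds x) where

  count : S → List S → ℕ
  count s [] = 0
  count s (z ∷ zs) = (if does (s ≟ z) then 1 else 0) + count s zs

  count-++ : ∀ s xs ys → count s (xs ++ ys) ≡ count s xs + count s ys
  count-++ s [] ys = refl
  count-++ s (x ∷ xs) ys rewrite count-++ s xs ys = sym (ℕₚ.+-assoc _ (count s xs) (count s ys))

  count-∈ : ∀ {s xs} → s ∈ xs → 1 ≤ count s xs
  count-∈ {s} (here refl) rewrite dec-true (s ≟ s) refl = s≤s z≤n
  count-∈ {s} {x ∷ xs} (there s∈) = ℕₚ.≤-trans (count-∈ s∈) (ℕₚ.m≤n+m _ _)

  count-≤-length : ∀ s xs → count s xs ≤ length xs
  count-≤-length s [] = z≤n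
  count-≤-length s (x ∷ xs) with does (s ≟ x)
  ... | true  = s≤s (count-≤-length s xs)
  ... | false = ℕₚ.m≤n⇒m≤1+n (count-≤-length s xs)

  -- Plays the role of an upper bound on the sum of `F` over all states, without summing over `S`:
  -- the list carries one entry per unit of mass.
  Mass : (S → ℕ) → ℕ → Set
  Mass F m = Σ (List S) λ zs → (∀ s → F s ≤ count s zs) × length zs ≤ m

  mass-≤ : ∀ {F m} → Mass F m → ∀ s → F s ≤ m
  mass-≤ (zs , h , l) s = ℕₚ.≤-trans (h s) (ℕₚ.≤-trans (count-≤-length s zs) l)

  mass-weaken : ∀ {F m m′} → m ≤ m′ → Mass F m → Mass F m′
  mass-weaken le (zs , h , l) = zs , h , ℕₚ.≤-trans l le

  mass-0 : Mass (λ _ → 0) 0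
  mass-0 = [] , (λ _ → z≤n) , z≤n

  mass-+ : ∀ {F G m m′} → Mass F m → Mass G m′ → Mass (λ s → F s + G s) (m + m′)
  mass-+ (zs , h , l) (zs′ , h′ , l′) =
    zs ++ zs′ ,
    (λ s → subst (_ ≤_) (sym (count-++ s zs zs′)) (ℕₚ.+-mono-≤ (h s) (h′ s))) ,
    subst (_≤ _) (sym (length-++ zs)) (ℕₚ.+-mono-≤ l l′)

  mass-* : ∀ {F m} k → Mass F m → Mass (λ s → k * F s) (k * m)
  mass-* zero μ = mass-0
  mass-* (suc k) μ = mass-+ μ (mass-* k μ)

  private
    hits-∉ : ∀ z xs → z ∉ xs → sum (map (λ x → if does (x ≟ z) then 1 else 0) xs) ≡ 0
    hits-∉ z [] _ = refl
    hits-∉ z (x ∷ xs) z∉ rewrite dec-false (x ≟ z) (λ e → z∉ (here (sym e))) = hits-∉ z xs (z∉ ∘ there)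

    hits-unique : ∀ z {xs} → Unique xs → sum (map (λ x → if does (x ≟ z) then 1 else 0) xs) ≤ 1
    hits-unique z [] = z≤n
    hits-unique z {x ∷ xs} (x# ∷ u) with x ≟ z
    ... | yes refl = ℕₚ.≤-reflexive (cong suc (hits-∉ x xs (λ x∈ → All.lookup x# x∈ refl)))
    ... | no _ = hits-unique z u

    hits : ∀ s z → sum (map (λ x → if does (x ≟ z) then 1 else 0) (succs s)) ≤ count s (preds z)
    hits s z with Any.any? (z ≟_) (succs s)
    ... | yes z∈ = ℕₚ.≤-trans (hits-unique z (unique-succs s)) (count-∈ (succs⇒preds s z z∈))
    ... | no z∉ = subst (_≤ count s (preds z)) (sym (hits-∉ z (succs s) z∉)) z≤n

    count-succs : ∀ s zs → sum (map (λ x → count x zs) (succs s)) ≤ count s (concatMap preds zs)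
    count-succs s [] = ℕₚ.≤-reflexive (zeros (succs s))
      where
      zeros : (xs : List S) → sum (map (λ _ → 0) xs) ≡ 0
      zeros [] = refl
      zeros (x ∷ xs) = zeros xs
    count-succs s (z ∷ zs)
      rewrite sum-map-+ (λ x → if does (x ≟ z) then 1 else 0) (λ x → count x zs) (succs s)
            | count-++ s (preds z) (concatMap preds zs) = ℕₚ.+-mono-≤ (hits s z) (count-succs s zs)

  -- Double counting of arcs: a unit of mass at `z` is seen only from `preds z`. Hence the factor is
  -- the in-degree bound `c`, however many successors there are.
  mass-succs : ∀ {F m} → Mass F m → Mass (λ s → sum (map F (succs s))) (m * c)
  mass-succs (zs , h , l) =
    concatMap preds zs ,
    (λ s → ℕₚ.≤-trans (sum-map-mono (succs s) h) (count-succs s zs)) ,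
    ℕₚ.≤-trans (length-concatMap-≤ preds c zs length-preds) (ℕₚ.*-monoˡ-≤ c l)

  -- Unfolded: the sum, over all `t ≤ K` and all walks of `t` steps from `s`, of `q ^ (K ∸ t)` times
  -- `O t` at the last state.
  Φ : ℕ → (ℕ → S → ℕ) → S → ℕ
  Φ zero    O s = O 0 s
  Φ (suc K) O s = q ^ suc K * O 0 s + sum (map (Φ K (O ∘ suc)) (succs s))

  Φ-+ : ∀ K O N s → Φ K (λ t x → O t x + N t x) s ≡ Φ K O s + Φ K N s
  Φ-+ zero O N s = refl
  Φ-+ (suc K) O N s = begin
      q ^ suc K * (O 0 s + N 0 s) + sum (map (Φ K (λ t x → O (suc t) x + N (suc t) x)) (succs s))
    ≡⟨ cong₂ _+_ (ℕₚ.*-distribˡ-+ (q ^ suc K) (O 0 s) (N 0 s)) (trans (sum-cong (succs s)) (sum-map-+ _ _ (succs s))) ⟩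
      (q ^ suc K * O 0 s + q ^ suc K * N 0 s) + (sum (map (Φ K (O ∘ suc)) (succs s)) + sum (map (Φ K (N ∘ suc)) (succs s)))
    ≡⟨ solve 4 (λ a b x y → (a :+ b) :+ (x :+ y) := (a :+ x) :+ (b :+ y)) refl (q ^ suc K * O 0 s) _ _ _ ⟩
      Φ (suc K) O s + Φ (suc K) N s ∎
    where
    open ≡-Reasoning
    open +-*-Solver
    sum-cong : (xs : List S) →
      sum (map (Φ K (λ t x → O (suc t) x + N (suc t) x)) xs) ≡ sum (map (λ x → Φ K (O ∘ suc) x + Φ K (N ∘ suc) x) xs)
    sum-cong [] = refl
    sum-cong (x ∷ xs) = cong₂ _+_ (Φ-+ K (O ∘ suc) (N ∘ suc) x) (sum-cong xs)

  Φ-clear : ∀ K O s → Φ K O s < q ^ K → O 0 s ≡ 0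
  Φ-clear zero O s lt = ℕₚ.n<1⇒n≡0 lt
  Φ-clear (suc K) O s lt with O 0 s
  ... | zero = refl
  ... | suc k = ⊥-elim (ℕₚ.<⇒≱ lt (ℕₚ.≤-trans (ℕₚ.m≤m*n (q ^ suc K) (suc k)) (ℕₚ.m≤m+n _ _)))

  -- A geometric series: `t` steps cost `c ^ t` in mass and gain `q ^ t` in weight, and `c` is at
  -- most half of `q`.
  Φ-mass : 2 * c ≤ q → ∀ {O m} → (∀ t → Mass (O t) m) → ∀ K → Mass (Φ K O) (2 * q ^ K * m)
  Φ-mass 2c≤q {O} {m} μ zero = mass-weaken (ℕₚ.m≤m+n m _) (μ 0)
  Φ-mass 2c≤q {O} {m} μ (suc K) =
    mass-weaken bound (mass-+ (mass-* (q ^ suc K) (μ 0)) (mass-succs (Φ-mass 2c≤q (μ ∘ suc) K)))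
    where
    open +-*-Solver
    open ℕₚ.≤-Reasoning
    bound : q ^ suc K * m + 2 * q ^ K * m * c ≤ 2 * q ^ suc K * m
    bound = begin
        q * q ^ K * m + 2 * q ^ K * m * c
      ≡⟨ cong (q * q ^ K * m +_) (solve 3 (λ Q m c → con 2 :* Q :* m :* c := con 2 :* c :* (Q :* m)) refl (q ^ K) m c) ⟩
        q * q ^ K * m + 2 * c * (q ^ K * m)
      ≤⟨ ℕₚ.+-monoʳ-≤ (q * q ^ K * m) (ℕₚ.*-monoˡ-≤ (q ^ K * m) 2c≤q) ⟩
        q * q ^ K * m + q * (q ^ K * m)
      ≡⟨ solve 3 (λ Q m q → q :* Q :* m :+ q :* (Q :* m) := con 2 :* (q :* Q) :* m) refl (q ^ K) m q ⟩
        2 * q ^ suc K * m ∎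

  -- Obstacles for the very next state have mass `m₁` and lose one factor `c`, so `m₁` must be small
  -- compared to `q`. Those for later states lose another `c` but gain a factor `q` in weight, which
  -- lets `m₂` be of order `q`.
  Φ-new : ∀ {m₁ m₂} → 2 * c ≤ q → m₁ * c ≤ q → (q * m₁ + 2 * m₂ * c) * c ≤ q * q →
    ∀ {N} → Mass (N 0) m₁ → (∀ t → Mass (N (suc t)) m₂) → ∀ K s → sum (map (Φ K N) (succs s)) ≤ q ^ suc K
  Φ-new 2c≤q h₁ h₂ μ₁ μ₂ zero s =
    ℕₚ.≤-trans (mass-≤ (mass-succs μ₁) s) (ℕₚ.≤-trans h₁ (ℕₚ.≤-reflexive (sym (ℕₚ.*-identityʳ q))))
  Φ-new {m₁} {m₂} 2c≤q h₁ h₂ μ₁ μ₂ (suc K) s =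
    ℕₚ.≤-trans (mass-≤ (mass-succs (mass-+ (mass-* (q ^ suc K) μ₁) (mass-succs (Φ-mass 2c≤q μ₂ K)))) s) (begin
        (q * q ^ K * m₁ + 2 * q ^ K * m₂ * c) * c
      ≡⟨ solve 5 (λ q Q m₁ m₂ c → (q :* Q :* m₁ :+ con 2 :* Q :* m₂ :* c) :* c := Q :* ((q :* m₁ :+ con 2 :* m₂ :* c) :* c)) refl q (q ^ K) m₁ m₂ c ⟩
        q ^ K * ((q * m₁ + 2 * m₂ * c) * c)
      ≤⟨ ℕₚ.*-monoʳ-≤ (q ^ K) h₂ ⟩
        q ^ K * (q * q)
      ≡⟨ solve 2 (λ Q q → Q :* (q :* q) := q :* (q :* Q)) refl (q ^ K) q ⟩
        q * (q * q ^ K) ∎)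
    where
    open +-*-Solver
    open ℕₚ.≤-Reasoning

  -- The old obstacles contribute less than `q ^ suc K` over all successors, the new ones at most
  -- `q ^ suc K`; an average over `2 * q` successors is below `q ^ K`.
  Φ-step : ∀ K O N s → length (succs s) ≡ 2 * q → Φ (suc K) O s < q ^ suc K → sum (map (Φ K N) (succs s)) ≤ q ^ suc K →
    ∃ λ x → x ∈ succs s × Φ K (λ t y → O (suc t) y + N t y) x < q ^ K
  Φ-step K O N s len lt new = below-average (Φ K (λ t y → O (suc t) y + N t y)) (q ^ K) (succs s) (begin-strict
      sum (map (Φ K (λ t y → O (suc t) y + N t y)) (succs s))
    ≡⟨ sum-cong (succs s) ⟩
      sum (map (λ x → Φ K (O ∘ suc) x + Φ K N x) (succs s))
    ≡⟨ sum-map-+ (Φ K (O ∘ suc)) (Φ K N) (succs s) ⟩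
      sum (map (Φ K (O ∘ suc)) (succs s)) + sum (map (Φ K N) (succs s))
    <⟨ ℕₚ.+-mono-<-≤ (ℕₚ.≤-<-trans (ℕₚ.m≤n+m _ (q ^ suc K * O 0 s)) lt) new ⟩
      q ^ suc K + q ^ suc K
    ≡⟨ solve 2 (λ q Q → q :* Q :+ q :* Q := con 2 :* q :* Q) refl q (q ^ K) ⟩
      2 * q * q ^ K
    ≡⟨ cong (_* q ^ K) (sym len) ⟩
      length (succs s) * q ^ K ∎)
    where
    open +-*-Solver
    open ℕₚ.≤-Reasoning
    sum-cong : (xs : List S) → sum (map (Φ K (λ t y → O (suc t) y + N t y)) xs) ≡ sum (map (λ x → Φ K (O ∘ suc) x + Φ K N x) xs)
    sum-cong [] = refl
    sum-cong (x ∷ xs) = cong₂ _+_ (Φ-+ K (O ∘ suc) N x) (sum-cong xs)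

  -- Obstacles that count only at the last step, where their weight is 1.
  deadline : ℕ → (S → ℕ) → ℕ → S → ℕ
  deadline zero    F zero    = F
  deadline zero    F (suc t) = λ _ → 0
  deadline (suc K) F zero    = λ _ → 0
  deadline (suc K) F (suc t) = deadline K F t

  deadline-at : ∀ K F s → deadline K F K s ≡ F s
  deadline-at zero F s = refl
  deadline-at (suc K) F s = deadline-at K F s

  -- No power of `q` appears, so even a mass exponential in `K` stays below the threshold `q ^ K`
  -- once `q` is a large multiple of `c`.
  Φ-deadline : ∀ {F m} → Mass F m → ∀ K → Mass (Φ K (deadline K F)) (m * c ^ K)
  Φ-deadline {m = m} μ zero = mass-weaken (ℕₚ.≤-reflexive (sym (ℕₚ.*-identityʳ m))) μ
  Φ-deadline {m = m} μ (suc K) = mass-weaken (ℕₚ.≤-reflexive bound) (mass-+ (mass-* (q ^ suc K) mass-0) (mass-succs (Φ-deadline μ K)))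
    where
    open +-*-Solver
    bound : q ^ suc K * 0 + m * c ^ K * c ≡ m * (c * c ^ K)
    bound = solve 4 (λ Q m C c → Q :* con 0 :+ m :* C :* c := m :* (c :* C)) refl (q ^ suc K) m (c ^ K) c

-- Partial colourings and alternating walks

PartialColouring : ℕ → ℕ → Set
PartialColouring n k = Fin n → Fin n → Maybe (Fin k)

infix 4 _≟ᵐ_

_≟ᵐ_ : {k : ℕ} → DecidableEquality (Maybe (Fin k))
_≟ᵐ_ = Maybeₚ.≡-dec Finₚ._≟_

module _ {n k : ℕ} where

  record Proper (G : Graph n) (φ : PartialColouring n k) : Set where
    field
      sym-col  : ∀ a b → φ a b ≡ φ b a
      edge-col : ∀ {a b c} → φ a b ≡ just c → adj G a b ≡ true
      matching : ∀ {a b b′ c} → φ a b ≡ just c → φ a b′ ≡ just c → b ≡ b′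
  open Proper public

  Missing : PartialColouring n k → Fin n → Fin k → Set
  Missing φ v c = ∀ u → φ v u ≢ just c

  follow? : ∀ (φ : PartialColouring n k) v c → Dec (∃ λ u → φ v u ≡ just c)
  follow? φ v c = Finₚ.any? (λ u → φ v u ≟ᵐ just c)

  missing : ∀ {φ : PartialColouring n k} {v c} → ¬ (∃ λ u → φ v u ≡ just c) → Missing φ v c
  missing ¬∃ u e = ¬∃ (u , e)

-- A position (x , y , v): the alternating walk stands at v, leaves along colour x, then continues along y.
-- A walk that cannot leave its vertex stays there for ever.
module Walk {n k : ℕ} (G : Graph n) (φ : PartialColouring n k) (proper : Proper G φ) where

  Position : Set
  Position = Fin k × Fin k × Fin n

  vertex : Position → Fin n
  vertex (_ , _ , v) = v

  flip : Position → Position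
  flip (x , y , v) = y , x , v

  Stuck Moving : Position → Set
  Stuck (x , _ , v) = Missing φ v x
  Moving (x , _ , v) = ∃ λ u → φ v u ≡ just x

  data Colours (x y : Fin k) : Position → Set where
    same    : ∀ {v} → Colours x y (x , y , v)
    swapped : ∀ {v} → Colours x y (y , x , v)

  abstract
    advance : Position → Position
    advance (x , y , v) with follow? φ v x
    ... | yes (u , _) = y , x , u
    ... | no _ = x , y , v

    advance-edge : ∀ {x y v u} → φ v u ≡ just x → advance (x , y , v) ≡ (y , x , u)
    advance-edge {x} {y} {v} {u} e with follow? φ v x
    ... | yes (u′ , e′) = cong (λ z → y , x , z) (matching proper e′ e)
    ... | no ¬e = ⊥-elim (¬e (u , e))

    advance-stuck : ∀ {σ} → Stuck σ → advance σ ≡ σ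
    advance-stuck {x , y , v} m with follow? φ v x
    ... | yes (u , e) = ⊥-elim (m u e)
    ... | no _ = refl

    colours-advance : ∀ {x y σ} → Colours x y σ → Colours x y (advance σ)
    colours-advance {x} {y} {_ , _ , v} same with follow? φ v x
    ... | yes _ = swapped
    ... | no _ = same
    colours-advance {x} {y} {_ , _ , v} swapped with follow? φ v y
    ... | yes _ = same
    ... | no _ = swapped

  moving? : ∀ σ → Dec (Moving σ)
  moving? (x , _ , v) = follow? φ v x

  moving-or-stuck : ∀ σ → Moving σ ⊎ Stuck σ
  moving-or-stuck σ with moving? σ
  ... | yes m = inj₁ m
  ... | no ¬m = inj₂ (λ u e → ¬m (u , e))

  advance-flip : ∀ {σ} → Moving σ → advance (flip (advance σ)) ≡ flip σ
  advance-flip {x , y , v} (u , e) =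
    trans (cong (advance ∘ flip) (advance-edge e)) (advance-edge (trans (sym-col proper u v) e))

  moving-back : ∀ {σ} → Moving σ → Moving (flip (advance σ))
  moving-back {x , y , v} (u , e) = subst (Moving ∘ flip) (sym (advance-edge e)) (v , trans (sym-col proper u v) e)

  walk : ℕ → Position → Position
  walk zero    σ = σ
  walk (suc i) σ = advance (walk i σ)

  walk-+ : ∀ i j σ → walk i (walk j σ) ≡ walk (i + j) σ
  walk-+ zero    j σ = refl
  walk-+ (suc i) j σ = cong advance (walk-+ i j σ)

  walk-advance : ∀ i σ → walk i (advance σ) ≡ advance (walk i σ)
  walk-advance zero    σ = refl
  walk-advance (suc i) σ = cong advance (walk-advance i σ)

  walk-stuck : ∀ {σ} → Stuck σ → ∀ i → walk i σ ≡ σ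
  walk-stuck m zero    = refl
  walk-stuck {σ} m (suc i) = trans (cong advance (walk-stuck m i)) (advance-stuck {σ} m)

  walk-stuck-≤ : ∀ {σ i j} → Stuck (walk i σ) → i ≤ j → walk j σ ≡ walk i σ
  walk-stuck-≤ {σ} {i} {j} m i≤j = begin
    walk j σ ≡⟨ cong (λ z → walk z σ) (sym (ℕₚ.m∸n+n≡m i≤j)) ⟩
    walk (j ∸ i + i) σ ≡⟨ sym (walk-+ (j ∸ i) i σ) ⟩
    walk (j ∸ i) (walk i σ) ≡⟨ walk-stuck m (j ∸ i) ⟩
    walk i σ ∎
    where open ≡-Reasoning

  -- Backward steps undo forward ones, and the walk then stays at the start because it is stuck
  -- there. So the start is recovered from a later position without knowing how many steps led to
  -- it.
  trace-back : ∀ {σ} → Stuck (flip σ) → ∀ {i L} → i ≤ L → walk L (flip (walk i σ)) ≡ flip σ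
  trace-back m {zero} {L} _ = walk-stuck m L
  trace-back {σ} m {suc i} {suc L} (s≤s i≤L) = [ go-moving , go-stuck ]′ (moving-or-stuck (walk i σ))
    where
    open ≡-Reasoning
    go-moving : Moving (walk i σ) → walk (suc L) (flip (walk (suc i) σ)) ≡ flip σ
    go-moving mv = begin
      advance (walk L (flip (advance (walk i σ)))) ≡⟨ sym (walk-advance L _) ⟩
      walk L (advance (flip (advance (walk i σ)))) ≡⟨ cong (walk L) (advance-flip {walk i σ} mv) ⟩
      walk L (flip (walk i σ)) ≡⟨ trace-back {σ} m i≤L ⟩
      flip σ ∎
    go-stuck : Stuck (walk i σ) → walk (suc L) (flip (walk (suc i) σ)) ≡ flip σ
    go-stuck st = begin
      walk (suc L) (flip (advance (walk i σ))) ≡⟨ cong (walk (suc L) ∘ flip) (advance-stuck {walk i σ} st) ⟩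
      walk (suc L) (flip (walk i σ)) ≡⟨ trace-back {σ} m (ℕₚ.m≤n⇒m≤1+n i≤L) ⟩
      flip σ ∎

  colours-walk : ∀ {x y v} i → Colours x y (walk i (x , y , v))
  colours-walk zero = same
  colours-walk (suc i) = colours-advance (colours-walk i)

  meet : ∀ {x y σ τ} → Colours x y σ → Colours x y τ → vertex σ ≡ vertex τ → σ ≡ τ ⊎ σ ≡ flip τ
  meet same    same    refl = inj₁ refl
  meet same    swapped refl = inj₂ refl
  meet swapped same    refl = inj₂ refl
  meet swapped swapped refl = inj₁ refl

  flip-advance : ∀ {σ τ} → Moving τ → advance τ ≡ flip σ → advance σ ≡ flip τ
  flip-advance {σ} {τ} m e = trans (cong (advance ∘ flip) (sym e)) (advance-flip {τ} m)

  no-fixed-flip : ∀ {x y σ} → x ≢ y → Colours x y σ → σ ≢ flip σ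
  no-fixed-flip x≢y same    e = x≢y (cong proj₁ e)
  no-fixed-flip x≢y swapped e = x≢y (sym (cong proj₁ e))

  -- Cut one step off both ends until the turning point is reached: it would be a position equal to
  -- its own reversal, which needs `x ≡ y`, or an edge traversed onto itself, a loop.
  no-palindrome : ∀ {x y v} → x ≢ y → ∀ m i → (∀ l → l < m + i → Moving (walk l (x , y , v))) →
    walk (m + i) (x , y , v) ≢ flip (walk i (x , y , v))
  no-palindrome x≢y zero i mv e = no-fixed-flip x≢y (colours-walk i) e
  no-palindrome {x} {y} {v} x≢y (suc zero) i mv e with walk i (x , y , v) | mv i ℕₚ.≤-refl
  ... | (p , r , w) | (u , φwu) with trans (sym (advance-edge {y = r} φwu)) e
  ... | refl = adj-≢ {G = G} (edge-col proper φwu) refl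
  no-palindrome {x} {y} {v} x≢y (suc (suc m)) i mv e =
    no-palindrome x≢y m (suc i) (λ l l< → mv l (ℕₚ.≤-trans l< (ℕₚ.≤-trans (ℕₚ.≤-reflexive (ℕₚ.+-suc m i)) (ℕₚ.n≤1+n _))))
      (trans (cong (λ z → walk z (x , y , v)) (ℕₚ.+-suc m i))
        (flip-flip (flip-advance {walk i (x , y , v)} {walk (suc m + i) (x , y , v)} (mv (suc (m + i)) ℕₚ.≤-refl) e)))
    where
    flip-flip : ∀ {σ τ} → σ ≡ flip τ → τ ≡ flip σ
    flip-flip refl = refl

  -- The last edge of such a return would have colour `y` at `v`, which `v` misses.
  walk-back-stuck : ∀ {x y v} → Stuck (y , x , v) → ∀ m → (∀ l → l < suc m → Moving (walk l (x , y , v))) →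
    walk (suc m) (x , y , v) ≢ (x , y , v)
  walk-back-stuck {x} {y} {v} st m mv e with moving-back {walk m (x , y , v)} (mv m ℕₚ.≤-refl)
  ... | back with subst (Moving ∘ flip) e back
  ... | u , φvu = st u φvu

  -- Two visits to a vertex are equal positions or reversals of each other. Reversals form a
  -- palindrome; equal positions, traced back `i` steps, give a return to the start.
  walk-simple : ∀ {x y v} → x ≢ y → Stuck (y , x , v) → ∀ {L} → (∀ l → l < L → Moving (walk l (x , y , v))) →
    ∀ {i j} → i < j → j ≤ L → vertex (walk i (x , y , v)) ≢ vertex (walk j (x , y , v))
  walk-simple {x} {y} {v} x≢y st {L} mv {i} {j} i<j j≤L e with meet (colours-walk {x} {y} {v} j) (colours-walk {x} {y} {v} i) (sym e)
  ... | inj₂ fl = no-palindrome x≢y (j ∸ i) i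
        (λ l l< → mv l (ℕₚ.<-≤-trans l< (ℕₚ.≤-trans (ℕₚ.≤-reflexive (ℕₚ.m∸n+n≡m (ℕₚ.<⇒≤ i<j))) j≤L)))
        (trans (cong (λ z → walk z (x , y , v)) (ℕₚ.m∸n+n≡m (ℕₚ.<⇒≤ i<j))) fl)
  ... | inj₁ eq = go (j ∸ i) refl
    where
    σ : Position
    σ = x , y , v
    j≡ : i + (j ∸ i) ≡ j
    j≡ = ℕₚ.m+[n∸m]≡n (ℕₚ.<⇒≤ i<j)
    closes : walk (j ∸ i) σ ≡ σ
    closes = cong flip (begin
      flip (walk (j ∸ i) σ) ≡⟨ sym (back i (j ∸ i) (subst (_≤ L) (sym j≡) j≤L)) ⟩
      walk i (flip (walk (i + (j ∸ i)) σ)) ≡⟨ cong (λ z → walk i (flip (walk z σ))) j≡ ⟩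
      walk i (flip (walk j σ)) ≡⟨ cong (walk i ∘ flip) eq ⟩
      walk i (flip (walk i σ)) ≡⟨ trace-back {σ} st {i} {i} ℕₚ.≤-refl ⟩
      flip σ ∎)
      where
      open ≡-Reasoning
      back : ∀ a b → a + b ≤ L → walk a (flip (walk (a + b) σ)) ≡ flip (walk b σ)
      back zero b _ = refl
      back (suc a) b le = begin
        advance (walk a (flip (advance (walk (a + b) σ)))) ≡⟨ sym (walk-advance a _) ⟩
        walk a (advance (flip (advance (walk (a + b) σ)))) ≡⟨ cong (walk a) (advance-flip {walk (a + b) σ} (mv (a + b) le)) ⟩
        walk a (flip (walk (a + b) σ)) ≡⟨ back a b (ℕₚ.≤-trans (ℕₚ.n≤1+n _) le) ⟩
        flip (walk b σ) ∎
    go : ∀ m → m ≡ j ∸ i → ⊥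
    go zero m≡ = ℕₚ.<⇒≢ (ℕₚ.m<n⇒0<n∸m i<j) m≡
    go (suc m) m≡ = walk-back-stuck st m
      (λ l l< → mv l (ℕₚ.<-≤-trans l< (ℕₚ.≤-trans (ℕₚ.≤-reflexive m≡) (ℕₚ.≤-trans (ℕₚ.m∸n≤m j i) j≤L))))
      (trans (cong (λ z → walk z σ) m≡) closes)

module _ {n : ℕ} where

  SamePair : Fin n → Fin n → Fin n → Fin n → Set
  SamePair a b x y = (a ≡ x × b ≡ y) ⊎ (a ≡ y × b ≡ x)

  abstract
    samePair? : ∀ a b x y → Dec (SamePair a b x y)
    samePair? a b x y = ((a ≟ᶠ x) ×-dec (b ≟ᶠ y)) ⊎-dec ((a ≟ᶠ y) ×-dec (b ≟ᶠ x))

  samePair-swap : ∀ {a b x y} → SamePair a b x y → SamePair b a x y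
  samePair-swap (inj₁ (p , q)) = inj₂ (q , p)
  samePair-swap (inj₂ (p , q)) = inj₁ (q , p)

  samePair-swapʳ : ∀ {a b x y} → SamePair a b x y → SamePair a b y x
  samePair-swapʳ (inj₁ e) = inj₂ e
  samePair-swapʳ (inj₂ e) = inj₁ e

  samePair-end : ∀ {a b x y} → SamePair a b x y → a ≡ x ⊎ a ≡ y
  samePair-end (inj₁ (p , _)) = inj₁ p
  samePair-end (inj₂ (p , _)) = inj₂ p

module _ {n k : ℕ} where

  recolour : PartialColouring n k → Fin n → Fin n → Maybe (Fin k) → PartialColouring n k
  recolour φ x y m a b = if does (samePair? a b x y) then m else φ a b

  recolour-hit : ∀ (φ : PartialColouring n k) {x y m a b} → SamePair a b x y → recolour φ x y m a b ≡ m
  recolour-hit φ {x} {y} {m} {a} {b} h rewrite dec-true (samePair? a b x y) h = refl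

  recolour-miss : ∀ (φ : PartialColouring n k) {x y m a b} → ¬ SamePair a b x y → recolour φ x y m a b ≡ φ a b
  recolour-miss φ {x} {y} {m} {a} {b} h rewrite dec-false (samePair? a b x y) h = refl

  module _ {G : Graph n} {φ : PartialColouring n k} (proper : Proper G φ) where

    missing-≢ : ∀ {v u c c′} → Missing φ v c′ → φ v u ≡ just c → c′ ≢ c
    missing-≢ m e refl = m _ e

    uncolour-proper : ∀ x y → Proper G (recolour φ x y nothing)
    sym-col (uncolour-proper x y) a b with samePair? a b x y
    ... | yes h = sym (recolour-hit φ (samePair-swap h))
    ... | no ¬h = trans (sym-col proper a b) (sym (recolour-miss φ (¬h ∘ samePair-swap)))
    edge-col (uncolour-proper x y) {a} {b} e with samePair? a b x y
    edge-col (uncolour-proper x y) () | yes _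
    edge-col (uncolour-proper x y) e  | no _ = edge-col proper e
    matching (uncolour-proper x y) {a} {b} {b′} e e′ with samePair? a b x y | samePair? a b′ x y
    matching (uncolour-proper x y) () e′ | yes _ | _
    matching (uncolour-proper x y) e () | no _ | yes _
    matching (uncolour-proper x y) e e′ | no _ | no _ = matching proper e e′

    colour-proper : ∀ {x y c} → adj G x y ≡ true → Missing φ x c → Missing φ y c → Proper G (recolour φ x y (just c))
    sym-col (colour-proper {x} {y} _ _ _) a b with samePair? a b x y
    ... | yes h = sym (recolour-hit φ (samePair-swap h))
    ... | no ¬h = trans (sym-col proper a b) (sym (recolour-miss φ (¬h ∘ samePair-swap)))
    edge-col (colour-proper {x} {y} xy _ _) {a} {b} e with samePair? a b x y
    ... | yes (inj₁ (refl , refl)) = xy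
    ... | yes (inj₂ (refl , refl)) = adj-sym {G = G} xy
    ... | no _ = edge-col proper e
    matching (colour-proper {x} {y} xy mx my) {a} {b} {b′} e e′ with samePair? a b x y | samePair? a b′ x y
    matching (colour-proper xy mx my) e e′ | yes (inj₁ (refl , refl)) | yes (inj₁ (_ , refl)) = refl
    matching (colour-proper xy mx my) e e′ | yes (inj₁ (refl , refl)) | yes (inj₂ (refl , refl)) = refl
    matching (colour-proper xy mx my) e e′ | yes (inj₂ (refl , refl)) | yes (inj₁ (refl , refl)) = refl
    matching (colour-proper xy mx my) e e′ | yes (inj₂ (refl , refl)) | yes (inj₂ (_ , refl)) = refl
    matching (colour-proper xy mx my) refl e′ | yes h | no _ = ⊥-elim (clash (samePair-end h))
      where
      clash : _ → ⊥
      clash (inj₁ refl) = mx _ e′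
      clash (inj₂ refl) = my _ e′
    matching (colour-proper xy mx my) e refl | no _ | yes h = ⊥-elim (clash (samePair-end h))
      where
      clash : _ → ⊥
      clash (inj₁ refl) = mx _ e
      clash (inj₂ refl) = my _ e
    matching (colour-proper xy mx my) e e′ | no _ | no _ = matching proper e e′

  missing-uncolour : ∀ (φ : PartialColouring n k) {x y v c} → Missing φ v c → Missing (recolour φ x y nothing) v c
  missing-uncolour φ {x} {y} {v} m u e with samePair? v u x y
  missing-uncolour φ m u () | yes _
  missing-uncolour φ m u e  | no _ = m u e

  missing-colour : ∀ (φ : PartialColouring n k) {x y v c c′} → Missing φ v c′ → (v ≡ x ⊎ v ≡ y → c′ ≢ c) →
    Missing (recolour φ x y (just c)) v c′
  missing-colour φ {x} {y} {v} m ne u e with samePair? v u x y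
  ... | yes h = ne (samePair-end h) (sym (Maybeₚ.just-injective e))
  ... | no _ = m u e

  -- The hole moves from pr to rs, whose colour c it leaves on pr.
  shift : PartialColouring n k → Fin n → Fin n → Fin n → Fin k → PartialColouring n k
  shift φ p r s c = recolour (recolour φ r s nothing) p r (just c)

  module Shift {G : Graph n} {φ : PartialColouring n k} (proper : Proper G φ) {p r s : Fin n} {c : Fin k}
    (pr : adj G p r ≡ true) (p≢s : p ≢ s) (rs : φ r s ≡ just c) (p-misses : Missing φ p c) where

    private
      φ₀ : PartialColouring n k
      φ₀ = recolour φ r s nothing

      freed : ∀ {a b} → SamePair a b r s → Missing φ₀ a c
      freed {a} {b} h u e with samePair? a u r s
      freed h u () | yes _
      freed (inj₁ (refl , refl)) u e | no ¬h = ¬h (inj₁ (refl , matching proper e rs))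
      freed (inj₂ (refl , refl)) u e | no ¬h = ¬h (inj₂ (refl , matching proper e (trans (sym-col proper s r) rs)))

      p≢r : p ≢ r
      p≢r = adj-≢ {G = G} pr

      ¬pr : ¬ SamePair r s p r
      ¬pr (inj₁ (e , _)) = p≢r (sym e)
      ¬pr (inj₂ (_ , e)) = p≢s (sym e)

    shift-proper : Proper G (shift φ p r s c)
    shift-proper = colour-proper (uncolour-proper proper r s) pr (missing-uncolour φ p-misses) (freed (inj₁ (refl , refl)))

    shift-hole : shift φ p r s c r s ≡ nothing
    shift-hole = trans (recolour-miss φ₀ ¬pr) (recolour-hit φ (inj₁ (refl , refl)))

    shift-off : ∀ {a b} → ¬ SamePair a b p r → ¬ SamePair a b r s → shift φ p r s c a b ≡ φ a b
    shift-off ¬h ¬h′ = trans (recolour-miss φ₀ ¬h) (recolour-miss φ ¬h′)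

    -- Only `p` receives a colour that it did not have: `r` had `c` on `rs` before.
    shift-missing : ∀ {v c′} → Missing φ v c′ → (v ≡ p → c′ ≢ c) → Missing (shift φ p r s c) v c′
    shift-missing {v} m ne = missing-colour φ₀ (missing-uncolour φ m) λ where
      (inj₁ v≡p) → ne v≡p
      (inj₂ refl) → missing-≢ proper m rs

    shift-freed : Missing (shift φ p r s c) s c
    shift-freed = missing-colour φ₀ (freed (inj₂ (refl , refl))) λ where
      (inj₁ s≡p) → ⊥-elim (p≢s (sym s≡p))
      (inj₂ s≡r) → ⊥-elim (adj-≢ {G = G} (edge-col proper rs) (sym s≡r))

    shift-uncoloured : ∀ {a b} → shift φ p r s c a b ≡ nothing → SamePair a b r s ⊎ (φ a b ≡ nothing × ¬ SamePair a b p r)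
    shift-uncoloured {a} {b} e with samePair? a b p r
    shift-uncoloured () | yes _
    shift-uncoloured {a} {b} e | no ¬h with samePair? a b r s
    ... | yes h = inj₁ h
    ... | no _ = inj₂ (e , ¬h)

    shift-keeps : ∀ {a b c′} → φ p r ≡ nothing → c′ ≢ c → φ a b ≡ just c′ → shift φ p r s c a b ≡ just c′
    shift-keeps {a} {b} hole c′≢c e = trans (shift-off ¬h ¬h′) e
      where
      ¬h : ¬ SamePair a b p r
      ¬h (inj₁ (refl , refl)) with trans (sym hole) e
      ... | ()
      ¬h (inj₂ (refl , refl)) with trans (sym hole) (trans (sym-col proper p r) e)
      ... | ()
      ¬h′ : ¬ SamePair a b r s
      ¬h′ (inj₁ (refl , refl)) = c′≢c (Maybeₚ.just-injective (trans (sym e) rs))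
      ¬h′ (inj₂ (refl , refl)) = c′≢c (Maybeₚ.just-injective (trans (sym e) (trans (sym-col proper s r) rs)))

-- Vizing chains

module Chains {n k : ℕ} {G : Graph n} {φ : PartialColouring n k} (proper : Proper G φ)
  (free : Fin n → Fin k) (free-missing : ∀ v → Missing φ v (free v)) where

  open Walk G φ proper public

  -- The rotation of the hole wu about w, listing the vertices passed before y in reverse order.
  data Fan (w u : Fin n) (α : Maybe (Fin k)) : Fin n → List (Fin n) → Set where
    start : Fan w u α u []
    turn  : ∀ {y ys y′} → Fan w u α y ys → φ w y′ ≡ just (free y) → y′ ≢ u → α ≢ just (free y) →
            (∀ {z} → z ∈ ys → free z ≢ free y) → Fan w u α y′ (y ∷ ys)

  module _ {w u : Fin n} {α : Maybe (Fin k)} where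

    fan-adj : adj G w u ≡ true → ∀ {y ys z} → Fan w u α y ys → z ∈ y ∷ ys → adj G w z ≡ true
    fan-adj wu start (here refl) = wu
    fan-adj wu (turn fan e _ _ _) (here refl) = edge-col proper e
    fan-adj wu (turn fan _ _ _ _) (there z∈) = fan-adj wu fan z∈

    fan-pred : ∀ {y ys z} → Fan w u α y ys → z ∈ y ∷ ys → z ≡ u ⊎ ∃ λ z′ → z′ ∈ ys × φ w z ≡ just (free z′)
    fan-pred start (here refl) = inj₁ refl
    fan-pred (turn fan e _ _ _) (here refl) = inj₂ (_ , here refl , e)
    fan-pred (turn fan _ _ _ _) (there z∈) with fan-pred fan z∈
    ... | inj₁ p = inj₁ p
    ... | inj₂ (z′ , z′∈ , e) = inj₂ (z′ , there z′∈ , e)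

    -- An earlier occurrence of `y′` would give its edge to `w` the free colour of some earlier fan
    -- vertex, and the free colours are distinct.
    fan-fresh : ∀ {y ys y′} → Fan w u α y ys → φ w y′ ≡ just (free y) → y′ ≢ u →
      (∀ {z} → z ∈ ys → free z ≢ free y) → y′ ∉ y ∷ ys
    fan-fresh fan e y′≢u distinct y′∈ with fan-pred fan y′∈
    ... | inj₁ p = y′≢u p
    ... | inj₂ (z′ , z′∈ , e′) = distinct z′∈ (Maybeₚ.just-injective (trans (sym e′) e))

    fan-unique : ∀ {y ys} → Fan w u α y ys → Unique (y ∷ ys)
    fan-unique start = [] ∷ []
    fan-unique (turn fan e ne _ distinct) =
      All.tabulate (λ { z∈ refl → fan-fresh fan e ne distinct z∈ }) ∷ fan-unique fan

    -- The colours already turned through are present at `w` on edges other than `wu`; this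
    -- separates them from `free w`, from `φ w u` and from `α`.
    fan-spent : ∀ {y ys z} → Fan w u α y ys → z ∈ ys →
      (∃ λ z′ → φ w z′ ≡ just (free z) × z′ ≢ u) × α ≢ just (free z)
    fan-spent (turn fan e ne a _) (here refl) = (_ , e , ne) , a
    fan-spent (turn fan _ _ _ _) (there z∈) = fan-spent fan z∈

    fan-prefix : ∀ {y ys z} → Fan w u α y ys → z ∈ ys →
      ∃ λ zs → Fan w u α z zs × (∀ {z′} → z′ ∈ zs → free z′ ≢ free z)
    fan-prefix (turn {ys = ys} fan _ _ _ distinct) (here refl) = ys , fan , distinct
    fan-prefix (turn fan _ _ _ _) (there z∈) = fan-prefix fan z∈

  -- The fan is read off `φ` but rotated in `ψ`. For this the two must agree at `w` apart from `wu`,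
  -- and the neighbours of `w` must still miss their free colours. `Open` describes the uncoloured
  -- edges other than the hole.
  module FanShift {ψ : PartialColouring n k} (ψ-proper : Proper G ψ) (Open : Fin n → Fin n → Set)
    {w u : Fin n} (wu : adj G w u ≡ true) (hole : ψ w u ≡ nothing)
    (uncoloured : ∀ a b → ψ a b ≡ nothing → Open a b ⊎ SamePair a b w u)
    (hub : ∀ z → z ≢ u → ψ w z ≡ φ w z)
    (still-free : ∀ z → adj G w z ≡ true → Missing ψ z (free z)) where

    record Fanned (y : Fin n) (ys : List (Fin n)) (χ : PartialColouring n k) : Set where
      field
        f-proper     : Proper G χ
        f-adj        : adj G w y ≡ true
        f-hole       : χ w y ≡ nothing
        f-uncoloured : ∀ a b → χ a b ≡ nothing → Open a b ⊎ SamePair a b w y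
        f-off        : ∀ a b → a ≢ w → b ≢ w → χ a b ≡ ψ a b
        f-hub        : ∀ z → z ∉ y ∷ ys → χ w z ≡ ψ w z
        f-missing-w  : ∀ c → Missing ψ w c → Missing χ w c
        f-missing    : ∀ v c → v ≢ w → Missing ψ v c → (v ∈ ys → free v ≢ c) → Missing χ v c
    open Fanned public

    fanned-same : ∀ {y ys χ} → Fanned y ys χ → ∀ v z → v ≢ w → z ≢ w ⊎ v ∉ y ∷ ys → χ v z ≡ ψ v z
    fanned-same {χ = χ} F v z v≢w h with z ≟ᶠ w
    ... | no z≢w = f-off F v z v≢w z≢w
    fanned-same F v z v≢w (inj₁ z≢w) | yes z≡w = ⊥-elim (z≢w z≡w)
    fanned-same F v z v≢w (inj₂ v∉) | yes refl =
      trans (sym-col (f-proper F) v z) (trans (f-hub F v v∉) (sym-col ψ-proper z v))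

    fan-shift : ∀ {α y ys} → Fan w u α y ys → ∃ λ χ → Fanned y ys χ
    fan-shift start = ψ , record
      { f-proper = ψ-proper ; f-adj = wu ; f-hole = hole ; f-uncoloured = uncoloured
      ; f-off = λ _ _ _ _ → refl ; f-hub = λ _ _ → refl ; f-missing-w = λ _ m → m ; f-missing = λ _ _ _ m _ → m }
    fan-shift {α} (turn {y} {ys} {y′} fan e y′≢u a distinct) with fan-shift fan
    ... | χ , F = shift χ y w y′ (free y) , record
      { f-proper = shift-proper
      ; f-adj = edge-col proper e
      ; f-hole = shift-hole
      ; f-uncoloured = unc
      ; f-off = λ p q p≢w q≢w → trans (shift-off (off p≢w q≢w) (off′ p≢w q≢w)) (f-off F p q p≢w q≢w)
      ; f-hub = λ z z∉ → trans (shift-off (hub₁ z∉) (hub₂ z∉)) (f-hub F z (z∉ ∘ there))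
      ; f-missing-w = λ c m → shift-missing (f-missing-w F c m) (λ w≡y → ⊥-elim (w≢y w≡y))
      ; f-missing = λ v c v≢w m ne → shift-missing (f-missing F v c v≢w m (ne ∘ there)) (λ { refl → ne (here refl) ∘ sym })
      }
      where
      fresh : y′ ∉ y ∷ ys
      fresh = fan-fresh fan e y′≢u distinct
      y∉ys : y ∉ ys
      y∉ys y∈ with fan-unique fan
      ... | y# ∷ _ = All.lookup y# y∈ refl
      w≢y : w ≢ y
      w≢y = adj-≢ {G = G} (f-adj F)
      w≢y′ : w ≢ y′
      w≢y′ = adj-≢ {G = G} (edge-col proper e)
      χwy′ : χ w y′ ≡ just (free y)
      χwy′ = trans (f-hub F y′ fresh) (trans (hub y′ y′≢u) e)
      open Shift (f-proper F) {y} {w} {y′} (adj-sym {G = G} (f-adj F)) (λ y≡y′ → fresh (here (sym y≡y′))) χwy′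
        (f-missing F y (free y) (w≢y ∘ sym) (still-free y (f-adj F)) (λ y∈ _ → y∉ys y∈))
      unc : ∀ p q → shift χ y w y′ (free y) p q ≡ nothing → Open p q ⊎ SamePair p q w y′
      unc p q h with shift-uncoloured h
      ... | inj₁ s = inj₂ s
      ... | inj₂ (h′ , ¬s) with f-uncoloured F p q h′
      ... | inj₁ o = inj₁ o
      ... | inj₂ s = ⊥-elim (¬s (samePair-swapʳ s))
      off : ∀ {p q} → p ≢ w → q ≢ w → ¬ SamePair p q y w
      off p≢w q≢w (inj₁ (_ , r)) = q≢w r
      off p≢w q≢w (inj₂ (r , _)) = p≢w r
      off′ : ∀ {p q} → p ≢ w → q ≢ w → ¬ SamePair p q w y′
      off′ p≢w q≢w (inj₁ (r , _)) = p≢w r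
      off′ p≢w q≢w (inj₂ (_ , r)) = q≢w r
      hub₁ : ∀ {z} → z ∉ y′ ∷ y ∷ ys → ¬ SamePair w z y w
      hub₁ z∉ (inj₁ (r , _)) = w≢y r
      hub₁ z∉ (inj₂ (_ , r)) = z∉ (there (here r))
      hub₂ : ∀ {z} → z ∉ y′ ∷ y ∷ ys → ¬ SamePair w z w y′
      hub₂ z∉ (inj₁ (_ , r)) = z∉ (here r)
      hub₂ z∉ (inj₂ (r , _)) = w≢y′ r

  -- The walk avoids `w`, while every edge of the fan contains it, so the rotation leaves the edges
  -- of the walk alone.
  module PathShift {ψ : PartialColouring n k} (ψ-proper : Proper G ψ) (Open : Fin n → Fin n → Set)
    {w u : Fin n} (wu : adj G w u ≡ true) (hole : ψ w u ≡ nothing)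
    (uncoloured : ∀ a b → ψ a b ≡ nothing → Open a b ⊎ SamePair a b w u)
    (hub : ∀ z → z ≢ u → ψ w z ≡ φ w z)
    (still-free : ∀ z → adj G w z ≡ true → Missing ψ z (free z))
    {α : Maybe (Fin k)} {y : Fin n} {ys : List (Fin n)} (fan : Fan w u α y ys)
    {a : Fin k} (a≢b : a ≢ free y) (w-misses : Missing ψ w a) {L : ℕ}
    (avoids : ∀ i → i ≤ L → vertex (walk i (a , free y , y)) ≢ w)
    (intact : ∀ i v → i < L → φ (vertex (walk i (a , free y , y))) v ≡ just (proj₁ (walk i (a , free y , y))) →
      ψ (vertex (walk i (a , free y , y))) v ≡ just (proj₁ (walk i (a , free y , y)))) where

    open FanShift ψ-proper Open wu hole uncoloured hub still-free

    private
      σ : Position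
      σ = a , free y , y

      y∉ys : y ∉ ys
      y∉ys y∈ with fan-unique fan
      ... | y# ∷ _ = All.lookup y# y∈ refl

    -- The hole is pr, where r is the i-th vertex of the walk, left along colour x, and p precedes r.
    record Shifted (i : ℕ) (p : Fin n) (x x′ : Fin k) (r : Fin n) (χ : PartialColouring n k) : Set where
      field
        s-at         : walk i σ ≡ (x , x′ , r)
        s-proper     : Proper G χ
        s-adj        : adj G p r ≡ true
        s-hole       : χ p r ≡ nothing
        s-uncoloured : ∀ c d → χ c d ≡ nothing → Open c d ⊎ SamePair c d p r
        s-prev       : p ≡ w ⊎ ∃ λ l → l < i × p ≡ vertex (walk l σ)
        -- Off the fan, a path vertex only receives a colour that it already has in `φ`. Hence
        -- colours missing in `φ` stay missing even on the path, which is `s-missing`.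
        s-had        : p ≢ w → p ∉ y ∷ ys → ∃ λ z → φ p z ≡ just x
        s-had′       : r ∈ y ∷ ys ⊎ ∃ λ z → φ r z ≡ just x′
        s-misses     : Missing χ p x
        s-misses′    : Missing χ r x′
        -- The alternative `z ≢ p` admits `r` itself away from the hole: `r` is the hub of the next
        -- fan.
        s-same       : ∀ v z → v ≢ w → (∀ l → l < i → v ≢ vertex (walk l σ)) → v ≢ r ⊎ z ≢ p → z ≢ w ⊎ v ∉ y ∷ ys →
                       χ v z ≡ ψ v z
        s-missing    : ∀ v c → v ≢ w → v ∉ y ∷ ys → Missing φ v c → Missing ψ v c → Missing χ v c
        s-missing′   : ∀ v c → v ≢ w → (∀ l → l < i → v ≢ vertex (walk l σ)) → Missing ψ v c → (v ∈ ys → free v ≢ c) →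
                       Missing χ v c
        s-keeps      : ∀ v z c → v ≢ w → v ∉ y ∷ ys → c ≢ a → c ≢ free y → ψ v z ≡ just c → χ v z ≡ just c
    open Shifted public

    begin-shift : ∃ λ χ → Shifted 0 w a (free y) y χ
    begin-shift with fan-shift fan
    ... | χ , F = χ , record
      { s-at = refl
      ; s-proper = f-proper F
      ; s-adj = f-adj F
      ; s-hole = f-hole F
      ; s-uncoloured = f-uncoloured F
      ; s-prev = inj₁ refl
      ; s-had = λ ne → ⊥-elim (ne refl)
      ; s-had′ = inj₁ (here refl)
      ; s-misses = f-missing-w F a w-misses
      ; s-misses′ = f-missing F y (free y) y≢w (still-free y (f-adj F)) (λ y∈ → ⊥-elim (y∉ys y∈))
      ; s-same = λ v z v≢w _ _ h → fanned-same F v z v≢w h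
      ; s-missing = λ v c v≢w v∉ _ m → f-missing F v c v≢w m (λ v∈ → ⊥-elim (v∉ (there v∈)))
      ; s-missing′ = λ v c v≢w _ m ne → f-missing F v c v≢w m ne
      ; s-keeps = λ v z c v≢w v∉ _ _ e → trans (fanned-same F v z v≢w (inj₂ v∉)) e
      }
      where
      y≢w : y ≢ w
      y≢w = adj-≢ {G = G} (f-adj F) ∘ sym

    continue : ∀ {i p x x′ r r′ χ} → Shifted i p x x′ r χ → i < L → (∀ l → l < i → Moving (walk l σ)) →
      φ r r′ ≡ just x → Shifted (suc i) r x′ x r′ (shift χ p r r′ x)
    continue {i} {p} {x} {x′} {r} {r′} {χ} S i<L moving e = record
      { s-at = at′
      ; s-proper = shift-proper
      ; s-adj = edge-col proper e
      ; s-hole = shift-hole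
      ; s-uncoloured = unc
      ; s-prev = inj₂ (i , ℕₚ.≤-refl , sym r-at)
      ; s-had = λ _ r∉ → [ (λ r∈ → ⊥-elim (r∉ r∈)) , id ]′ (s-had′ S)
      ; s-had′ = inj₂ (r , trans (sym-col proper r′ r) e)
      ; s-misses = shift-missing (s-misses′ S) (λ r≡p → ⊥-elim (adj-≢ {G = G} (s-adj S) (sym r≡p)))
      ; s-misses′ = shift-freed
      ; s-same = same-as
      ; s-missing = λ v c v≢w v∉ m m′ → shift-missing (s-missing S v c v≢w v∉ m m′) (λ { refl refl → m _ (proj₂ (s-had S v≢w v∉)) })
      ; s-missing′ = λ v c v≢w far m ne → shift-missing (s-missing′ S v c v≢w (λ l l< → far l (ℕₚ.m≤n⇒m≤1+n l<)) m ne)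
                       (λ v≡p → ⊥-elim (not-p v≢w far v≡p))
      ; s-keeps = λ v z c v≢w v∉ c≢a c≢b h → shift-keeps (s-hole S) (c≢x c≢a c≢b) (s-keeps S v z c v≢w v∉ c≢a c≢b h)
      }
      where
      r-at : vertex (walk i σ) ≡ r
      r-at = cong vertex (s-at S)
      at′ : walk (suc i) σ ≡ (x′ , x , r′)
      at′ = trans (cong advance (s-at S)) (advance-edge e)
      moving′ : ∀ l → l < suc i → Moving (walk l σ)
      moving′ l (s≤s l≤i) with ℕₚ.m≤n⇒m<n∨m≡n l≤i
      ... | inj₁ l<i = moving l l<i
      ... | inj₂ refl = subst Moving (sym (s-at S)) (r′ , e)
      r′-new : ∀ l → l < suc i → r′ ≢ vertex (walk l σ)
      r′-new l l< r′≡ = walk-simple a≢b (free-missing y) moving′ l< ℕₚ.≤-refl (trans (sym r′≡) (sym (cong vertex at′)))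
      r′≢w : r′ ≢ w
      r′≢w r′≡ = avoids (suc i) i<L (trans (cong vertex at′) r′≡)
      r≢w : r ≢ w
      r≢w r≡ = avoids i (ℕₚ.<⇒≤ i<L) (trans r-at r≡)
      p≢r′ : p ≢ r′
      p≢r′ p≡r′ with s-prev S
      ... | inj₁ p≡w = r′≢w (trans (sym p≡r′) p≡w)
      ... | inj₂ (l , l< , p≡) = r′-new l (ℕₚ.m≤n⇒m≤1+n l<) (trans (sym p≡r′) p≡)
      ψrr′ : ψ r r′ ≡ just x
      ψrr′ = subst (λ τ → ψ (vertex τ) r′ ≡ just (proj₁ τ)) (s-at S)
        (intact i r′ i<L (subst (λ τ → φ (vertex τ) r′ ≡ just (proj₁ τ)) (sym (s-at S)) e))
      -- Read in the row of `r′`, which the walk has not visited yet; the row of `r` already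
      -- contains the hole.
      χrr′ : χ r r′ ≡ just x
      χrr′ = begin
        χ r r′ ≡⟨ sym-col (s-proper S) r r′ ⟩
        χ r′ r ≡⟨ s-same S r′ r r′≢w (λ l l< → r′-new l (ℕₚ.m≤n⇒m≤1+n l<)) (inj₁ (adj-≢ {G = G} (edge-col proper e) ∘ sym)) (inj₁ r≢w) ⟩
        ψ r′ r ≡⟨ sym-col ψ-proper r′ r ⟩
        ψ r r′ ≡⟨ ψrr′ ⟩
        just x ∎
        where open ≡-Reasoning
      open Shift (s-proper S) {p} {r} {r′} (s-adj S) p≢r′ χrr′ (s-misses S)
      unc : ∀ c d → shift χ p r r′ x c d ≡ nothing → Open c d ⊎ SamePair c d r r′
      unc c d h with shift-uncoloured h
      ... | inj₁ s = inj₂ s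
      ... | inj₂ (h′ , ¬s) with s-uncoloured S c d h′
      ... | inj₁ o = inj₁ o
      ... | inj₂ s = ⊥-elim (¬s s)
      not-p : ∀ {v} → v ≢ w → (∀ l → l < suc i → v ≢ vertex (walk l σ)) → v ≢ p
      not-p v≢w far v≡p with s-prev S
      ... | inj₁ p≡w = v≢w (trans v≡p p≡w)
      ... | inj₂ (l , l< , p≡) = far l (ℕₚ.m≤n⇒m≤1+n l<) (trans v≡p p≡)
      same-as : ∀ v z → v ≢ w → (∀ l → l < suc i → v ≢ vertex (walk l σ)) → v ≢ r′ ⊎ z ≢ r → z ≢ w ⊎ v ∉ y ∷ ys →
        shift χ p r r′ x v z ≡ ψ v z
      same-as v z v≢w far h h′ = trans (shift-off ¬pr ¬rr′) (s-same S v z v≢w (λ l l< → far l (ℕₚ.m≤n⇒m≤1+n l<)) (inj₁ v≢r) h′)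
        where
        v≢r : v ≢ r
        v≢r v≡r = far i ℕₚ.≤-refl (trans v≡r (sym r-at))
        ¬pr : ¬ SamePair v z p r
        ¬pr (inj₁ (v≡p , _)) = not-p v≢w far v≡p
        ¬pr (inj₂ (v≡r , _)) = v≢r v≡r
        ¬rr′ : ¬ SamePair v z r r′
        ¬rr′ (inj₁ (v≡r , _)) = v≢r v≡r
        ¬rr′ (inj₂ (v≡r′ , z≡r)) = [ (λ v≢r′ → v≢r′ v≡r′) , (λ z≢r → z≢r z≡r) ]′ h
      c≢x : ∀ {c} → c ≢ a → c ≢ free y → c ≢ x
      c≢x c≢a c≢b c≡x with walk i σ | colours-walk {a} {free y} {y} i | s-at S
      ... | _ | same | refl = c≢a c≡x
      ... | _ | swapped | refl = c≢b c≡x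

    shift-along : ∀ i → i ≤ L → (∀ l → l < i → Moving (walk l σ)) →
      ∃ λ p → ∃ λ χ → Shifted i p (proj₁ (walk i σ)) (proj₁ (proj₂ (walk i σ))) (vertex (walk i σ)) χ
    shift-along zero _ _ = w , begin-shift
    shift-along (suc i) i<L moving with shift-along i (ℕₚ.<⇒≤ i<L) (λ l l< → moving l (ℕₚ.m≤n⇒m≤1+n l<)) | moving i ℕₚ.≤-refl
    ... | p , χ , S | r′ , e = vertex (walk i σ) , shift χ p (vertex (walk i σ)) r′ (proj₁ (walk i σ)) ,
      subst (λ τ → Shifted (suc i) (vertex (walk i σ)) (proj₁ τ) (proj₁ (proj₂ τ)) (vertex τ) (shift χ p (vertex (walk i σ)) r′ (proj₁ (walk i σ))))
        (sym (advance-edge e)) (continue S i<L (λ l l< → moving l (ℕₚ.m≤n⇒m≤1+n l<)) e)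

-- The chain at a hole and the digraph of holes

module Outcomes {n k : ℕ} {G : Graph n} {φ : PartialColouring n k} (proper : Proper G φ)
  (free : Fin n → Fin k) (free-missing : ∀ v → Missing φ v (free v)) (d : ℕ) (degree≤d : DegreeAtMost d G) (ℓ : ℕ) where

  open Chains {G = G} proper free free-missing public

  L : ℕ
  L = 2 + ℓ

  -- (u , w , α): the hole is wu, and α is a colour that the previous chain took away from u.
  State′ : Set
  State′ = Fin n × Fin n × Maybe (Fin k)

  Valid : State′ → Set
  Valid (u , w , α) = adj G w u ≡ true × (∀ {b} → α ≡ just b → ∃ λ a → φ w u ≡ just a)

  Avoids : Position → Fin n → Set
  Avoids σ v = ∀ i → i ≤ L → vertex (walk i σ) ≢ v

  -- A chain for every state, so that successors are a function of the state. The colour `a` is one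
  -- that `w` misses once the hole is there. In the first alternative `free y` is neither `α` nor
  -- `φ w u`, the two colours of the preceding path; in the second the path has exactly these two.
  -- The conditions on `ys` are there because the rotation gives each `z ∈ ys` its own free colour.
  data Outcome : State′ → Set where
    idle : ∀ {s} → ¬ Valid s → Outcome s
    done : ∀ {u w α} → Valid (u , w , α) → ∀ {y ys} → Fan w u α y ys → Missing φ w (free y) ⊎ φ w u ≡ just (free y) → Outcome (u , w , α)
    path : ∀ {u w α} → Valid (u , w , α) → ∀ {y ys} → Fan w u α y ys → ∀ a → a ≢ free y → (∀ {z} → z ∈ ys → free z ≢ a) →
           (∀ {z} → z ∈ ys → free z ≡ free y → Avoids (a , free y , y) z) →
           (a ≡ free w × α ≢ just (free y) × φ w u ≢ just (free y) × Avoids (a , free y , y) w)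
             ⊎ (α ≡ just (free y) × φ w u ≡ just a) →
           Outcome (u , w , α)

  private
    avoids? : ∀ σ v → Avoids σ v ⊎ ∃ λ i → i ≤ L × vertex (walk i σ) ≡ v
    avoids? σ v with Finₚ.any? (λ (i : Fin (suc L)) → vertex (walk (toℕ i) σ) ≟ᶠ v)
    ... | yes (i , e) = inj₂ (toℕ i , ℕₚ.≤-pred (Finₚ.toℕ<n i) , e)
    ... | no ¬hit = inj₁ λ i i≤L e → ¬hit (fromℕ< (s≤s i≤L) , trans (cong (λ j → vertex (walk j σ)) (Finₚ.toℕ-fromℕ< (s≤s i≤L))) e)

    -- A walk arriving at `w` along `a` is impossible, since `w` misses `a`: traced back, it would
    -- never leave `w` and would have its colours in the wrong order.
    ends-at : ∀ {a b v w i} → a ≢ b → Missing φ v b → Missing φ w a → i ≤ L → vertex (walk i (a , b , v)) ≡ w →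
      walk i (a , b , v) ≡ (a , b , w)
    ends-at {a} {b} {v} {w} {i} a≢b v-misses w-misses i≤L e
      with meet (colours-walk {a} {b} {v} i) (same {a} {b} {w}) e
    ... | inj₁ eq = eq
    ... | inj₂ eq = ⊥-elim (a≢b (cong proj₁ (begin
        (a , b , w) ≡⟨ sym (walk-stuck {a , b , w} w-misses L) ⟩
        walk L (a , b , w) ≡⟨ cong (walk L ∘ flip) (sym eq) ⟩
        walk L (flip (walk i (a , b , v))) ≡⟨ trace-back {a , b , v} v-misses i≤L ⟩
        (b , a , v) ∎)))
      where open ≡-Reasoning

    -- The component of w in the graph of the two colours is a path with one other end, so at most
    -- one of two walks from distinct ends reaches w, and then the other one misses that walk.
    module _ {a b z y w m} (a≢b : a ≢ b) (z-misses : Missing φ z b) (y-misses : Missing φ y b) (w-misses : Missing φ w a)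
      (z≢y : z ≢ y) (m≤L : m ≤ L) (hit : vertex (walk m (a , b , z)) ≡ w) where

      private
        arrives : walk m (a , b , z) ≡ (a , b , w)
        arrives = ends-at a≢b z-misses w-misses m≤L hit

      other-avoids-hub : Avoids (a , b , y) w
      other-avoids-hub i i≤L e = z≢y (cong vertex (begin
        flip (a , b , z) ≡⟨ sym (trace-back {a , b , z} z-misses m≤L) ⟩
        walk L (flip (walk m (a , b , z))) ≡⟨ cong (walk L ∘ flip) (trans arrives (sym (ends-at a≢b y-misses w-misses i≤L e))) ⟩
        walk L (flip (walk i (a , b , y))) ≡⟨ trace-back {a , b , y} y-misses i≤L ⟩
        flip (a , b , y) ∎))
        where open ≡-Reasoning

      other-avoids-end : Avoids (a , b , y) z
      other-avoids-end i i≤L e with meet (colours-walk {a} {b} {y} i) (same {a} {b} {z}) e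
      ... | inj₁ eq = z≢y (cong vertex (begin
        flip (a , b , z) ≡⟨ sym (walk-stuck {b , a , z} z-misses L) ⟩
        walk L (flip (a , b , z)) ≡⟨ cong (walk L ∘ flip) (sym eq) ⟩
        walk L (flip (walk i (a , b , y))) ≡⟨ trace-back {a , b , y} y-misses i≤L ⟩
        flip (a , b , y) ∎))
        where open ≡-Reasoning
      ... | inj₂ eq = a≢b (cong proj₁ (begin
        (a , b , w) ≡⟨ sym arrives ⟩
        walk m (a , b , z) ≡⟨ sym (walk-stuck-≤ {a , b , z} {m} (subst Stuck (sym arrives) w-misses) m≤L) ⟩
        walk L (a , b , z) ≡⟨ cong (walk L ∘ flip) (sym eq) ⟩
        walk L (flip (walk i (a , b , y))) ≡⟨ trace-back {a , b , y} y-misses i≤L ⟩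
        (b , a , y) ∎))
        where open ≡-Reasoning

    fan-distinct : ∀ {w u α y ys z z′} → Fan w u α y ys → z ∈ ys → z′ ∈ ys → free z ≡ free z′ → z ≡ z′
    fan-distinct (turn _ _ _ _ _) (here refl) (here refl) e = refl
    fan-distinct (turn _ _ _ _ distinct) (here refl) (there z′∈) e = ⊥-elim (distinct z′∈ (sym e))
    fan-distinct (turn _ _ _ _ distinct) (there z∈) (here refl) e = ⊥-elim (distinct z∈ e)
    fan-distinct (turn fan _ _ _ _) (there z∈) (there z′∈) e = fan-distinct fan z∈ z′∈ e

    module Grow (u w : Fin n) (α : Maybe (Fin k)) (valid : Valid (u , w , α)) where

      taken-≢ : ∀ {z a b} → φ w u ≡ just a → φ w z ≡ just b → z ≢ u → b ≢ a
      taken-≢ φwu φwz z≢u refl = z≢u (matching proper φwz φwu)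

      grow : ∀ fuel {y ys} → Fan w u α y ys → length ys + fuel ≡ d → Outcome (u , w , α)
      -- The fan lists distinct neighbours of `w`, and with the fuel spent there would be `d + 1` of
      -- them.
      grow zero {y} {ys} fan len = ⊥-elim (ℕₚ.1+n≰n (ℕₚ.≤-trans
        (degree≤d w (y ∷ ys) (fan-unique fan) (All.tabulate (fan-adj (proj₁ valid) fan)))
        (ℕₚ.≤-reflexive (trans (sym len) (ℕₚ.+-identityʳ _)))))
      grow (suc fuel) {y} {ys} fan len with follow? φ w (free y)
      ... | no ¬e = done valid fan (inj₁ (missing {φ = φ} ¬e))
      ... | yes (y′ , e) with y′ ≟ᶠ u
      ... | yes refl = done valid fan (inj₂ e)
      ... | no y′≢u with α ≟ᵐ just (free y)
      -- The fan stops at `α`: a path in `free w` and `α` would share one colour with the preceding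
      -- path. Paired with `φ w u`, both colours are shared and the paths will be told apart by
      -- their components.
      ... | yes α≡ = path valid fan a (taken-≢ φwu e y′≢u ∘ sym)
          (λ z∈ → let ((_ , e′ , ne) , _) = fan-spent fan z∈ in taken-≢ φwu e′ ne)
          (λ z∈ eq → ⊥-elim (proj₂ (fan-spent fan z∈) (trans α≡ (cong just (sym eq)))))
          (inj₂ (α≡ , φwu))
        where
        a : Fin k
        a = proj₁ (proj₂ valid α≡)
        φwu : φ w u ≡ just a
        φwu = proj₂ (proj₂ valid α≡)
      ... | no α≢ with Any.any? (λ z → free z Finₚ.≟ free y) ys
      ... | no new = grow fuel (turn fan e y′≢u α≢ (λ z∈ eq → new (lose z∈ eq))) (trans (sym (ℕₚ.+-suc (length ys) fuel)) len)
      ... | yes old with find old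
      ... | z , z∈ , z≈y = choose (avoids? (a , free z , z) w)
        where
        a : Fin k
        a = free w
        y-fresh : y ∉ ys
        y-fresh y∈ with fan-unique fan
        ... | y# ∷ _ = All.lookup y# y∈ refl
        present : ∀ {v v′} → φ w v′ ≡ just (free v) → free v ≢ a
        present e′ eq = free-missing w _ (trans e′ (cong just eq))
        choose : (Avoids (a , free z , z) w ⊎ ∃ λ i → i ≤ L × vertex (walk i (a , free z , z)) ≡ w) → Outcome (u , w , α)
        -- Vizing's choice for a repeated colour: cut the fan back to `z` if the path from `z`
        -- avoids `w`. Otherwise keep the whole fan, as the path from `y` then avoids both `w` and
        -- `z`.
        choose (inj₁ av) = path valid (proj₁ (proj₂ (fan-prefix fan z∈))) a (present (proj₁ (proj₂ spent)) ∘ sym)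
            (λ z′∈ → present (proj₁ (proj₂ (proj₁ (fan-spent (proj₁ (proj₂ (fan-prefix fan z∈))) z′∈)))))
            (λ z′∈ eq → ⊥-elim (proj₂ (proj₂ (fan-prefix fan z∈)) z′∈ eq))
            (inj₁ (refl , proj₂ (fan-spent fan z∈) , (λ φwu → taken-≢ φwu (proj₁ (proj₂ spent)) (proj₂ (proj₂ spent)) refl) , av))
          where
          spent : ∃ λ z′ → φ w z′ ≡ just (free z) × z′ ≢ u
          spent = proj₁ (fan-spent fan z∈)
        choose (inj₂ (m , m≤L , hit)) = path valid fan a (present e ∘ sym)
            (λ z′∈ → present (proj₁ (proj₂ (proj₁ (fan-spent fan z′∈)))))
            (λ z′∈ eq → subst (Avoids (a , free y , y)) (fan-distinct fan z∈ z′∈ (trans z≈y (sym eq)))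
              (other-avoids-end (present e ∘ sym) z-misses (free-missing y) (free-missing w) z≢y m≤L hit′))
            (inj₁ (refl , α≢ , (λ φwu → taken-≢ φwu e y′≢u refl) ,
              other-avoids-hub (present e ∘ sym) z-misses (free-missing y) (free-missing w) z≢y m≤L hit′))
          where
          z≢y : z ≢ y
          z≢y refl = y-fresh z∈
          z-misses : Missing φ z (free y)
          z-misses = subst (Missing φ z) z≈y (free-missing z)
          hit′ : vertex (walk m (a , free y , z)) ≡ w
          hit′ = subst (λ b → vertex (walk m (a , b , z)) ≡ w) z≈y hit

    valid? : ∀ s → Dec (Valid s)
    valid? (u , w , α) = (adj G w u Boolₚ.≟ true) ×-dec check α
      where
      check : ∀ α → Dec (∀ {b} → α ≡ just b → ∃ λ a → φ w u ≡ just a)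
      check nothing = yes λ ()
      check (just b) with φ w u
      ... | just a  = yes λ _ → a , refl
      ... | nothing = no λ h → case h refl of λ ()

  abstract
    outcome : ∀ s → Outcome s
    outcome s@(u , w , α) with valid? s
    ... | yes valid = Grow.grow u w α valid d start refl
    ... | no ¬valid = idle ¬valid

  origin : ∀ {s} → Outcome s → Maybe Position
  origin (path _ {y} _ a _ _ _ _) = just (a , free y , y)
  origin _ = nothing

  visited : Maybe Position → List (Fin n)
  visited nothing = []
  visited (just σ) = applyUpTo (λ i → vertex (walk i σ)) (suc L)

  -- A superset of the vertices whose rows the chain can change; taking all neighbours of `w` covers
  -- the fan whatever its length.
  touch : State′ → List (Fin n)
  touch s@(u , w , α) = w ∷ neighbours G w ++ visited (origin (outcome s))

  Long : Position → Set
  Long σ = ∀ (i : Fin L) → Moving (walk (toℕ i) σ)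

  long? : ∀ σ → Dec (Long σ)
  long? σ = Finₚ.all? (λ i → moving? (walk (toℕ i) σ))

  long-moving : ∀ {σ} → Long σ → ∀ i → i < L → Moving (walk i σ)
  long-moving {σ} long i i<L = subst (λ j → Moving (walk j σ)) (Finₚ.toℕ-fromℕ< i<L) (long (fromℕ< i<L))

  -- The first edge of the path is never chosen, so another path edge precedes the hole. The colour
  -- of that edge is the one that the shift removes from `u`.
  next : Position → ℕ → State′
  next σ t = vertex (walk (1 + t) σ) , vertex (walk (2 + t) σ) , just (proj₁ (walk t σ))

  next-valid : ∀ {σ t} → Long σ → t < ℓ → Valid (next σ t)
  next-valid {σ} {t} long t<ℓ = go (long-moving {σ} long (1 + t) (s≤s (s≤s (ℕₚ.<⇒≤ t<ℓ))))
    where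
    u : Fin n
    u = vertex (walk (1 + t) σ)
    c : Fin k
    c = proj₁ (walk (1 + t) σ)
    go : Moving (walk (1 + t) σ) → Valid (next σ t)
    go (v , e) = subst (λ τ → Valid (u , vertex τ , just (proj₁ (walk t σ)))) (sym (advance-edge {c} {proj₁ (proj₂ (walk (1 + t) σ))} e))
      (adj-sym {G = G} (edge-col proper e) , λ _ → c , trans (sym-col proper v u) e)

  succsFrom : Maybe Position → List State′
  succsFrom nothing = []
  succsFrom (just σ) with long? σ
  ... | yes _ = applyUpTo (next σ) ℓ
  ... | no _ = []

  succs : State′ → List State′
  succs s = succsFrom (origin (outcome s))

  succs⁻ : ∀ {s x} → x ∈ succs s → ∃ λ σ → origin (outcome s) ≡ just σ × Long σ × ∃ λ t → t < ℓ × x ≡ next σ t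
  succs⁻ {s} x∈ with origin (outcome s)
  ... | just σ with long? σ
  ... | yes long with ∈-applyUpTo⁻ (next σ) x∈
  ... | t , t< , e = σ , refl , long , t , t< , e

  origin-valid : ∀ {s σ} (o : Outcome s) → origin o ≡ just σ → Valid s
  origin-valid (path v _ _ _ _ _ _) _ = v

  origin-stuck : ∀ {s σ} (o : Outcome s) → origin o ≡ just σ → Stuck (flip σ)
  origin-stuck (path _ {y} _ _ _ _ _ _) refl = free-missing y

  origin-adj : ∀ {s σ} (o : Outcome s) → origin o ≡ just σ → adj G (proj₁ (proj₂ s)) (vertex σ) ≡ true
  origin-adj (path v fan _ _ _ _ _) refl = fan-adj (proj₁ v) fan (here refl)

  origin-≢ : ∀ {s σ} (o : Outcome s) → origin o ≡ just σ → proj₁ σ ≢ proj₁ (proj₂ σ)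
  origin-≢ (path _ _ _ ne _ _ _) refl = ne

  touch-hub : ∀ {u w α} → w ∈ touch (u , w , α)
  touch-hub = here refl

  touch-nbr : ∀ {u w α v} → adj G w v ≡ true → v ∈ touch (u , w , α)
  touch-nbr wv = there (∈-++⁺ˡ (neighbours⁺ {G = G} wv))

  touch-walk : ∀ {s σ i} → origin (outcome s) ≡ just σ → i ≤ L → vertex (walk i σ) ∈ touch s
  touch-walk {s@(u , w , α)} {σ} e i≤L with origin (outcome s)
  touch-walk {u , w , α} {σ} refl i≤L | just _ =
    there (∈-++⁺ʳ (neighbours G w) (∈-applyUpTo⁺ (λ i → vertex (walk i σ)) (s≤s i≤L)))

  data Touched (s : State′) (v : Fin n) : Set where
    hub  : v ≡ proj₁ (proj₂ s) → Touched s v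
    nbr  : adj G (proj₁ (proj₂ s)) v ≡ true → Touched s v
    walked : ∀ σ i → origin (outcome s) ≡ just σ → i ≤ L → v ≡ vertex (walk i σ) → Touched s v

  touch⁻ : ∀ {s v} → v ∈ touch s → Touched s v
  touch⁻ (here e) = hub e
  touch⁻ {s@(u , w , α)} (there v∈) with ∈-++⁻ (neighbours G w) v∈
  ... | inj₁ v∈ = nbr (neighbours⁻ {G = G} v∈)
  ... | inj₂ v∈ with origin (outcome s) in e
  ... | just σ with ∈-applyUpTo⁻ (λ i → vertex (walk i σ)) v∈
  ... | i , s≤s i≤L , v≡ = walked σ i e i≤L v≡

  endsFrom : Fin n → Fin k → List (Fin n)
  endsFrom z x = map (λ x′ → vertex (walk L (x , x′ , z))) (allFin k)

  -- The possible starts of walks through `z`: one for each pair of colours, found by going back `L`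
  -- steps, which is enough whatever the distance.
  ends : Fin n → List (Fin n)
  ends z = z ∷ concatMap (endsFrom z) (allFin k)

  colours : List (Maybe (Fin k))
  colours = nothing ∷ map just (allFin k)

  statesVia : Fin n → Fin n → List State′
  statesVia w u = map (λ α → u , w , α) colours

  statesAt : Fin n → List State′
  statesAt w = concatMap (statesVia w) (neighbours G w)

  statesNear : Fin n → List State′
  statesNear y = concatMap statesAt (y ∷ neighbours G y)

  touching : Fin n → List State′
  touching z = concatMap statesNear (ends z)

  ∈-colours : ∀ α → α ∈ colours
  ∈-colours nothing = here refl
  ∈-colours (just c) = there (∈-map⁺ just (∈-allFin c))

  ∈-statesAt : ∀ {u w α} → adj G w u ≡ true → (u , w , α) ∈ statesAt w
  ∈-statesAt {u} {w} {α} wu = ∈-concatMap⁺ (statesVia w) (neighbours G w) (neighbours⁺ {G = G} wu) (∈-map⁺ (λ α → u , w , α) (∈-colours α))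

  ∈-ends : ∀ {σ i} → Stuck (flip σ) → i ≤ L → vertex σ ∈ ends (vertex (walk i σ))
  ∈-ends {σ} {i} st i≤L = there (∈-concatMap⁺ (endsFrom (vertex τ)) (allFin k) (∈-allFin (proj₁ (proj₂ τ)))
    (subst (_∈ map (λ x′ → vertex (walk L (proj₁ (proj₂ τ) , x′ , vertex τ))) (allFin k)) (cong vertex (trace-back {σ} st i≤L))
      (∈-map⁺ (λ x′ → vertex (walk L (proj₁ (proj₂ τ) , x′ , vertex τ))) (∈-allFin (proj₁ τ)))))
    where
    τ : Position
    τ = walk i σ

  touch⇒touching : ∀ {s z} → Valid s → z ∈ touch s → s ∈ touching z
  touch⇒touching {s@(u , w , α)} {z} valid z∈ with touch⁻ {s} z∈
  ... | hub refl = ∈-concatMap⁺ statesNear (ends z) {x = z} (here refl) (∈-concatMap⁺ statesAt (z ∷ neighbours G z) {x = w} (here refl) (∈-statesAt (proj₁ valid)))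
  ... | nbr wz = ∈-concatMap⁺ statesNear (ends z) {x = z} (here refl) (∈-concatMap⁺ statesAt (z ∷ neighbours G z) {x = w} (there (neighbours⁺ {G = G} (adj-sym {G = G} wz))) (∈-statesAt (proj₁ valid)))
  ... | walked σ i e i≤L refl = ∈-concatMap⁺ statesNear (ends z) {x = vertex σ} (∈-ends {σ} (origin-stuck (outcome s) e) i≤L)
    (∈-concatMap⁺ statesAt (vertex σ ∷ neighbours G (vertex σ)) {x = w} (there (neighbours⁺ {G = G} (adj-sym {G = G} (origin-adj (outcome s) e)))) (∈-statesAt (proj₁ valid)))

  length-statesAt : ∀ w → length (statesAt w) ≤ d * suc k
  length-statesAt w = ℕₚ.≤-trans
    (length-concatMap-≤ (statesVia w) (suc k) (neighbours G w) (λ u → ℕₚ.≤-reflexive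
      (trans (length-map _ colours) (cong suc (trans (length-map just (allFin k)) (length-tabulate {n = k} id))))))
    (ℕₚ.*-monoˡ-≤ (suc k) (length-neighbours {G = G} degree≤d w))

  length-touching : ∀ z → length (touching z) ≤ (1 + k * k) * (suc d * (d * suc k))
  length-touching z = ℕₚ.≤-trans
    (length-concatMap-≤ statesNear (suc d * (d * suc k)) (ends z) (λ y → ℕₚ.≤-trans
      (length-concatMap-≤ statesAt (d * suc k) (y ∷ neighbours G y) length-statesAt)
      (ℕₚ.*-monoˡ-≤ (d * suc k) (s≤s (length-neighbours {G = G} degree≤d y)))))
    (ℕₚ.*-monoˡ-≤ (suc d * (d * suc k)) (s≤s (ℕₚ.≤-trans
      (length-concatMap-≤ (endsFrom z) k (allFin k) (λ x → ℕₚ.≤-reflexive (trans (length-map _ (allFin k)) (length-tabulate {n = k} id))))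
      (ℕₚ.≤-reflexive (cong (_* k) (length-tabulate {n = k} id))))))

  length-touch : ∀ s → length (touch s) ≤ suc d + suc L
  length-touch s@(u , w , α) = s≤s (ℕₚ.≤-trans (ℕₚ.≤-reflexive (length-++ (neighbours G w)))
    (ℕₚ.+-mono-≤ (length-neighbours {G = G} degree≤d w) (bound (origin (outcome s)))))
    where
    bound : ∀ m → length (visited m) ≤ suc L
    bound nothing = z≤n
    bound (just σ) = ℕₚ.≤-reflexive (length-applyUpTo (λ i → vertex (walk i σ)) (suc L))

  -- The path of a predecessor runs through `u`, so the predecessors are among the states touching
  -- `u`. Their number is bounded independently of `L`, hence of `q`.
  preds : State′ → List State′
  preds (u , _) = touching u

  succs⇒preds : ∀ s x → x ∈ succs s → s ∈ preds x
  succs⇒preds s x x∈ with succs⁻ {s} x∈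
  ... | σ , e , long , t , t<ℓ , refl =
    touch⇒touching (origin-valid (outcome s) e) (touch-walk {s} e (s≤s (ℕₚ.≤-trans (ℕₚ.<⇒≤ t<ℓ) (ℕₚ.n≤1+n ℓ))))

  unique-succs : ∀ s → Unique (succs s)
  unique-succs s with origin (outcome s) in e
  ... | nothing = []
  ... | just σ with long? σ
  ... | no _ = []
  ... | yes long = Uniqueₚ.applyUpTo⁺₁ (next σ) ℓ (λ {i} {j} i<j j<ℓ eq →
    walk-simple (origin-≢ (outcome s) e) (origin-stuck (outcome s) e) {L} (long-moving {σ} long) (s≤s i<j) (s≤s (ℕₚ.≤-trans (ℕₚ.<⇒≤ j<ℓ) (ℕₚ.n≤1+n ℓ))) (cong proj₁ eq))

  length-succs : ∀ {s σ} → origin (outcome s) ≡ just σ → Long σ → length (succs s) ≡ ℓ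
  length-succs {s} {σ} e long with origin (outcome s)
  length-succs {s} {σ} refl long | just _ with long? σ
  ... | yes _ = length-applyUpTo (next σ) ℓ
  ... | no ¬long = ⊥-elim (¬long long)

-- Multi-step chains

module Augment {n k : ℕ} {G : Graph n} {φ : PartialColouring n k} (proper : Proper G φ)
  (free : Fin n → Fin k) (free-missing : ∀ v → Missing φ v (free v)) (d : ℕ) (degree≤d : DegreeAtMost d G) (q : ℕ)
  (u₀ w₀ : Fin n) (w₀u₀ : adj G w₀ u₀ ≡ true) (hole₀ : φ w₀ u₀ ≡ nothing) where

  open Outcomes {G = G} proper free free-missing d degree≤d (2 * q)

  Open : Fin n → Fin n → Set
  Open a b = φ a b ≡ nothing × ¬ SamePair a b w₀ u₀

  -- `ψ` is `φ` with the hole moved to `wu`, and all changes lie in `hist`. The clauses from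
  -- `i-missing` on say that the chain of this state, defined by `φ`, works in `ψ`; `i-spare` says
  -- that `w` no longer has the colour of the edge to which the hole came.
  record Invariant (hist : List (Fin n)) (u w : Fin n) (α : Maybe (Fin k)) (ψ : PartialColouring n k) : Set where
    field
      i-valid      : Valid (u , w , α)
      i-proper     : Proper G ψ
      i-hole       : ψ w u ≡ nothing
      i-uncoloured : ∀ a b → ψ a b ≡ nothing → Open a b ⊎ SamePair a b w u
      i-fresh      : ∀ v → v ∉ hist → ∀ z → ψ v z ≡ φ v z
      i-missing    : ∀ v → v ∈ touch (u , w , α) → ∀ c → Missing φ v c → Missing ψ v c
      i-spare      : ∀ c → φ w u ≡ just c → Missing ψ w c
      i-hub        : ∀ z → z ≢ u → ψ w z ≡ φ w z
      i-walk       : ∀ σ → origin (outcome (u , w , α)) ≡ just σ → ∀ i v → i < L →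
                     φ (vertex (walk i σ)) v ≡ just (proj₁ (walk i σ)) → ψ (vertex (walk i σ)) v ≡ just (proj₁ (walk i σ))
      i-avoids     : ∀ σ → origin (outcome (u , w , α)) ≡ just σ → Avoids σ w
  open Invariant

  invariant₀ : Invariant [] u₀ w₀ nothing φ
  invariant₀ = record
    { i-valid = w₀u₀ , λ ()
    ; i-proper = proper
    ; i-hole = hole₀
    ; i-uncoloured = unc
    ; i-fresh = λ _ _ _ → refl
    ; i-missing = λ _ _ _ m → m
    ; i-spare = λ c e → case trans (sym hole₀) e of λ ()
    ; i-hub = λ _ _ → refl
    ; i-walk = λ _ _ _ _ _ e → e
    ; i-avoids = λ σ → avoid (outcome (u₀ , w₀ , nothing))
    }
    where
    unc : ∀ a b → φ a b ≡ nothing → Open a b ⊎ SamePair a b w₀ u₀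
    unc a b e with samePair? a b w₀ u₀
    ... | yes s = inj₂ s
    ... | no ¬s = inj₁ (e , ¬s)
    avoid : ∀ {σ} (o : Outcome (u₀ , w₀ , nothing)) → origin o ≡ just σ → Avoids σ w₀
    avoid (path _ _ _ _ _ _ (inj₁ (_ , _ , _ , av))) refl = av

  Solved : List (Fin n) → PartialColouring n k → Set
  Solved touched ψ = Proper G ψ × (∀ a b → ψ a b ≡ nothing → Open a b) × (∀ v → v ∉ touched → ∀ z → ψ v z ≡ φ v z)

  module _ {hist u w α ψ} (inv : Invariant hist u w α ψ) where

    private
      wu : adj G w u ≡ true
      wu = proj₁ (i-valid inv)

      still-free : ∀ z → adj G w z ≡ true → Missing ψ z (free z)
      still-free z wz = i-missing inv z (touch-nbr {u} {w} {α} wz) (free z) (free-missing z)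

      fan⊆touch : ∀ {y ys z} → Fan w u α y ys → z ∈ y ∷ ys → z ∈ touch (u , w , α)
      fan⊆touch fan z∈ = touch-nbr {u} {w} {α} (fan-adj wu fan z∈)

    finish-fan : ∀ {y ys} → Fan w u α y ys → Missing φ w (free y) ⊎ φ w u ≡ just (free y) → ∃ (Solved (hist ++ touch (u , w , α)))
    finish-fan {y} {ys} fan avail with FanShift.fan-shift (i-proper inv) Open wu (i-hole inv) (i-uncoloured inv) (i-hub inv) still-free fan
    ... | χ , F = recolour χ w y (just (free y)) ,
      colour-proper (f-proper F) (f-adj F) (f-missing-w F (free y) (spare avail))
        (f-missing F y (free y) y≢w (still-free y (f-adj F)) (λ y∈ → ⊥-elim (y∉ys y∈))) ,
      closed ,
      (λ v v∉ z → trans (recolour-miss χ (away v∉)) (trans (fanned-same F v z (≢w v∉) (inj₂ (λ v∈ → v∉ (∈-++⁺ʳ hist (fan⊆touch fan v∈)))))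
        (i-fresh inv v (λ v∈ → v∉ (∈-++⁺ˡ v∈)) z)))
      where
      open FanShift (i-proper inv) Open wu (i-hole inv) (i-uncoloured inv) (i-hub inv) still-free
      y≢w : y ≢ w
      y≢w = adj-≢ {G = G} (f-adj F) ∘ sym
      y∉ys : y ∉ ys
      y∉ys y∈ with fan-unique fan
      ... | y# ∷ _ = All.lookup y# y∈ refl
      spare : Missing φ w (free y) ⊎ φ w u ≡ just (free y) → Missing ψ w (free y)
      spare (inj₁ m) = i-missing inv w (touch-hub {u} {w} {α}) (free y) m
      spare (inj₂ e) = i-spare inv (free y) e
      closed : ∀ a b → recolour χ w y (just (free y)) a b ≡ nothing → Open a b
      closed a b e with samePair? a b w y
      closed a b () | yes _
      closed a b e | no ¬s with f-uncoloured F a b e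
      ... | inj₁ o = o
      ... | inj₂ s = ⊥-elim (¬s s)
      ≢w : ∀ {v} → v ∉ hist ++ touch (u , w , α) → v ≢ w
      ≢w v∉ refl = v∉ (∈-++⁺ʳ hist (touch-hub {u} {w} {α}))
      away : ∀ {v z} → v ∉ hist ++ touch (u , w , α) → ¬ SamePair v z w y
      away v∉ s with samePair-end s
      ... | inj₁ v≡w = ≢w v∉ v≡w
      ... | inj₂ refl = v∉ (∈-++⁺ʳ hist (fan⊆touch fan (here refl)))

    module _ (valid : Valid (u , w , α)) {y ys} (fan : Fan w u α y ys) (a : Fin k) (a≢b : a ≢ free y)
      (no-a : ∀ {z} → z ∈ ys → free z ≢ a) (no-b : ∀ {z} → z ∈ ys → free z ≡ free y → Avoids (a , free y , y) z)
      (kind : (a ≡ free w × α ≢ just (free y) × φ w u ≢ just (free y) × Avoids (a , free y , y) w)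
              ⊎ (α ≡ just (free y) × φ w u ≡ just a))
      (out : outcome (u , w , α) ≡ path valid fan a a≢b no-a no-b kind) where

      private
        σ : Position
        σ = a , free y , y

        is-origin : origin (outcome (u , w , α)) ≡ just σ
        is-origin = cong origin out

        avoids : Avoids σ w
        avoids = i-avoids inv σ is-origin

        w-misses : Missing ψ w a
        w-misses = from kind
          where
          from : _ → Missing ψ w a
          from (inj₁ (refl , _)) = i-missing inv w (touch-hub {u} {w} {α}) (free w) (free-missing w)
          from (inj₂ (_ , e)) = i-spare inv a e

      open PathShift (i-proper inv) Open wu (i-hole inv) (i-uncoloured inv) (i-hub inv) still-free fan a≢b w-misses {L}
        avoids (i-walk inv σ is-origin)

      private
        same-row : ∀ {i p x x′ r χ} → i ≤ L → Shifted i p x x′ r χ → ∀ v → v ∉ hist ++ touch (u , w , α) → ∀ z →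
          χ v z ≡ φ v z
        same-row {i} i≤L S v v∉ z = trans
          (s-same S v z (λ { refl → v∉ (∈-++⁺ʳ hist (touch-hub {u} {w} {α})) }) (λ l l<i → off l (ℕₚ.≤-trans (ℕₚ.<⇒≤ l<i) i≤L))
            (inj₁ (λ v≡r → off i i≤L (trans v≡r (sym (cong vertex (s-at S))))))
            (inj₂ (λ v∈ → v∉ (∈-++⁺ʳ hist (fan⊆touch fan v∈)))))
          (i-fresh inv v (λ v∈ → v∉ (∈-++⁺ˡ v∈)) z)
          where
          off : ∀ l → l ≤ L → v ≢ vertex (walk l σ)
          off l l≤L refl = v∉ (∈-++⁺ʳ hist (touch-walk {u , w , α} {σ} {l} is-origin l≤L))

      finish-path : ∀ i → i ≤ L → (∀ l → l < i → Moving (walk l σ)) → Stuck (walk i σ) → ∃ (Solved (hist ++ touch (u , w , α)))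
      finish-path i i≤L moving stuck with shift-along i i≤L moving
      ... | p , χ , S = recolour χ p r (just x) ,
        colour-proper (s-proper S) (s-adj S) (s-misses S)
          (s-missing′ S r x (avoids i i≤L) (λ l l<i e → walk-simple a≢b (free-missing y) moving l<i ℕₚ.≤-refl (sym e))
            (i-missing inv r (touch-walk {u , w , α} {σ} {i} is-origin i≤L) x stuck) not-spent) ,
        closed ,
        (λ v v∉ z → trans (recolour-miss χ (away v∉)) (same-row i≤L S v v∉ z))
        where
        r : Fin n
        r = vertex (walk i σ)
        x : Fin k
        x = proj₁ (walk i σ)
        -- The rotation has used up the free colours of `ys`, so the end of the path must not rely
        -- on them; `no-a` and `no-b` treat its two possible colours.
        not-spent : r ∈ ys → free r ≢ x
        not-spent r∈ e with walk i σ in at | colours-walk {a} {free y} {y} i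
        ... | _ | same = no-a r∈ e
        ... | _ | swapped = no-b r∈ e i i≤L (cong vertex at)
        closed : ∀ c d → recolour χ p r (just x) c d ≡ nothing → Open c d
        closed c d e with samePair? c d p r
        closed c d () | yes _
        closed c d e | no ¬s with s-uncoloured S c d e
        ... | inj₁ o = o
        ... | inj₂ s = ⊥-elim (¬s s)
        away : ∀ {v z} → v ∉ hist ++ touch (u , w , α) → ¬ SamePair v z p r
        away v∉ s with samePair-end s | s-prev S
        ... | inj₂ refl | _ = v∉ (∈-++⁺ʳ hist (touch-walk {u , w , α} {σ} {i} is-origin i≤L))
        ... | inj₁ refl | inj₁ refl = v∉ (∈-++⁺ʳ hist (touch-hub {u} {w} {α}))
        ... | inj₁ refl | inj₂ (l , l<i , refl) =
          v∉ (∈-++⁺ʳ hist (touch-walk {u , w , α} {σ} {l} is-origin (ℕₚ.≤-trans (ℕₚ.<⇒≤ l<i) i≤L)))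

      -- Avoiding `w` and its neighbours keeps the next chain off the fan and off the start of this
      -- path. If the next path has the same two colours and meets this one, it starts at an end of
      -- the same component: at the start of this path, or at the vertex reached after `L + L`
      -- steps.
      anchors : List (Fin n)
      anchors = vertex (walk (L + L) σ) ∷ w ∷ neighbours G w

      module _ (long : Long σ) (t : ℕ) (t<ℓ : t < 2 * q)
        (off-hist : ∀ {v} → v ∈ touch (next σ t) → v ∉ hist) (off-anchors : ∀ {v} → v ∈ touch (next σ t) → v ∉ anchors) where

        private
          u′ w′ : Fin n
          u′ = vertex (walk (1 + t) σ)
          w′ = vertex (walk (2 + t) σ)
          α′ β′ : Fin k
          α′ = proj₁ (walk t σ)
          β′ = proj₁ (walk (1 + t) σ)
          s′ : State′
          s′ = next σ t

          moving : ∀ l → l < L → Moving (walk l σ)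
          moving = long-moving {σ} long

          2+t≤L : 2 + t ≤ L
          2+t≤L = ℕₚ.+-monoʳ-≤ 2 (ℕₚ.<⇒≤ t<ℓ)

          advanced : ∀ l → l < L → φ (vertex (walk l σ)) (vertex (walk (suc l) σ)) ≡ just (proj₁ (walk l σ)) ×
            proj₁ (walk (suc l) σ) ≡ proj₁ (proj₂ (walk l σ)) × proj₁ (proj₂ (walk (suc l) σ)) ≡ proj₁ (walk l σ)
          advanced l l<L with moving l l<L
          ... | v , e = subst (λ τ → φ (vertex (walk l σ)) (vertex τ) ≡ just (proj₁ (walk l σ)) ×
              proj₁ τ ≡ proj₁ (proj₂ (walk l σ)) × proj₁ (proj₂ τ) ≡ proj₁ (walk l σ)) (sym (advance-edge e)) (e , refl , refl)

          φu′w′ : φ u′ w′ ≡ just β′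
          φu′w′ = proj₁ (advanced (1 + t) 2+t≤L)

          φw′u′ : φ w′ u′ ≡ just β′
          φw′u′ = trans (sym-col proper w′ u′) φu′w′

          shifted : ∃ λ χ → Shifted (2 + t) u′ (proj₁ (walk (2 + t) σ)) (proj₁ (proj₂ (walk (2 + t) σ))) w′ χ
          shifted = proj₂ (shift-along (2 + t) 2+t≤L (λ l l< → moving l (ℕₚ.<-≤-trans l< 2+t≤L)))

          χ : PartialColouring n k
          χ = proj₁ shifted

          S : Shifted (2 + t) u′ (proj₁ (walk (2 + t) σ)) (proj₁ (proj₂ (walk (2 + t) σ))) w′ χ
          S = proj₂ shifted

          ≢w : ∀ {v} → v ∈ touch s′ → v ≢ w
          ≢w v∈ refl = off-anchors v∈ (there (here refl))

          ∉fan : ∀ {v} → v ∈ touch s′ → v ∉ y ∷ ys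
          ∉fan v∈ v∈fan = off-anchors v∈ (there (there (neighbours⁺ {G = G} (fan-adj wu fan v∈fan))))

          fresh : ∀ {v} → v ∈ touch s′ → ∀ z → ψ v z ≡ φ v z
          fresh v∈ = i-fresh inv _ (off-hist v∈)

          fresh-missing : ∀ {v c} → v ∈ touch s′ → Missing φ v c → Missing ψ v c
          fresh-missing v∈ m z e = m z (trans (sym (fresh v∈ z)) e)

          w′∈ : w′ ∈ touch s′
          w′∈ = touch-hub {u′} {w′}

          two-colours : ∀ {c} → c ≢ α′ → c ≢ β′ → c ≢ a × c ≢ free y
          two-colours {c} c≢α′ c≢β′ with walk t σ | walk (1 + t) σ | advanced t (ℕₚ.≤-trans (ℕₚ.n≤1+n _) 2+t≤L) | colours-walk {a} {free y} {y} t
          ... | _ | _ | _ , refl , _ | same = c≢α′ , c≢β′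
          ... | _ | _ | _ , refl , _ | swapped = c≢β′ , c≢α′

          -- The path edge after the hole. With `φw′u′` it shows that both colours of the path occur
          -- at `w′`, so `free w′` is neither of them.
          φw′-α′ : ∃ λ z → φ w′ z ≡ just α′
          φw′-α′ = _ , trans (proj₁ (advanced (2 + t) (ℕₚ.+-monoʳ-< 2 t<ℓ)))
            (cong just (trans (proj₁ (proj₂ (advanced (1 + t) 2+t≤L))) (proj₂ (proj₂ (advanced t (ℕₚ.≤-trans (ℕₚ.n≤1+n _) 2+t≤L))))))

        -- A walk with the same two colours from elsewhere lies in another component.
        private
          disjoint : ∀ {σ′} → origin (outcome s′) ≡ just σ′ → Colours a (free y) σ′ →
            ∀ i j → i ≤ L → j ≤ L → vertex (walk i σ′) ≢ vertex (walk j σ)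
          disjoint {σ′} is-origin′ cols i j i≤L j≤L e with meet (walk-colours i) (colours-walk {a} {free y} {y} j) e
            where
            walk-colours : ∀ i → Colours a (free y) (walk i σ′)
            walk-colours zero = cols
            walk-colours (suc i) = colours-advance (walk-colours i)
          ... | inj₁ eq = off-anchors (touch-walk {s′} {σ′} {0} is-origin′ z≤n)
            (there (there (subst (_∈ neighbours G w) (cong vertex (begin
              flip σ ≡⟨ sym (trace-back {σ} (free-missing y) j≤L) ⟩
              walk L (flip (walk j σ)) ≡⟨ cong (walk L ∘ flip) (sym eq) ⟩
              walk L (flip (walk i σ′)) ≡⟨ trace-back {σ′} (origin-stuck (outcome s′) is-origin′) i≤L ⟩
              flip σ′ ∎)) (neighbours⁺ {G = G} (fan-adj wu fan (here refl))))))
            where open ≡-Reasoning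
          ... | inj₂ eq = off-anchors (touch-walk {s′} {σ′} {0} is-origin′ z≤n) (here (cong vertex (sym (begin
              walk (L + L) σ ≡⟨ walk-stuck-≤ {σ} {L + j} (subst Stuck (sym far) (origin-stuck (outcome s′) is-origin′)) (ℕₚ.+-monoʳ-≤ L j≤L) ⟩
              walk (L + j) σ ≡⟨ far ⟩
              flip σ′ ∎))))
            where
            open ≡-Reasoning
            far : walk (L + j) σ ≡ flip σ′
            far = begin
              walk (L + j) σ ≡⟨ sym (walk-+ L j σ) ⟩
              walk L (walk j σ) ≡⟨ cong (walk L ∘ flip) (sym eq) ⟩
              walk L (flip (walk i σ′)) ≡⟨ trace-back {σ′} (origin-stuck (outcome s′) is-origin′) i≤L ⟩
              flip σ′ ∎

          kind2-colours : ∀ {x x′ v} → just α′ ≡ just x′ → φ w′ u′ ≡ just x → Colours a (free y) (x , x′ , v)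
          kind2-colours {x} {x′} {v} refl e with walk t σ | walk (1 + t) σ | Maybeₚ.just-injective (trans (sym φw′u′) e) | advanced t (ℕₚ.≤-trans (ℕₚ.n≤1+n _) 2+t≤L) | colours-walk {a} {free y} {y} t
          ... | _ | _ | refl | _ , refl , _ | same = swapped
          ... | _ | _ | refl | _ , refl , _ | swapped = same

        advance-invariant : ∃ (Invariant (hist ++ touch (u , w , α)) u′ w′ (just α′))
        advance-invariant = χ , record
          { i-valid = adj-sym {G = G} (s-adj S) , λ _ → β′ , φw′u′
          ; i-proper = s-proper S
          ; i-hole = trans (sym-col (s-proper S) w′ u′) (s-hole S)
          ; i-uncoloured = λ c d e → case s-uncoloured S c d e of λ where
              (inj₁ o) → inj₁ o
              (inj₂ s) → inj₂ (samePair-swapʳ s)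
          ; i-fresh = same-row 2+t≤L S
          ; i-missing = λ v v∈ c m → s-missing S v c (≢w v∈) (∉fan v∈) m (fresh-missing v∈ m)
          ; i-spare = λ c e → subst (Missing χ w′) (trans (proj₂ (proj₂ (advanced (1 + t) 2+t≤L))) (Maybeₚ.just-injective (trans (sym φw′u′) e))) (s-misses′ S)
          ; i-hub = λ z z≢u′ → trans
              (s-same S w′ z (≢w w′∈) (λ l l< e → walk-simple a≢b (free-missing y) (λ i i< → moving i (ℕₚ.<-≤-trans i< 2+t≤L)) l< ℕₚ.≤-refl (sym e))
                (inj₂ z≢u′) (inj₂ (∉fan w′∈))) (fresh w′∈ z)
          ; i-walk = λ σ′ e i v i<L → keep (outcome s′) refl e i v i<L
          ; i-avoids = λ σ′ e → avoid (outcome s′) refl e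
          }
          where
          avoid : ∀ {σ′} (o : Outcome s′) → outcome s′ ≡ o → origin o ≡ just σ′ → Avoids σ′ w′
          avoid (path _ _ _ _ _ _ (inj₁ (_ , _ , _ , av))) _ refl = av
          -- `w′` lies on the old path, which the new one does not meet.
          avoid (path _ _ _ _ _ _ (inj₂ (α≡ , e))) out′ refl i i≤L =
            disjoint (cong origin out′) (kind2-colours α≡ e) i (2 + t) i≤L 2+t≤L

          -- In the first kind the new path has other colours, and off the fan the shift moves only
          -- `a` and `free y`. In the second kind the two paths have no common vertex.
          keep : ∀ {σ′} (o : Outcome s′) → outcome s′ ≡ o → origin o ≡ just σ′ → ∀ i v → i < L →
            φ (vertex (walk i σ′)) v ≡ just (proj₁ (walk i σ′)) → χ (vertex (walk i σ′)) v ≡ just (proj₁ (walk i σ′))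
          keep (path _ {y′} fan′ a′ _ _ _ (inj₁ (refl , α′≢ , β′≢ , _))) out′ refl i v i<L e =
            s-keeps S _ v _ (≢w r∈) (∉fan r∈) (proj₁ other) (proj₂ other) (trans (fresh r∈ v) e)
            where
            r∈ : vertex (walk i (free w′ , free y′ , y′)) ∈ touch s′
            r∈ = touch-walk {s′} (cong origin out′) (ℕₚ.<⇒≤ i<L)
            other : proj₁ (walk i (free w′ , free y′ , y′)) ≢ a × proj₁ (walk i (free w′ , free y′ , y′)) ≢ free y
            other with walk i (free w′ , free y′ , y′) | colours-walk {free w′} {free y′} {y′} i
            ... | _ | same = two-colours (missing-≢ {G = G} proper (free-missing w′) (proj₂ φw′-α′)) (missing-≢ {G = G} proper (free-missing w′) φw′u′)
            ... | _ | swapped = two-colours (λ eq → α′≢ (cong just (sym eq))) (λ eq → β′≢ (trans φw′u′ (cong just (sym eq))))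
          keep (path _ {y′} fan′ a′ _ _ _ (inj₂ (α≡ , φ≡))) out′ refl i v i<L e = trans
            (s-same S _ v (≢w r∈) (λ l l< → apart l (ℕₚ.≤-trans (ℕₚ.<⇒≤ l<) 2+t≤L)) (inj₁ (apart (2 + t) 2+t≤L)) (inj₂ (∉fan r∈)))
            (trans (fresh r∈ v) e)
            where
            r∈ : vertex (walk i (a′ , free y′ , y′)) ∈ touch s′
            r∈ = touch-walk {s′} (cong origin out′) (ℕₚ.<⇒≤ i<L)
            apart : ∀ l → l ≤ L → vertex (walk i (a′ , free y′ , y′)) ≢ vertex (walk l σ)
            apart l l≤L = disjoint (cong origin out′) (kind2-colours α≡ φ≡) i l (ℕₚ.<⇒≤ i<L) l≤L

-- Augmentation within bounded distance

module LocalAugment {n k : ℕ} {G : Graph n} {φ : PartialColouring n k} (proper : Proper G φ)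
  (free : Fin n → Fin k) (free-missing : ∀ v → Missing φ v (free v)) (d : ℕ) (degree≤d : DegreeAtMost d G)
  (f : ℕ → ℕ) (growth : GrowthAtMost f G) (c q ρ K₀ : ℕ)
  (c-large : (1 + k * k) * (suc d * (d * suc k)) ≤ c) (2c≤q : 2 * c ≤ q)
  (q-large : (2 + d) * c * c ≤ q) (q-larger : (q * ((2 + d) * c) + 2 * ((suc d + (3 + 2 * q)) * c) * c) * c ≤ q * q)
  (ρ-large : 4 + 2 * q ≤ ρ) (K-large : f (ρ * K₀) * (d * suc k) * c ^ K₀ < q ^ K₀)
  (u₀ w₀ : Fin n) (w₀u₀ : adj G w₀ u₀ ≡ true) (hole₀ : φ w₀ u₀ ≡ nothing) where

  open Outcomes {G = G} proper free free-missing d degree≤d (2 * q)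
  open Augment {G = G} proper free free-missing d degree≤d q u₀ w₀ w₀u₀ hole₀
  open Invariant

  private
    _≟ˢ_ : DecidableEquality State′
    _≟ˢ_ = Productₚ.≡-dec _≟ᶠ_ (Productₚ.≡-dec _≟ᶠ_ _≟ᵐ_)

  open Potential _≟ˢ_ succs preds c q (λ (u , _) → ℕₚ.≤-trans (length-touching u) c-large) unique-succs succs⇒preds

  private
    walk-path : ∀ i σ → Path G (vertex σ) i (vertex (walk i σ))
    walk-path zero σ = stop
    walk-path (suc i) σ with moving-or-stuck (walk i σ)
    ... | inj₁ (v , e) = subst (λ τ → Path G (vertex σ) (suc i) (vertex τ)) (sym (advance-edge e)) (snoc (walk-path i σ) (edge-col proper e))
    ... | inj₂ st = subst (λ τ → Path G (vertex σ) (suc i) (vertex τ)) (sym (advance-stuck {walk i σ} st)) (path-mono (ℕₚ.n≤1+n i) (walk-path i σ))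

    touch-near : ∀ {u w α v} → Valid (u , w , α) → v ∈ touch (u , w , α) → Path G u ρ v
    touch-near {u} {w} {α} (wu , _) v∈ with touch⁻ {u , w , α} v∈
    ... | hub refl = path-mono (ℕₚ.≤-trans (s≤s z≤n) ρ-large) (path-edge (adj-sym {G = G} wu))
    ... | nbr wv = path-mono (ℕₚ.≤-trans (s≤s (s≤s z≤n)) ρ-large) (snoc (path-edge (adj-sym {G = G} wu)) wv)
    ... | walked σ i e i≤L refl = path-mono (ℕₚ.≤-trans (ℕₚ.+-monoʳ-≤ 2 i≤L) ρ-large)
      (path-trans 2 (snoc (path-edge (adj-sym {G = G} wu)) (origin-adj (outcome (u , w , α)) e)) (walk-path i σ))

    blocked : List (Fin n) → State′ → ℕ
    blocked vs s = count s (concatMap touching vs)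

    blocked-mass : ∀ {m} vs → length vs ≤ m → Mass (blocked vs) (m * c)
    blocked-mass vs le = concatMap touching vs , (λ _ → ℕₚ.≤-refl) , ℕₚ.≤-trans
      (length-concatMap-≤ touching c vs (λ z → ℕₚ.≤-trans (length-touching z) c-large)) (ℕₚ.*-monoˡ-≤ c le)

    blocked-hit : ∀ {vs v s} → Valid s → v ∈ touch s → v ∈ vs → 1 ≤ blocked vs s
    blocked-hit {vs} {v} {s} valid v∈ v∈vs = count-∈ (∈-concatMap⁺ touching vs v∈vs (touch⇒touching {s} valid v∈))

    around : Fin n → List State′
    around u = concatMap (λ w → map (λ α → u , w , α) colours) (neighbours G u)

    length-around : ∀ u → length (around u) ≤ d * suc k
    length-around u = ℕₚ.≤-trans
      (length-concatMap-≤ (λ w → map (λ α → u , w , α) colours) (suc k) (neighbours G u) (λ w → ℕₚ.≤-reflexive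
        (trans (length-map (λ α → u , w , α) colours) (cong suc (trans (length-map just (allFin k)) (length-tabulate {n = k} id))))))
      (ℕₚ.*-monoˡ-≤ (suc k) (length-neighbours {G = G} degree≤d u))

    R₀ : ℕ
    R₀ = ρ * K₀

    inside : List (Fin n)
    inside = filterᵇ (ball G R₀ u₀) (allFin n)

    -- `K₀` chains cannot leave the ball of radius `R₀`, so a walk of `K₀` steps that also avoids
    -- these states at its end is contradictory: a chain must have ended before.
    dead : List State′
    dead = concatMap around inside

    dead-mass : Mass (λ s → count s dead) (f R₀ * (d * suc k))
    dead-mass = dead , (λ _ → ℕₚ.≤-refl) , ℕₚ.≤-trans (length-concatMap-≤ around (d * suc k) inside length-around)
      (ℕₚ.*-monoˡ-≤ (d * suc k) (growth R₀ u₀ inside (unique-filterᵇ (ball G R₀ u₀))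
        (All.tabulate (λ v∈ → ball⇒path R₀ (∈-filterᵇ⁻ (ball G R₀ u₀) v∈)))))

    dead-hit : ∀ {s} → Valid s → Path G u₀ R₀ (proj₁ s) → 1 ≤ count s dead
    dead-hit {u , w , α} (wu , _) p = count-∈ (∈-concatMap⁺ around inside (∈-filterᵇ⁺ (ball G R₀ u₀) (path⇒ball p))
      (∈-concatMap⁺ (λ w → map (λ α → u , w , α) colours) (neighbours G u) (neighbours⁺ {G = G} (adj-sym {G = G} wu))
        (∈-map⁺ (λ α → u , w , α) (∈-colours α))))

    run-or-stuck : ∀ σ m → (∃ λ i → i ≤ m × (∀ l → l < i → Moving (walk l σ)) × Stuck (walk i σ)) ⊎ (∀ l → l < m → Moving (walk l σ))
    run-or-stuck σ zero = inj₂ λ _ ()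
    run-or-stuck σ (suc m) with run-or-stuck σ m
    ... | inj₁ (i , i≤m , mv , st) = inj₁ (i , ℕₚ.m≤n⇒m≤1+n i≤m , mv , st)
    ... | inj₂ mv with moving-or-stuck (walk m σ)
    ... | inj₂ st = inj₁ (m , ℕₚ.n≤1+n m , mv , st)
    ... | inj₁ mm = inj₂ more
      where
      more : ∀ l → l < suc m → Moving (walk l σ)
      more l (s≤s l≤m) with ℕₚ.m≤n⇒m<n∨m≡n l≤m
      ... | inj₁ l<m = mv l l<m
      ... | inj₂ refl = mm

  Augmentation : Set
  Augmentation = ∃ λ ψ → Proper G ψ × (∀ a b → ψ a b ≡ nothing → Open a b) ×
    (∀ v → ¬ Path G u₀ (ρ * suc K₀) v → ∀ z → ψ v z ≡ φ v z)

  private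
    localise : ∀ {hist} → (∀ {v} → v ∈ hist → Path G u₀ (ρ * suc K₀) v) → ∃ (Solved hist) → Augmentation
    localise near (ψ , prop , closed , rest) = ψ , prop , closed , λ v far → rest v (far ∘ near)

    -- `j` chains are done and at most `K` remain. `O` forbids touching `hist` from the next state
    -- on; the present state lies on the last chain, and its compatibility is part of the invariant.
    search : ∀ K j hist {u w α ψ} O → j + K ≡ K₀ → Invariant hist u w α ψ → Path G u₀ (ρ * j) u →
      (∀ {v} → v ∈ hist → Path G u₀ (ρ * j) v) →
      (∀ s → Valid s → Path G u₀ R₀ (proj₁ s) → 1 ≤ O K s) →
      (∀ t {s v} → Valid s → v ∈ touch s → v ∈ hist → 1 ≤ O (suc t) s) →
      Φ K O (u , w , α) < q ^ K → Augmentation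
    search zero j hist {u} {w} {α} O jK inv near _ deadly _ lt = ⊥-elim (ℕₚ.<⇒≱
      (deadly (u , w , α) (i-valid inv) (path-mono (ℕₚ.*-monoʳ-≤ ρ (ℕₚ.≤-reflexive (trans (sym (ℕₚ.+-identityʳ j)) jK))) near)) (ℕₚ.≤-pred lt))
    search (suc K) j hist {u} {w} {α} {ψ} O jK inv near hist-near deadly avoid lt = by-outcome (outcome (u , w , α)) refl
      where
      s : State′
      s = u , w , α

      near′ : ∀ {v} → v ∈ hist ++ touch s → Path G u₀ (ρ * suc j) v
      near′ {v} v∈ with ∈-++⁻ hist v∈
      ... | inj₁ v∈ = path-mono (ℕₚ.*-monoʳ-≤ ρ (ℕₚ.n≤1+n j)) (hist-near v∈)
      ... | inj₂ v∈ = subst (λ m → Path G u₀ m v) (trans (ℕₚ.+-comm (ρ * j) ρ) (sym (ℕₚ.*-suc ρ j)))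
        (path-trans (ρ * j) near (touch-near {u} {w} {α} (i-valid inv) v∈))

      suc-j : suc j + K ≡ K₀
      suc-j = trans (sym (ℕₚ.+-suc j K)) jK

      finish : ∃ (Solved (hist ++ touch s)) → Augmentation
      finish = localise (λ v∈ → path-mono (ℕₚ.*-monoʳ-≤ ρ (s≤s (ℕₚ.≤-trans (ℕₚ.m≤m+n j (suc K)) (ℕₚ.≤-reflexive jK)))) (near′ v∈))

      by-outcome : (o : Outcome s) → outcome s ≡ o → Augmentation
      by-outcome (idle ¬valid) _ = ⊥-elim (¬valid (i-valid inv))
      by-outcome (done _ fan avail) _ = finish (finish-fan inv fan avail)
      by-outcome (path valid {y} fan a a≢b no-a no-b kind) out with run-or-stuck (a , free y , y) L
      ... | inj₁ (i , i≤L , mv , st) = finish (finish-path inv valid fan a a≢b no-a no-b kind out i i≤L mv st)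
      ... | inj₂ mv = extend
        where
        σ : Position
        σ = a , free y , y
        is-origin : origin (outcome s) ≡ just σ
        is-origin = cong origin out
        long : Long σ
        long i = mv (toℕ i) (Finₚ.toℕ<n i)
        anch : List (Fin n)
        anch = anchors inv valid fan a a≢b no-a no-b kind out

        -- Index 0 is the next state, whose chain follows this one and must avoid only its anchors;
        -- all later chains must avoid everything touched here.
        N : ℕ → State′ → ℕ
        N zero    = blocked anch
        N (suc t) = blocked (touch s)

        O′ : ℕ → State′ → ℕ
        O′ t x = O (suc t) x + N t x

        new : sum (map (Φ K N) (succs s)) ≤ q ^ suc K
        new = Φ-new 2c≤q q-large q-larger {N} (blocked-mass anch (s≤s (s≤s (length-neighbours {G = G} degree≤d w))))
          (λ _ → blocked-mass (touch s) (length-touch s)) K s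

        continue-at : ∀ t → t < 2 * q → Φ K O′ (next σ t) < q ^ K → Augmentation
        continue-at t t<ℓ lt′ =
          search K (suc j) (hist ++ touch s) O′ suc-j (proj₂ inv′)
            (near′ (∈-++⁺ʳ hist (touch-walk {s} {σ} {1 + t} is-origin (s≤s (ℕₚ.≤-trans (ℕₚ.<⇒≤ t<ℓ) (ℕₚ.n≤1+n _))))))
            near′
            (λ s′ v p → ℕₚ.≤-trans (deadly s′ v p) (ℕₚ.m≤m+n _ _))
            avoid′ lt′
          where
          clear : O′ 0 (next σ t) ≡ 0
          clear = Φ-clear K O′ (next σ t) lt′
          valid′ : Valid (next σ t)
          valid′ = next-valid {σ} {t} long t<ℓ
          inv′ : ∃ (Invariant (hist ++ touch s) (vertex (walk (1 + t) σ)) (vertex (walk (2 + t) σ)) (just (proj₁ (walk t σ))))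
          inv′ = advance-invariant inv valid fan a a≢b no-a no-b kind out long t t<ℓ
            (λ v∈ v∈hist → ℕₚ.<⇒≱ (avoid 0 valid′ v∈ v∈hist) (ℕₚ.≤-reflexive (ℕₚ.m+n≡0⇒m≡0 _ clear)))
            (λ v∈ v∈anch → ℕₚ.<⇒≱ (blocked-hit {anch} {s = next σ t} valid′ v∈ v∈anch) (ℕₚ.≤-reflexive (ℕₚ.m+n≡0⇒n≡0 (O 1 (next σ t)) clear)))
          avoid′ : ∀ t′ {s′ v} → Valid s′ → v ∈ touch s′ → v ∈ hist ++ touch s → 1 ≤ O′ (suc t′) s′
          avoid′ t′ {s′} vs v∈ v∈h with ∈-++⁻ hist v∈h
          ... | inj₁ h = ℕₚ.≤-trans (avoid (suc t′) vs v∈ h) (ℕₚ.m≤m+n _ _)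
          ... | inj₂ h = ℕₚ.≤-trans (blocked-hit {touch s} {s = s′} vs v∈ h) (ℕₚ.m≤n+m _ (O (suc (suc t′)) s′))

        extend : Augmentation
        extend = choose (Φ-step K O N s (length-succs {s} {σ} is-origin long) lt new)
          where
          choose : (∃ λ x → x ∈ succs s × Φ K O′ x < q ^ K) → Augmentation
          choose (x , x∈ , lt′) = go (succs⁻ {s} x∈)
            where
            go : (∃ λ τ → origin (outcome s) ≡ just τ × Long τ × ∃ λ t → t < 2 * q × x ≡ next τ t) → Augmentation
            go (τ , e , _ , t , t<ℓ , x≡) = continue-at t t<ℓ
              (subst (λ x → Φ K O′ x < q ^ K) (trans x≡ (cong (λ τ → next τ t) (Maybeₚ.just-injective (trans (sym e) is-origin)))) lt′)

  augmentation : Augmentation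
  augmentation = search K₀ 0 [] (deadline K₀ (λ s → count s dead)) refl invariant₀ stop (λ ())
    (λ s valid p → ℕₚ.≤-trans (dead-hit {s} valid p) (ℕₚ.≤-reflexive (sym (deadline-at K₀ _ s)))) (λ _ _ _ ())
    (ℕₚ.≤-<-trans (mass-≤ (Φ-deadline dead-mass K₀) (u₀ , w₀ , nothing)) K-large)

-- Choice of the constants

^-distribʳ-* : ∀ k m n → (m * n) ^ k ≡ m ^ k * n ^ k
^-distribʳ-* zero m n = refl
^-distribʳ-* (suc k) m n = trans (cong (m * n *_) (^-distribʳ-* k m n))
  (solve 4 (λ m n a b → m :* n :* (a :* b) := m :* a :* (n :* b)) refl m n (m ^ k) (n ^ k))
  where open +-*-Solver

-- Otherwise the `d + 1` colours would lead to `d + 1` distinct neighbours.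
free-colour : ∀ {n d} {G : Graph n} {φ : PartialColouring n (suc d)} → DegreeAtMost d G → Proper G φ → ∀ v → ∃ (Missing φ v)
free-colour {n} {d} {G} {φ} deg proper v with Finₚ.any? (λ c → ¬? (follow? φ v c))
... | yes (c , ¬e) = c , missing {φ = φ} ¬e
... | no all-used = ⊥-elim (ℕₚ.1+n≰n (ℕₚ.≤-trans (ℕₚ.≤-reflexive (sym len)) (deg v (map end (allFin (suc d)))
    (Uniqueₚ.map⁺ injective (Uniqueₚ.allFin⁺ (suc d)))
    (All.tabulate (λ u∈ → let (c , _ , u≡) = ∈-map⁻ end u∈ in trans (cong (adj G v) u≡) (edge-col proper (proj₂ (used c))))))))
  where
  used : ∀ c → ∃ λ u → φ v u ≡ just c
  used c with follow? φ v c
  ... | yes e = e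
  ... | no ¬e = ⊥-elim (all-used (c , ¬e))
  end : Fin (suc d) → Fin n
  end c = proj₁ (used c)
  injective : ∀ {c c′} → end c ≡ end c′ → c ≡ c′
  injective {c} {c′} e = Maybeₚ.just-injective (trans (sym (proj₂ (used c))) (trans (cong (φ v) e) (proj₂ (used c′))))
  len : length (map end (allFin (suc d))) ≡ suc d
  len = trans (length-map end (allFin (suc d))) (length-tabulate {n = suc d} id)

module Constants (f : ℕ → ℕ) (subexponential : Subexponential f) (D : ℕ) where

  abstract
    private
      c E q ρ K₁ K : ℕ
      c = suc ((1 + suc D * suc D) * (suc D * (D * suc (suc D))))
      -- More than the number of states with a given `u`; positive, so that `E ≤ E ^ K`.
      E = suc (D * suc (suc D))
      -- The summands pay for the anchors, for the part of an earlier chain that grows with `q`, for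
      -- the rest of that chain, and for the states inside the ball.
      q = suc ((2 + D) * c * c + 4 * (c * c * c) + 2 * (c * c * c) * (4 + D) + 2 * E * c)
      -- Two edges from `u` to the start of the path, then `L = 2 + 2 * q` along it.
      ρ = 4 + 2 * q
      K₁ = proj₁ (subexponential ρ (s≤s z≤n))
      K = suc K₁

      A₁ A₂ A₃ : ℕ
      A₁ = (2 + D) * c * c
      A₂ = 4 * (c * c * c)
      A₃ = 2 * (c * c * c) * (4 + D)

      c-large : ∀ {d} → d ≤ D → (1 + suc d * suc d) * (suc d * (d * suc (suc d))) ≤ c
      c-large d≤D = ℕₚ.≤-trans (ℕₚ.*-mono-≤ (s≤s (ℕₚ.*-mono-≤ (s≤s d≤D) (s≤s d≤D)))
        (ℕₚ.*-mono-≤ (s≤s d≤D) (ℕₚ.*-mono-≤ d≤D (s≤s (s≤s d≤D))))) (ℕₚ.n≤1+n _)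

      2Ec≤q : 2 * E * c ≤ q
      2Ec≤q = ℕₚ.≤-trans (ℕₚ.m≤n+m (2 * E * c) (A₁ + A₂ + A₃)) (ℕₚ.n≤1+n _)

      2c≤q : 2 * c ≤ q
      2c≤q = ℕₚ.≤-trans (ℕₚ.*-monoˡ-≤ c (ℕₚ.m≤m*n 2 E)) 2Ec≤q

      A≤q : A₁ + A₂ + A₃ ≤ q
      A≤q = ℕₚ.≤-trans (ℕₚ.m≤m+n _ (2 * E * c)) (ℕₚ.n≤1+n _)

      q-large : ∀ {d} → d ≤ D → (2 + d) * c * c ≤ q
      q-large d≤D = ℕₚ.≤-trans (ℕₚ.*-monoˡ-≤ c (ℕₚ.*-monoˡ-≤ c (s≤s (s≤s d≤D))))
        (ℕₚ.≤-trans (ℕₚ.m≤m+n A₁ A₂) (ℕₚ.≤-trans (ℕₚ.m≤m+n (A₁ + A₂) A₃) A≤q))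

      expand : ∀ q c D → (q * ((2 + D) * c) + 2 * ((suc D + (3 + 2 * q)) * c) * c) * c ≡
        q * ((2 + D) * c * c) + q * (4 * (c * c * c)) + 2 * (c * c * c) * (4 + D)
      expand = solve 3 (λ q c D → (q :* ((con 2 :+ D) :* c) :+ con 2 :* ((con 1 :+ D :+ (con 3 :+ con 2 :* q)) :* c) :* c) :* c :=
        q :* ((con 2 :+ D) :* c :* c) :+ q :* (con 4 :* (c :* c :* c)) :+ con 2 :* (c :* c :* c) :* (con 4 :+ D)) refl
        where open +-*-Solver

      q-larger : ∀ {d} → d ≤ D → (q * ((2 + d) * c) + 2 * ((suc d + (3 + 2 * q)) * c) * c) * c ≤ q * q
      q-larger {d} d≤D = begin
          (q * ((2 + d) * c) + 2 * ((suc d + (3 + 2 * q)) * c) * c) * c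
        ≤⟨ ℕₚ.*-monoˡ-≤ c (ℕₚ.+-mono-≤ (ℕₚ.*-monoʳ-≤ q (ℕₚ.*-monoˡ-≤ c (s≤s (s≤s d≤D))))
             (ℕₚ.*-monoˡ-≤ c (ℕₚ.*-monoʳ-≤ 2 (ℕₚ.*-monoˡ-≤ c (ℕₚ.+-monoˡ-≤ (3 + 2 * q) (s≤s d≤D)))))) ⟩
          (q * ((2 + D) * c) + 2 * ((suc D + (3 + 2 * q)) * c) * c) * c
        ≡⟨ expand q c D ⟩
          q * A₁ + q * A₂ + A₃
        ≤⟨ ℕₚ.+-monoʳ-≤ (q * A₁ + q * A₂) (ℕₚ.m≤m+n A₃ _) ⟩
          q * A₁ + q * A₂ + q * A₃
        ≡⟨ cong (_+ q * A₃) (sym (ℕₚ.*-distribˡ-+ q A₁ A₂)) ⟩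
          q * (A₁ + A₂) + q * A₃
        ≡⟨ sym (ℕₚ.*-distribˡ-+ q (A₁ + A₂) A₃) ⟩
          q * (A₁ + A₂ + A₃)
        ≤⟨ ℕₚ.*-monoʳ-≤ q A≤q ⟩
          q * q ∎
        where open ℕₚ.≤-Reasoning

      -- Subexponentiality with exponent `ρ` at radius `ρ * K`: the `ρ`-th power is below
      -- `2 ^ (ρ * K)`.
      f-small : f (ρ * K) < 2 ^ K
      f-small = ℕₚ.≰⇒> λ le → ℕₚ.<⇒≱
        (proj₂ (subexponential ρ (s≤s z≤n)) (ρ * K) (ℕₚ.≤-trans (ℕₚ.n≤1+n _) (ℕₚ.m≤m+n K _)))
        (ℕₚ.≤-trans (ℕₚ.≤-reflexive (trans (cong (2 ^_) (ℕₚ.*-comm ρ K)) (sym (ℕₚ.^-*-assoc 2 K ρ)))) (ℕₚ.^-monoˡ-≤ ρ le))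

      K-large : ∀ {d} → d ≤ D → f (ρ * K) * (d * suc (suc d)) * c ^ K < q ^ K
      K-large {d} d≤D = begin-strict
          f (ρ * K) * (d * suc (suc d)) * c ^ K
        ≤⟨ ℕₚ.*-monoˡ-≤ (c ^ K) (ℕₚ.*-monoʳ-≤ (f (ρ * K)) E-large) ⟩
          f (ρ * K) * E ^ K * c ^ K
        ≡⟨ ℕₚ.*-assoc (f (ρ * K)) (E ^ K) (c ^ K) ⟩
          f (ρ * K) * (E ^ K * c ^ K)
        <⟨ ℕₚ.*-monoˡ-< (E ^ K * c ^ K) {{ℕₚ.m*n≢0 (E ^ K) (c ^ K) {{ℕₚ.m^n≢0 E K}} {{ℕₚ.m^n≢0 c K}}}} f-small ⟩
          2 ^ K * (E ^ K * c ^ K)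
        ≡⟨ sym (ℕₚ.*-assoc (2 ^ K) (E ^ K) (c ^ K)) ⟩
          2 ^ K * E ^ K * c ^ K
        ≡⟨ cong (_* c ^ K) (sym (^-distribʳ-* K 2 E)) ⟩
          (2 * E) ^ K * c ^ K
        ≡⟨ sym (^-distribʳ-* K (2 * E) c) ⟩
          (2 * E * c) ^ K
        ≤⟨ ℕₚ.^-monoˡ-≤ K 2Ec≤q ⟩
          q ^ K ∎
        where
        open ℕₚ.≤-Reasoning
        E-large : d * suc (suc d) ≤ E ^ K
        E-large = ℕₚ.≤-trans (ℕₚ.≤-trans (ℕₚ.*-mono-≤ d≤D (s≤s (s≤s d≤D))) (ℕₚ.n≤1+n _)) (ℕₚ.m≤m*n E (E ^ K₁) {{ℕₚ.m^n≢0 E K₁}})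

    radius : ℕ
    radius = ρ * suc K

    colour-edge : ∀ {n d} → d ≤ D → {G : Graph n} → DegreeAtMost d G → GrowthAtMost f G →
      {φ : PartialColouring n (suc d)} → Proper G φ → ∀ u w → adj G w u ≡ true → φ w u ≡ nothing →
      ∃ λ ψ → Proper G ψ × (∀ a b → ψ a b ≡ nothing → φ a b ≡ nothing × ¬ SamePair a b w u) ×
        (∀ v → ¬ Path G u radius v → ∀ z → ψ v z ≡ φ v z)
    colour-edge {d = d} d≤D {G} deg growth {φ} proper u w wu hole = LocalAugment.augmentation {G = G} {φ} proper
      (λ v → proj₁ (free-colour {G = G} {φ} deg proper v)) (λ v → proj₂ (free-colour {G = G} {φ} deg proper v)) d deg f growth c q ρ K
      (c-large d≤D) 2c≤q (q-large d≤D) (q-larger d≤D) ℕₚ.≤-refl (K-large d≤D) u w wu hole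

  -- For every edge the distance is measured from the same end `v`, so all changes stay in one ball
  -- and the radii do not add up.
  colour-star : ∀ {n d} → d ≤ D → {G : Graph n} → DegreeAtMost d G → GrowthAtMost f G →
    {φ : PartialColouring n (suc d)} → Proper G φ → ∀ v →
    ∃ λ ψ → Proper G ψ × (∀ a b → ψ a b ≡ nothing → φ a b ≡ nothing) ×
      (∀ b → adj G v b ≡ true → ψ v b ≢ nothing) × (∀ a → ¬ Path G v radius a → ∀ z → ψ a z ≡ φ a z)
  colour-star {n} {d} d≤D {G} deg growth {φ} proper v with go (allFin n)
    where
    Done : List (Fin n) → PartialColouring n (suc d) → Set
    Done bs ψ = Proper G ψ × (∀ a b → ψ a b ≡ nothing → φ a b ≡ nothing) ×
      (∀ b → b ∈ bs → adj G v b ≡ true → ψ v b ≢ nothing) × (∀ a → ¬ Path G v radius a → ∀ z → ψ a z ≡ φ a z)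
    go : ∀ bs → ∃ (Done bs)
    go [] = φ , proper , (λ _ _ e → e) , (λ _ ()) , λ _ _ _ → refl
    go (b ∷ bs) with go bs
    ... | ψ , ψ-proper , grows , done , far with adj G v b in vb | ψ v b in ψvb
    ... | false | _ = ψ , ψ-proper , grows ,
        (λ { _ (here refl) e → case trans (sym vb) e of λ () ; b′ (there b∈) e → done b′ b∈ e }) , far
    ... | true | just c = ψ , ψ-proper , grows ,
        (λ { _ (here refl) _ e → case trans (sym ψvb) e of λ () ; b′ (there b∈) e → done b′ b∈ e }) , far
    ... | true | nothing with colour-edge d≤D deg growth ψ-proper v b (adj-sym {G = G} vb) (trans (sym-col ψ-proper b v) ψvb)
    ... | χ , χ-proper , filled , far′ = χ , χ-proper , (λ a b e → grows a b (proj₁ (filled a b e))) ,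
        (λ { _ (here refl) _ e → proj₂ (filled v b e) (inj₂ (refl , refl))
           ; b′ (there b∈) vb′ e → done b′ b∈ vb′ (proj₁ (filled v b′ e)) }) ,
        λ a ¬p z → trans (far′ a ¬p z) (far a ¬p z)
  ... | ψ , ψ-proper , grows , done , far = ψ , ψ-proper , grows , (λ b → done b (∈-allFin b)) , far

-- Linial's colour reduction

n<2^n : ∀ n → n < 2 ^ n
n<2^n zero = s≤s z≤n
n<2^n (suc n) = begin-strict
  suc n ≡⟨ ℕₚ.+-comm 1 n ⟩
  n + 1 <⟨ ℕₚ.+-mono-<-≤ (n<2^n n) (ℕₚ.m^n>0 2 n) ⟩
  2 ^ n + 2 ^ n ≡⟨ cong (2 ^ n +_) (sym (ℕₚ.+-identityʳ (2 ^ n))) ⟩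
  2 ^ suc n ∎
  where open ℕₚ.≤-Reasoning

⌈log₂⌉-≤ : ∀ {m k} → m ≤ 2 ^ k → ⌈log₂ m ⌉ ≤ k
⌈log₂⌉-≤ {m} {k} h = ℕₚ.≤-trans (⌈log₂⌉-mono-≤ h) (ℕₚ.≤-reflexive (⌈log₂2^n⌉≡n k))

⌈log₂1+n⌉≤n : ∀ n → ⌈log₂ suc n ⌉ ≤ n
⌈log₂1+n⌉≤n n = ⌈log₂⌉-≤ (n<2^n n)

n≤2^⌈log₂n⌉ : ∀ n → n ≤ 2 ^ ⌈log₂ n ⌉
n≤2^⌈log₂n⌉ n = go n n ℕₚ.≤-refl
  where
  open ℕₚ.≤-Reasoning
  half-≤ : ∀ m → ⌈ suc (suc m) /2⌉ ≤ suc m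
  half-≤ m = s≤s (ℕₚ.⌈n/2⌉≤n m)
  go : ∀ k n → n ≤ k → n ≤ 2 ^ ⌈log₂ n ⌉
  go k zero _ = z≤n
  go k (suc zero) _ = ℕₚ.m^n>0 2 ⌈log₂ 1 ⌉
  go (suc k) n@(suc (suc m)) (s≤s le) = begin
    n ≡⟨ sym (ℕₚ.⌊n/2⌋+⌈n/2⌉≡n n) ⟩
    ⌊ n /2⌋ + ⌈ n /2⌉ ≤⟨ ℕₚ.+-monoˡ-≤ ⌈ n /2⌉ (ℕₚ.⌊n/2⌋≤⌈n/2⌉ n) ⟩
    ⌈ n /2⌉ + ⌈ n /2⌉ ≡⟨ cong (⌈ n /2⌉ +_) (sym (ℕₚ.+-identityʳ ⌈ n /2⌉)) ⟩
    2 * ⌈ n /2⌉ ≤⟨ ℕₚ.*-monoʳ-≤ 2 (go k ⌈ n /2⌉ (ℕₚ.≤-trans (half-≤ m) le)) ⟩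
    2 * 2 ^ ⌈log₂ ⌈ n /2⌉ ⌉ ≡⟨ cong (λ l → 2 * 2 ^ l) (⌈log₂⌈n/2⌉⌉≡⌈log₂n⌉∸1 n) ⟩
    2 ^ suc (⌈log₂ n ⌉ ∸ 1) ≡⟨ cong (2 ^_) (trans (sym (ℕₚ.+-∸-assoc 1 (⌈log₂⌉-mono-≤ {2} {n} (s≤s (s≤s z≤n))))) refl) ⟩
    2 ^ ⌈log₂ n ⌉ ∎

iterLog : ℕ → ℕ → ℕ
iterLog zero    n = n
iterLog (suc t) n = ⌈log₂ iterLog t n ⌉

iterLog-log : ∀ t n → iterLog t ⌈log₂ n ⌉ ≡ iterLog (suc t) n
iterLog-log zero    n = refl
iterLog-log (suc t) n = cong ⌈log₂_⌉ (iterLog-log t n)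

-- The fuel suffices because `⌈log₂ m ⌉ < m` for `m ≥ 2`.
iterLog-logStar : ∀ n → iterLog (logStar n) n ≤ 1
iterLog-logStar n = go n n ℕₚ.≤-refl
  where
  go : ∀ k m → m ≤ k → iterLog (logStarFuel k m) m ≤ 1
  go zero    zero _ = z≤n
  go (suc k) zero _ = z≤n
  go (suc k) (suc zero) _ = s≤s z≤n
  go (suc k) m@(suc (suc m′)) (s≤s le) =
    subst (_≤ 1) (iterLog-log (logStarFuel k ⌈log₂ m ⌉) m) (go k ⌈log₂ m ⌉ (ℕₚ.≤-trans (⌈log₂1+n⌉≤n (suc m′)) le))

funToFin-cong : ∀ {m k} {g h : Fin m → Fin k} → (∀ i → g i ≡ h i) → funToFin g ≡ funToFin h
funToFin-cong {zero}  e = refl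
funToFin-cong {suc m} e = cong₂ combine (e zero) (funToFin-cong (e ∘ suc))

nth : {A : Set} → List A → ℕ → Maybe A
nth [] _ = nothing
nth (x ∷ xs) zero = just x
nth (x ∷ xs) (suc i) = nth xs i

nth-∈ : {A : Set} {x : A} {xs : List A} → x ∈ xs → ∃ λ i → i < length xs × nth xs i ≡ just x
nth-∈ (here refl) = 0 , s≤s z≤n , refl
nth-∈ (there x∈) with nth-∈ x∈
... | i , i< , e = suc i , s≤s i< , e

-- One round of colour reduction: the new colour lists, for each conflicting vertex, the position of a
-- bit in which the two colours differ, and the own value of that bit.
module Reduction (m P : ℕ) where

  -- The extra bit keeps `Fin bits` inhabited, so that `position` has a default.
  bits : ℕ
  bits = suc ⌈log₂ m ⌉

  palette : ℕ
  palette = (bits * 2) ^ P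

  m≤2^bits : m ≤ 2 ^ bits
  m≤2^bits = ℕₚ.≤-trans (n≤2^⌈log₂n⌉ m) (ℕₚ.^-monoʳ-≤ 2 (ℕₚ.n≤1+n ⌈log₂ m ⌉))

  abstract
    code : Fin m → Fin bits → Fin 2
    code c = finToFun (inject≤ c m≤2^bits)

    code-injective : ∀ {c c′} → (∀ i → code c i ≡ code c′ i) → c ≡ c′
    code-injective {c} {c′} e = Finₚ.inject≤-injective m≤2^bits m≤2^bits c c′ (begin
      inject≤ c m≤2^bits ≡⟨ sym (Finₚ.funToFin-finToFin {bits} {2} (inject≤ c m≤2^bits)) ⟩
      funToFin (code c) ≡⟨ funToFin-cong e ⟩
      funToFin (code c′) ≡⟨ Finₚ.funToFin-finToFin {bits} {2} (inject≤ c′ m≤2^bits) ⟩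
      inject≤ c′ m≤2^bits ∎)
      where open ≡-Reasoning

  differ? : ∀ c c′ → Dec (∃ λ i → code c i ≢ code c′ i)
  differ? c c′ = Finₚ.any? (λ i → ¬? (code c i Finₚ.≟ code c′ i))

  position : Fin m → Maybe (Fin m) → Fin bits
  position c nothing = zero
  position c (just c′) with differ? c c′
  ... | yes (i , _) = i
  ... | no _ = zero

  position-differs : ∀ {c c′} → c ≢ c′ → code c (position c (just c′)) ≢ code c′ (position c (just c′))
  position-differs {c} {c′} c≢c′ with differ? c c′
  ... | yes (_ , ne) = ne
  ... | no all-equal = ⊥-elim (c≢c′ (code-injective λ i → decide i (code c i Finₚ.≟ code c′ i)))
    where
    decide : ∀ i → Dec (code c i ≡ code c′ i) → code c i ≡ code c′ i
    decide i (yes e) = e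
    decide i (no ne) = ⊥-elim (all-equal (i , ne))

  entry : Fin m → Maybe (Fin m) → Fin (bits * 2)
  entry c e = combine (position c e) (code c (position c e))

  reduce : Fin m → List (Fin m) → Fin palette
  reduce c cs = funToFin (λ (j : Fin P) → entry c (nth cs (toℕ j)))

  -- At the index of `c′` in `cs`, equal results would name the same position and the same bit value
  -- for both colours; but this position was chosen because the two colours differ there.
  reduce-≢ : ∀ {c c′ cs cs′} → c ≢ c′ → c′ ∈ cs → length cs ≤ P → reduce c cs ≢ reduce c′ cs′
  reduce-≢ {c} {c′} {cs} {cs′} c≢c′ c′∈ len eq with nth-∈ c′∈
  ... | j , j< , at = position-differs c≢c′ (subst (λ e → code c (position c e) ≡ code c′ (position c e)) nth≡ (trans bit≡ (cong (code c′) (sym pos≡))))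
    where
    j<P : j < P
    j<P = ℕₚ.<-≤-trans j< len
    i : Fin P
    i = fromℕ< j<P
    nth≡ : nth cs (toℕ i) ≡ just c′
    nth≡ = trans (cong (nth cs) (Finₚ.toℕ-fromℕ< j<P)) at
    entry≡ : entry c (nth cs (toℕ i)) ≡ entry c′ (nth cs′ (toℕ i))
    entry≡ = begin
      entry c (nth cs (toℕ i)) ≡⟨ sym (Finₚ.finToFun-funToFin (λ (j : Fin P) → entry c (nth cs (toℕ j))) i) ⟩
      finToFun (reduce c cs) i ≡⟨ cong (λ z → finToFun z i) eq ⟩
      finToFun (reduce c′ cs′) i ≡⟨ Finₚ.finToFun-funToFin (λ (j : Fin P) → entry c′ (nth cs′ (toℕ j))) i ⟩
      entry c′ (nth cs′ (toℕ i)) ∎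
      where open ≡-Reasoning
    separated : position c (nth cs (toℕ i)) ≡ position c′ (nth cs′ (toℕ i)) ×
      code c (position c (nth cs (toℕ i))) ≡ code c′ (position c′ (nth cs′ (toℕ i)))
    separated = Finₚ.combine-injective (position c (nth cs (toℕ i))) (code c (position c (nth cs (toℕ i))))
      (position c′ (nth cs′ (toℕ i))) (code c′ (position c′ (nth cs′ (toℕ i)))) entry≡
    pos≡ : position c (nth cs (toℕ i)) ≡ position c′ (nth cs′ (toℕ i))
    pos≡ = proj₁ separated
    bit≡ : code c (position c (nth cs (toℕ i))) ≡ code c′ (position c′ (nth cs′ (toℕ i)))
    bit≡ = proj₂ separated

module Palettes (P : ℕ) where

  open Reduction using (palette)

  palettes : ℕ → ℕ → ℕ
  palettes zero    n = n
  palettes (suc t) n = palette (palettes t n) P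

  abstract
    private
      b B : ℕ
      -- Twice an exponent `e` with `2 ^ e ≥ 4 + 2 * P`, so `2 ^ b` dominates the square of
      -- `4 + 2 * P`, hence the quadratic `(3 + b) * P`.
      b = (3 + 2 * P) + (3 + 2 * P)
      B = 2 ^ b

      B-large : (3 + b) * P ≤ B
      B-large = begin
        (3 + b) * P ≤⟨ ℕₚ.m≤m+n ((3 + b) * P) (7 * P + 16) ⟩
        (3 + b) * P + (7 * P + 16) ≡⟨ solve 1 (λ P → (con 3 :+ ((con 3 :+ con 2 :* P) :+ (con 3 :+ con 2 :* P))) :* P :+ (con 7 :* P :+ con 16) := (con 4 :+ con 2 :* P) :* (con 4 :+ con 2 :* P)) refl P ⟩
        (4 + 2 * P) * (4 + 2 * P) ≤⟨ ℕₚ.*-mono-≤ (n<2^n (3 + 2 * P)) (n<2^n (3 + 2 * P)) ⟩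
        2 ^ (3 + 2 * P) * 2 ^ (3 + 2 * P) ≡⟨ sym (ℕₚ.^-distribˡ-+-* 2 (3 + 2 * P) (3 + 2 * P)) ⟩
        B ∎
        where
        open ℕₚ.≤-Reasoning
        open +-*-Solver

      P≤B : P ≤ B
      P≤B = ℕₚ.≤-trans (ℕₚ.m≤n*m P (3 + b)) B-large

      1≤B : 1 ≤ B
      1≤B = ℕₚ.m^n>0 2 b

      -- The factor `B` absorbs `P` and all rounding, so that `x` follows the iterated logarithm
      -- without error and `logStar n` rounds are enough.
      palette-bound : ∀ m x → m ≤ 2 ^ (B * (1 + x)) → palette m P ≤ 2 ^ (B * (1 + ⌈log₂ x ⌉))
      palette-bound m x h = begin
          (suc ⌈log₂ m ⌉ * 2) ^ P
        ≤⟨ ℕₚ.^-monoˡ-≤ P bits≤ ⟩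
          (2 ^ (3 + b + l)) ^ P
        ≡⟨ ℕₚ.^-*-assoc 2 (3 + b + l) P ⟩
          2 ^ ((3 + b + l) * P)
        ≤⟨ ℕₚ.^-monoʳ-≤ 2 (ℕₚ.≤-trans (ℕₚ.≤-reflexive (ℕₚ.*-distribʳ-+ P (3 + b) l))
             (ℕₚ.≤-trans (ℕₚ.+-mono-≤ B-large (ℕₚ.*-monoʳ-≤ l P≤B)) (ℕₚ.≤-reflexive (trans (cong (B +_) (ℕₚ.*-comm l B)) (sym (ℕₚ.*-suc B l)))))) ⟩
          2 ^ (B * (1 + l)) ∎
        where
        open ℕₚ.≤-Reasoning
        open +-*-Solver
        l : ℕ
        l = ⌈log₂ x ⌉
        bits≤ : suc ⌈log₂ m ⌉ * 2 ≤ 2 ^ (3 + b + l)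
        bits≤ = begin
            suc ⌈log₂ m ⌉ * 2
          ≤⟨ ℕₚ.*-monoˡ-≤ 2 (ℕₚ.+-mono-≤ (ℕₚ.*-mono-≤ 1≤B (s≤s (z≤n {x}))) (⌈log₂⌉-≤ h)) ⟩
            (B * (1 + x) + B * (1 + x)) * 2
          ≤⟨ ℕₚ.*-monoˡ-≤ 2 (ℕₚ.+-mono-≤ bound bound) ⟩
            (B * (2 ^ l + 2 ^ l) + B * (2 ^ l + 2 ^ l)) * 2
          ≡⟨ solve 2 (λ B l → (B :* (l :+ l) :+ B :* (l :+ l)) :* con 2 := con 8 :* (B :* l)) refl B (2 ^ l) ⟩
            8 * (2 ^ b * 2 ^ l)
          ≡⟨ cong (8 *_) (sym (ℕₚ.^-distribˡ-+-* 2 b l)) ⟩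
            2 ^ 3 * 2 ^ (b + l)
          ≡⟨ sym (ℕₚ.^-distribˡ-+-* 2 3 (b + l)) ⟩
            2 ^ (3 + b + l) ∎
          where
          bound : B * (1 + x) ≤ B * (2 ^ l + 2 ^ l)
          bound = ℕₚ.*-monoʳ-≤ B (ℕₚ.+-mono-≤ (ℕₚ.m^n>0 2 l) (n≤2^⌈log₂n⌉ x))

      palettes-bound : ∀ t n → palettes t n ≤ 2 ^ (B * (1 + iterLog t n))
      palettes-bound zero n = ℕₚ.≤-trans (ℕₚ.<⇒≤ (n<2^n n)) (ℕₚ.^-monoʳ-≤ 2
        (ℕₚ.≤-trans (ℕₚ.n≤1+n n) (ℕₚ.m≤n*m (suc n) B {{ℕₚ.m^n≢0 2 b}})))
      palettes-bound (suc t) n = palette-bound (palettes t n) (iterLog t n) (palettes-bound t n)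

    finalPalette : ℕ
    finalPalette = 2 ^ (B * 2)

    palettes-logStar : ∀ n → palettes (logStar n) n ≤ finalPalette
    palettes-logStar n = ℕₚ.≤-trans (palettes-bound (logStar n) n) (ℕₚ.^-monoʳ-≤ 2 (ℕₚ.*-monoʳ-≤ B (s≤s (iterLog-logStar n))))

-- Locality

module _ {n : ℕ} where

  -- Whole rows are compared, including edges that leave the ball. Distances are taken in `G`;
  -- agreement makes them the same in `H`, up to `r`.
  Agree : ℕ → Graph n → Graph n → Fin n → Set
  Agree r G H v = ∀ {w} → Path G v r w → ∀ x → adj G w x ≡ adj H w x

  module _ {G H : Graph n} where

    agree-mono : ∀ {r s v} → s ≤ r → Agree r G H v → Agree s G H v
    agree-mono s≤r ag p = ag (path-mono s≤r p)

    agree-at : ∀ a {b v w} → Agree (a + b) G H v → Path G v a w → Agree b G H w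
    agree-at a ag p q = ag (path-trans a p q)

    agree-path : ∀ {r s v w} → s ≤ r → Agree r G H v → Path G v s w → Path H v s w
    agree-path s≤r ag stop = stop
    agree-path s≤r ag (snoc {u = u} {x} p e) =
      snoc (agree-path s′≤r ag p) (trans (sym (ag (path-mono s′≤r p) x)) e)
      where s′≤r = ℕₚ.≤-trans (ℕₚ.n≤1+n _) s≤r

    agree-path⁻ : ∀ {r s v w} → s ≤ r → Agree r G H v → Path H v s w → Path G v s w
    agree-path⁻ s≤r ag stop = stop
    agree-path⁻ s≤r ag (snoc {u = u} {x} p e) = snoc p′ (trans (ag (path-mono s′≤r p′) x) e)
      where
      s′≤r = ℕₚ.≤-trans (ℕₚ.n≤1+n _) s≤r
      p′ = agree-path⁻ s′≤r ag p

    agree-ball : ∀ {r s v} → s ≤ r → Agree r G H v → ∀ w → ball G s v w ≡ ball H s v w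
    agree-ball {s = s} s≤r ag w = true-iff
      (λ e → path⇒ball (agree-path s≤r ag (ball⇒path s e)))
      (λ e → path⇒ball (agree-path⁻ s≤r ag (ball⇒path s e)))

  findFirst-just : (p : Fin n → Bool) (xs : List (Fin n)) {v : Fin n} → findFirst p xs ≡ just v → p v ≡ true
  findFirst-just p (x ∷ xs) e with p x in px
  findFirst-just p (x ∷ xs) refl | true = px
  ... | false = findFirst-just p xs e

  findFirst-nothing : (p : Fin n → Bool) (xs : List (Fin n)) → findFirst p xs ≡ nothing → ∀ {v} → v ∈ xs → p v ≡ false
  findFirst-nothing p (x ∷ xs) e v∈ with p x in px
  findFirst-nothing p (x ∷ xs) e (here refl) | false = px
  findFirst-nothing p (x ∷ xs) e (there v∈) | false = findFirst-nothing p xs e v∈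

  findFirst-cong : {p p′ : Fin n → Bool} → (∀ v → p v ≡ p′ v) → ∀ xs → findFirst p xs ≡ findFirst p′ xs
  findFirst-cong e [] = refl
  findFirst-cong {p} {p′} e (x ∷ xs) rewrite e x with p′ x
  ... | true = refl
  ... | false = findFirst-cong e xs

  -- Filter and map in one, so that congruence asks for equal values at selected vertices only.
  collect : {A : Set} → (Fin n → Bool) → (Fin n → A) → List (Fin n) → List A
  collect p g [] = []
  collect p g (v ∷ vs) = if p v then g v ∷ collect p g vs else collect p g vs

  collect-cong : {A : Set} {p p′ : Fin n → Bool} {g g′ : Fin n → A} → (∀ v → p v ≡ p′ v) →
    (∀ v → p v ≡ true → g v ≡ g′ v) → ∀ vs → collect p g vs ≡ collect p′ g′ vs
  collect-cong e e′ [] = refl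
  collect-cong {p = p} {p′} {g} e e′ (v ∷ vs) with p v in pv | p′ v in p′v
  ... | true  | true  = cong₂ _∷_ (e′ v pv) (collect-cong e e′ vs)
  ... | false | false = collect-cong e e′ vs
  ... | true  | false = case trans (sym pv) (trans (e v) p′v) of λ ()
  ... | false | true  = case trans (sym pv) (trans (e v) p′v) of λ ()

  ∈-collect : {A : Set} (p : Fin n → Bool) (g : Fin n → A) {v : Fin n} {vs : List (Fin n)} → v ∈ vs → p v ≡ true →
    g v ∈ collect p g vs
  ∈-collect p g {v} (here refl) pv rewrite pv = here refl
  ∈-collect p g {v} {x ∷ vs} (there v∈) pv with p x
  ... | true = there (∈-collect p g v∈ pv)
  ... | false = ∈-collect p g v∈ pv

  length-collect : {A : Set} (p : Fin n → Bool) (g : Fin n → A) (vs : List (Fin n)) → length (collect p g vs) ≡ length (filterᵇ p vs)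
  length-collect p g [] = refl
  length-collect p g (v ∷ vs) with p v
  ... | true = cong suc (length-collect p g vs)
  ... | false = length-collect p g vs

module PowerColouring (P δ : ℕ) where

  open Palettes P public

  module _ {n : ℕ} where

    conflicts : Graph n → Fin n → Fin n → Bool
    conflicts G v u = ball G δ v u ∧ not (u == v)

    colourAt : ∀ t → Graph n → Fin n → Fin (palettes t n)
    colourAt zero    G v = v
    colourAt (suc t) G v = Reduction.reduce (palettes t n) P (colourAt t G v) (collect (conflicts G v) (colourAt t G) (allFin n))

    colourAt-local : ∀ t {G H v} → Agree (t * δ) G H v → colourAt t G v ≡ colourAt t H v
    colourAt-local zero ag = refl
    colourAt-local (suc t) {G} {H} {v} ag = cong₂ (Reduction.reduce (palettes t n) P)
      (colourAt-local t (agree-mono {G = G} {H} (ℕₚ.m≤n+m (t * δ) δ) ag))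
      (collect-cong (λ u → cong (_∧ not (u == v)) (agree-ball {G = G} {H} (ℕₚ.m≤m+n δ (t * δ)) ag u))
        (λ u e → colourAt-local t (agree-at {G = G} {H} δ ag (ball⇒path δ (proj₁ (∧-true {ball G δ v u} e))))) (allFin n))

    colourAt-≢ : ∀ t {G : Graph n} → (∀ v us → Unique us → All (Path G v δ) us → length us ≤ P) →
      ∀ {u v} → Path G v δ u → u ≢ v → colourAt t G v ≢ colourAt t G u
    colourAt-≢ zero few p u≢v e = u≢v (sym e)
    colourAt-≢ (suc t) {G} few {u} {v} p u≢v = Reduction.reduce-≢ (palettes t n) P
      {cs = collect (conflicts G v) (colourAt t G) (allFin n)} {cs′ = collect (conflicts G u) (colourAt t G) (allFin n)}
      (colourAt-≢ t {G} few p u≢v)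
      (∈-collect (conflicts G v) (colourAt t G) (∈-allFin u) (∧-intro (path⇒ball p) u≠v))
      (ℕₚ.≤-trans (ℕₚ.≤-reflexive (length-collect (conflicts G v) (colourAt t G) (allFin n)))
        (few v _ (unique-filterᵇ (conflicts G v)) (All.tabulate (λ {w} w∈ →
          ball⇒path δ (proj₁ (∧-true {ball G δ v w} (∈-filterᵇ⁻ (conflicts G v) w∈)))))))
      where
      u≠v : not (u == v) ≡ true
      u≠v with u == v in e
      ... | true = ⊥-elim (u≢v (==-true u v e))
      ... | false = refl

-- Exhaustive search for a recolouring

vectors : {A : Set} → List A → ∀ n → List (Vec A n)
vectors xs zero    = Vec.[] ∷ []
vectors xs (suc n) = concatMap (λ x → map (x Vec.∷_) (vectors xs n)) xs

∈-vectors : {A : Set} {xs : List A} → (∀ x → x ∈ xs) → ∀ {n} (v : Vec A n) → v ∈ vectors xs n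
∈-vectors all Vec.[] = here refl
∈-vectors {xs = xs} all {suc n} (x Vec.∷ v) =
  ∈-concatMap⁺ (λ x → map (x Vec.∷_) (vectors xs n)) xs (all x) (∈-map⁺ (x Vec.∷_) (∈-vectors all v))

choose : {A : Set} {P : A → Set} → (∀ x → Dec (P x)) → A → List A → A
choose P? z [] = z
choose P? z (x ∷ xs) = if does (P? x) then x else choose P? z xs

choose-correct : {A : Set} {P : A → Set} (P? : ∀ x → Dec (P x)) (z : A) {x : A} {xs : List A} → x ∈ xs → P x → P (choose P? z xs)
choose-correct P? z {xs = x ∷ xs} x∈ Px with P? x
... | yes p = p
choose-correct P? z (here refl) Px | no ¬p = ⊥-elim (¬p Px)
choose-correct P? z (there x∈) Px | no ¬p = choose-correct P? z x∈ Px

module Recolouring (n d : ℕ) where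

  Colour : Set
  Colour = Maybe (Fin (suc d))

  -- Vectors instead of functions: they can be enumerated, and windows with equal entries are equal,
  -- so `repair` returns the same rows for them.
  Row : Set
  Row = Vec Colour n

  Rows : Set
  Rows = Vec Row n

  -- nothing for a non-edge, just nothing for an uncoloured edge.
  Window : Set
  Window = Vec (Vec (Maybe Colour) n) n

  at : {A : Set} → Vec (Vec A n) n → Fin n → Fin n → A
  at m a b = lookup (lookup m a) b

  record Repairs (W : Window) (near : Vec Bool n) (v : Fin n) (ψ : Rows) : Set where
    constructor repairs
    field
      r-sym      : ∀ a b → at ψ a b ≡ at ψ b a
      r-edge     : ∀ a b → at W a b ≡ nothing → at ψ a b ≡ nothing
      r-matching : ∀ a b b′ → at ψ a b ≢ nothing → at ψ a b ≡ at ψ a b′ → b ≡ b′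
      r-keeps    : ∀ a b → at ψ a b ≡ nothing → at W a b ≡ nothing ⊎ at W a b ≡ just nothing
      r-star     : ∀ b → at W v b ≢ nothing → at ψ v b ≢ nothing
      r-far      : ∀ a b → lookup near a ≡ false → at W a b ≢ nothing → at W a b ≡ just (at ψ a b)
  open Repairs public

  private
    _≟ʷ_ : DecidableEquality (Maybe Colour)
    _≟ʷ_ = Maybeₚ.≡-dec _≟ᵐ_

  repairs? : ∀ W near v ψ → Dec (Repairs W near v ψ)
  repairs? W near v ψ
    with Finₚ.all? (λ a → Finₚ.all? λ b → at ψ a b ≟ᵐ at ψ b a)
       | Finₚ.all? (λ a → Finₚ.all? λ b → (at W a b ≟ʷ nothing) →-dec (at ψ a b ≟ᵐ nothing))
       | Finₚ.all? (λ a → Finₚ.all? λ b → Finₚ.all? λ b′ → ¬? (at ψ a b ≟ᵐ nothing) →-dec ((at ψ a b ≟ᵐ at ψ a b′) →-dec (b ≟ᶠ b′)))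
       | Finₚ.all? (λ a → Finₚ.all? λ b → (at ψ a b ≟ᵐ nothing) →-dec ((at W a b ≟ʷ nothing) ⊎-dec (at W a b ≟ʷ just nothing)))
       | Finₚ.all? (λ b → ¬? (at W v b ≟ʷ nothing) →-dec ¬? (at ψ v b ≟ᵐ nothing))
       | Finₚ.all? (λ a → Finₚ.all? λ b → (lookup near a Boolₚ.≟ false) →-dec (¬? (at W a b ≟ʷ nothing) →-dec (at W a b ≟ʷ just (at ψ a b))))
  ... | no ¬h | _ | _ | _ | _ | _ = no (¬h ∘ r-sym)
  ... | yes _ | no ¬h | _ | _ | _ | _ = no (¬h ∘ r-edge)
  ... | yes _ | yes _ | no ¬h | _ | _ | _ = no (¬h ∘ r-matching)
  ... | yes _ | yes _ | yes _ | no ¬h | _ | _ = no (¬h ∘ r-keeps)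
  ... | yes _ | yes _ | yes _ | yes _ | no ¬h | _ = no (¬h ∘ r-star)
  ... | yes _ | yes _ | yes _ | yes _ | yes _ | no ¬h = no (¬h ∘ r-far)
  ... | yes h₁ | yes h₂ | yes h₃ | yes h₄ | yes h₅ | yes h₆ = yes (repairs h₁ h₂ h₃ h₄ h₅ h₆)

  private
    allColours : List Colour
    allColours = nothing ∷ map just (allFin (suc d))

    ∈-allColours : ∀ c → c ∈ allColours
    ∈-allColours nothing = here refl
    ∈-allColours (just c) = there (∈-map⁺ just (∈-allFin c))

  blank : Row
  blank = tabulate (λ _ → nothing)

  -- An exhaustive search, so that the outcome is a function of the window alone.
  abstract
    repair : Window → Vec Bool n → Fin n → Rows
    repair W near v = choose (repairs? W near v) (tabulate (λ _ → blank)) (vectors (vectors allColours n) n)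

    repair-correct : ∀ {W near v ψ} → Repairs W near v ψ → Repairs W near v (repair W near v)
    repair-correct {W} {near} {v} {ψ} r =
      choose-correct (repairs? W near v) (tabulate (λ _ → blank)) (∈-vectors (∈-vectors ∈-allColours) ψ) r

-- Recolouring one colour class at a time

false-unless : ∀ {b} → ¬ (b ≡ true) → b ≡ false
false-unless {true}  h = ⊥-elim (h refl)
false-unless {false} h = refl

-- A centre can augment only inside what it sees. Restriction keeps the degree and growth bounds, so
-- `colour-star` applies to the part inside a ball.
restrict : ∀ {n} → Graph n → (Fin n → Bool) → Graph n
adj    (restrict G p) a b = p a ∧ (p b ∧ adj G a b)
symm   (restrict G p) a b = true-iff flip-∧ flip-∧
  where
  flip-∧ : ∀ {a b} → p a ∧ (p b ∧ adj G a b) ≡ true → p b ∧ (p a ∧ adj G b a) ≡ true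
  flip-∧ {a} {b} e with ∧-true {p a} e
  ... | pa , e′ with ∧-true {p b} e′
  ... | pb , ab = ∧-intro pb (∧-intro pa (adj-sym {G = G} ab))
irrefl (restrict G p) v = false-unless λ e → adj-≢ {G = G} (proj₂ (∧-true {p v} (proj₂ (∧-true {p v} e)))) refl

module _ {n : ℕ} {G : Graph n} {p : Fin n → Bool} where

  restrict-adj : ∀ {a b} → adj (restrict G p) a b ≡ true → adj G a b ≡ true
  restrict-adj {a} {b} e = proj₂ (∧-true {p b} (proj₂ (∧-true {p a} e)))

  restrict-path : ∀ {v r u} → Path (restrict G p) v r u → Path G v r u
  restrict-path stop = stop
  restrict-path (snoc q e) = snoc (restrict-path q) (restrict-adj e)

  restrict-degree : ∀ {d} → DegreeAtMost d G → DegreeAtMost d (restrict G p)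
  restrict-degree deg v xs u all = deg v xs u (All.map restrict-adj all)

  restrict-growth : ∀ {f} → GrowthAtMost f G → GrowthAtMost f (restrict G p)
  restrict-growth growth r v xs u all = growth r v xs u (All.map restrict-path all)

module Procedure (f : ℕ → ℕ) (subexponential : Subexponential f) (D d : ℕ) (d≤D : d ≤ D) where

  open Constants f subexponential D

  -- No edge joins the `R`-balls of two centres at distance more than `δ`. A centre is up to `R`
  -- away, and its window extends to `suc R` to contain every edge at a changed vertex.
  R δ reach : ℕ
  R = radius
  δ = suc (R + R)
  reach = R + suc R

  open PowerColouring (f δ) δ

  module _ {n : ℕ} where

    open Recolouring n d

    inside : Graph n → Fin n → Fin n → Bool
    inside G v = ball G (suc R) v

    window : Graph n → (Fin n → Row) → Fin n → Window
    window G x v = tabulate λ a → tabulate λ b → if adj (restrict G (inside G v)) a b then just (lookup (x a) b) else nothing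

    nearby : Graph n → Fin n → Vec Bool n
    nearby G v = tabulate (ball G R v)

    rowsOf : (Fin n → Row) → PartialColouring n (suc d)
    rowsOf x a b = lookup (x a) b

    at-tabulate : {A : Set} (m : Fin n → Fin n → A) (a b : Fin n) → at (tabulate λ a → tabulate λ b → m a b) a b ≡ m a b
    at-tabulate m a b = trans (cong (λ z → lookup z b) (Vecₚ.lookup∘tabulate (λ a → tabulate λ b → m a b) a)) (Vecₚ.lookup∘tabulate (m a) b)

    module _ (G : Graph n) (x : Fin n → Row) (v : Fin n) where

      private
        H : Graph n
        H = restrict G (inside G v)

      window-edge : ∀ {a b} → adj H a b ≡ true → at (window G x v) a b ≡ just (rowsOf x a b)
      window-edge {a} {b} e = trans (at-tabulate _ a b) (cong (λ z → if z then just (rowsOf x a b) else nothing) e)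

      window-nonedge : ∀ {a b} → ¬ (adj H a b ≡ true) → at (window G x v) a b ≡ nothing
      window-nonedge {a} {b} e = trans (at-tabulate _ a b) (cong (λ z → if z then just (rowsOf x a b) else nothing) (false-unless e))

      window-edge⁻ : ∀ {a b} → at (window G x v) a b ≢ nothing → adj H a b ≡ true
      window-edge⁻ {a} {b} ne with adj H a b in e
      ... | true = refl
      ... | false = ⊥-elim (ne (window-nonedge {a} {b} (λ e′ → case trans (sym e) e′ of λ ())))

      window-near : ∀ {a b} → Path G v R a → adj G a b ≡ true → adj H a b ≡ true
      window-near p ab = ∧-intro (path⇒ball (path-mono (ℕₚ.n≤1+n R) p)) (∧-intro (path⇒ball (snoc p ab)) ab)

      module _ (deg : DegreeAtMost d G) (growth : GrowthAtMost f G) (proper : Proper G (rowsOf x)) where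

        private
          φ : PartialColouring n (suc d)
          φ a b = if adj H a b then rowsOf x a b else nothing

          φ-edge : ∀ {a b} → adj H a b ≡ true → φ a b ≡ rowsOf x a b
          φ-edge e rewrite e = refl

          φ-nonedge : ∀ {a b} → adj H a b ≡ false → φ a b ≡ nothing
          φ-nonedge e rewrite e = refl

          φ-just : ∀ {a b c} → φ a b ≡ just c → adj H a b ≡ true × rowsOf x a b ≡ just c
          φ-just {a} {b} e with adj H a b
          ... | true = refl , e
          φ-just () | false

          φ-proper : Proper H φ
          sym-col φ-proper a b with adj H a b in e
          ... | true = trans (sym-col proper a b) (sym (φ-edge (adj-sym {G = H} e)))
          ... | false = sym (φ-nonedge (trans (symm H b a) e))
          edge-col φ-proper e = proj₁ (φ-just e)
          matching φ-proper e e′ = matching proper (proj₂ (φ-just e)) (proj₂ (φ-just e′))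

        repairable : ∃ (Repairs (window G x v) (nearby G v) v)
        repairable with colour-star d≤D (restrict-degree {G = G} {inside G v} deg) (restrict-growth {G = G} {inside G v} growth) φ-proper v
        ... | ψ , ψ-proper , keeps , star , far = (tabulate λ a → tabulate λ b → ψ a b) , repairs
          (λ a b → trans (ψ≡ a b) (trans (sym-col ψ-proper a b) (sym (ψ≡ b a))))
          (λ a b e → trans (ψ≡ a b) (no-colour a b (λ ab → case trans (sym (window-edge ab)) e of λ ())))
          (λ a b b′ ne e → same-end a b b′ (ψ a b) refl (λ z → ne (trans (ψ≡ a b) z)) (trans (sym (ψ≡ a b)) (trans e (ψ≡ a b′))))
          (λ a b e → kept a b (keeps a b (trans (sym (ψ≡ a b)) e)))
          (λ b ne e → star b (window-edge⁻ {v} {b} ne) (trans (sym (ψ≡ v b)) e))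
          (λ a b off ne → trans (window-edge (window-edge⁻ {a} {b} ne)) (cong just (trans (sym (φ-edge (window-edge⁻ {a} {b} ne)))
            (trans (sym (far a (not-near a off) b)) (sym (ψ≡ a b))))))
          where
          ψ≡ : ∀ a b → at (tabulate λ a → tabulate λ b → ψ a b) a b ≡ ψ a b
          ψ≡ = at-tabulate ψ
          no-colour : ∀ a b → ¬ (adj H a b ≡ true) → ψ a b ≡ nothing
          no-colour a b ¬ab with ψ a b in e
          ... | nothing = refl
          ... | just c = ⊥-elim (¬ab (edge-col ψ-proper e))
          same-end : ∀ a b b′ m → ψ a b ≡ m → ψ a b ≢ nothing → ψ a b ≡ ψ a b′ → b ≡ b′
          same-end a b b′ (just c) e _ e′ = matching ψ-proper e (trans (sym e′) e)
          same-end a b b′ nothing e ne _ = ⊥-elim (ne e)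
          kept : ∀ a b → φ a b ≡ nothing → at (window G x v) a b ≡ nothing ⊎ at (window G x v) a b ≡ just nothing
          kept a b e with adj H a b in ab
          ... | true = inj₂ (trans (window-edge ab) (cong just e))
          ... | false = inj₁ (window-nonedge {a} {b} (λ ab′ → case trans (sym ab) ab′ of λ ()))
          not-near : ∀ a → lookup (nearby G v) a ≡ false → ¬ Path H v R a
          not-near a off p = case trans (sym off) (trans (Vecₚ.lookup∘tabulate (ball G R v) a) (path⇒ball (restrict-path {G = G} {inside G v} p))) of λ ()

        repaired : Repairs (window G x v) (nearby G v) v (repair (window G x v) (nearby G v) v)
        repaired = repair-correct (proj₂ repairable)

    selects : Graph n → (Fin n → ℕ) → ℕ → Fin n → Fin n → Bool
    selects G c i a v = ball G R a v ∧ (c v ≡ᵇ i)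

    -- Two vertices of class `i` within `R` of `a` would be at distance at most `R + R`, below `δ`,
    -- so the order of the search does not matter when the classes are spread.
    centre : Graph n → (Fin n → ℕ) → ℕ → Fin n → Maybe (Fin n)
    centre G c i a = findFirst (selects G c i a) (allFin n)

    rowFrom : Graph n → (Fin n → Row) → Fin n → Maybe (Fin n) → Row
    rowFrom G x a nothing  = x a
    rowFrom G x a (just v) = lookup (repair (window G x v) (nearby G v) v) a

    recolourClass : Graph n → (Fin n → ℕ) → ℕ → (Fin n → Row) → Fin n → Row
    recolourClass G c i x a = rowFrom G x a (centre G c i a)

    module _ {G : Graph n} {c : Fin n → ℕ} (i : ℕ) (x : Fin n → Row) (deg : DegreeAtMost d G) (growth : GrowthAtMost f G)
      (proper : Proper G (rowsOf x)) (spread : ∀ {u v} → Path G v δ u → c u ≡ c v → u ≡ v) where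

      private
        ψ : Fin n → PartialColouring n (suc d)
        ψ v = at (repair (window G x v) (nearby G v) v)

        rep : ∀ v → Repairs (window G x v) (nearby G v) v (repair (window G x v) (nearby G v) v)
        rep v = repaired G x v deg growth proper

        φ′ : PartialColouring n (suc d)
        φ′ = rowsOf (recolourClass G c i x)

        data Row-of (a : Fin n) : Set where
          kept : (∀ {v} → Path G a R v → c v ≢ i) → (∀ b → φ′ a b ≡ rowsOf x a b) → Row-of a
          new  : ∀ v → Path G a R v → c v ≡ i → (∀ b → φ′ a b ≡ ψ v a b) → Row-of a

        row-of : ∀ a → Row-of a
        row-of a with centre G c i a in e
        ... | nothing = kept (λ {v} p cv → case trans (sym (findFirst-nothing _ (allFin n) e (∈-allFin v)))
                (∧-intro (path⇒ball p) (≡ᵇ-true cv)) of λ ()) (λ b → cong (λ z → lookup (rowFrom G x a z) b) e)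
          where
          ≡ᵇ-true : ∀ {j} → j ≡ i → (j ≡ᵇ i) ≡ true
          ≡ᵇ-true {j} refl with j ≡ᵇ j | ℕₚ.≡⇒≡ᵇ j j refl
          ... | true | _ = refl
        ... | just v with ∧-true {ball G R a v} (findFirst-just _ (allFin n) e)
        ... | near , cv = new v (ball⇒path R near) (ℕₚ.≡ᵇ⇒≡ (c v) i (subst T (sym cv) tt))
          (λ b → cong (λ z → lookup (rowFrom G x a z) b) e)

        ψ-edge : ∀ {v a b} → ψ v a b ≢ nothing → adj G a b ≡ true
        ψ-edge {v} {a} {b} ne with adj (restrict G (inside G v)) a b in e
        ... | true = restrict-adj {G = G} {inside G v} e
        ... | false = ⊥-elim (ne (r-edge (rep v) a b (window-nonedge G x v {a} {b} (λ e′ → case trans (sym e) e′ of λ ()))))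

        not-nothing : ∀ {A : Set} {m : Maybe A} {c} → m ≡ just c → m ≢ nothing
        not-nothing refl ()

        φ′-edge : ∀ {a b} → φ′ a b ≢ nothing → adj G a b ≡ true
        φ′-edge {a} {b} ne with row-of a
        ... | new v _ _ e = ψ-edge {v} (λ z → ne (trans (e b) z))
        ... | kept _ e with rowsOf x a b in xab
        ...   | just _ = edge-col proper xab
        ...   | nothing = ⊥-elim (ne (trans (e b) xab))

        -- An edge leaving the ball of `v` is in the window, but the repair keeps the rows outside
        -- the ball. This makes the two ends of the edge agree on its colour.
        ψ-far : ∀ {v a b} → Path G v R b → adj G a b ≡ true → ¬ Path G a R v → ψ v a b ≡ rowsOf x a b
        ψ-far {v} {a} {b} p ab ¬p = sym (Maybeₚ.just-injective (trans (sym (window-edge G x v edge)) (r-far (rep v) a b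
          (trans (Vecₚ.lookup∘tabulate (ball G R v) a) (false-unless (λ e → ¬p (path-sym (ball⇒path R e)))))
          (λ z → case trans (sym (window-edge G x v edge)) z of λ ()))))
          where
          edge : adj (restrict G (inside G v)) a b ≡ true
          edge = adj-sym {G = restrict G (inside G v)} (window-near G x v p (adj-sym {G = G} ab))

        same-centre : ∀ {a b u v} → adj G a b ≡ true → Path G a R u → Path G b R v → c u ≡ i → c v ≡ i → u ≡ v
        same-centre {a} {b} {u} {v} ab p q cu cv = spread
          (path-mono (ℕₚ.≤-reflexive (ℕₚ.+-suc R R)) (path-trans R (path-sym q) (path-trans 1 (path-edge (adj-sym {G = G} ab)) p))) (trans cu (sym cv))

        φ′-sym-adj : ∀ a b → adj G a b ≡ true → φ′ a b ≡ φ′ b a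
        φ′-sym-adj a b ab with row-of a | row-of b
        ... | kept _ e | kept _ e′ = trans (e b) (trans (sym-col proper a b) (sym (e′ a)))
        ... | new u p cu e | new v q cv e′ with same-centre ab p q cu cv
        ...   | refl = trans (e b) (trans (r-sym (rep u) a b) (sym (e′ a)))
        φ′-sym-adj a b ab | kept none e | new v q cv e′ = trans (e b) (trans (sym (ψ-far (path-sym q) ab (λ p → none p cv)))
          (trans (r-sym (rep v) a b) (sym (e′ a))))
        φ′-sym-adj a b ab | new u p cu e | kept none e′ = trans (e b) (trans (r-sym (rep u) a b)
          (trans (ψ-far (path-sym p) (adj-sym {G = G} ab) (λ q → none q cu)) (sym (e′ a))))

        φ′-nonadj : ∀ {a b} → ¬ (adj G a b ≡ true) → φ′ a b ≡ nothing
        φ′-nonadj {a} {b} ¬ab with φ′ a b in e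
        ... | nothing = refl
        ... | just _ = ⊥-elim (¬ab (φ′-edge (not-nothing e)))

      recolourClass-proper : Proper G (rowsOf (recolourClass G c i x))
      sym-col recolourClass-proper a b with adj G a b in e
      ... | true = φ′-sym-adj a b e
      ... | false = trans (φ′-nonadj (λ ab → case trans (sym e) ab of λ ()))
        (sym (φ′-nonadj (λ ba → case trans (sym e) (trans (symm G a b) ba) of λ ())))
      edge-col recolourClass-proper e = φ′-edge (not-nothing e)
      matching recolourClass-proper {a} {b} {b′} e e′ with row-of a
      ... | kept _ h = matching proper (trans (sym (h b)) e) (trans (sym (h b′)) e′)
      ... | new v _ _ h = r-matching (rep v) a b b′ (not-nothing (trans (sym (h b)) e)) (trans (sym (h b)) (trans e (trans (sym e′) (h b′))))

      recolourClass-keeps : ∀ {a b} → adj G a b ≡ true → rowsOf (recolourClass G c i x) a b ≡ nothing → rowsOf x a b ≡ nothing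
      recolourClass-keeps {a} {b} ab e with row-of a
      ... | kept _ h = trans (sym (h b)) e
      ... | new v p _ h = uncoloured (r-keeps (rep v) a b (trans (sym (h b)) e))
        where
        seen : at (window G x v) a b ≡ just (rowsOf x a b)
        seen = window-edge G x v (window-near G x v (path-sym p) ab)
        uncoloured : at (window G x v) a b ≡ nothing ⊎ at (window G x v) a b ≡ just nothing → rowsOf x a b ≡ nothing
        uncoloured (inj₁ z) = case trans (sym seen) z of λ ()
        uncoloured (inj₂ z) = Maybeₚ.just-injective (trans (sym seen) z)

      recolourClass-star : ∀ {a b} → adj G a b ≡ true → c a ≡ i → rowsOf (recolourClass G c i x) a b ≢ nothing
      recolourClass-star {a} {b} ab ca e with row-of a
      ... | kept none _ = none stop ca
      ... | new v p cv h with spread (path-mono (ℕₚ.≤-trans (ℕₚ.m≤m+n R R) (ℕₚ.n≤1+n _)) p) (trans cv (sym ca))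
      ...   | refl = r-star (rep a) b (not-nothing (window-edge G x a (window-near G x a stop ab))) (trans (sym (h b)) e)

    -- The centre is found within `R`, its window is read within `suc R` of the centre, and `repair`
    -- depends on nothing else.
    recolourClass-local : ∀ {G H : Graph n} {c c′ : Fin n → ℕ} {x x′ : Fin n → Row} i {a} → Agree reach G H a →
      (∀ {v} → Path G a reach v → c v ≡ c′ v) → (∀ {v} → Path G a reach v → x v ≡ x′ v) →
      recolourClass G c i x a ≡ recolourClass H c′ i x′ a
    recolourClass-local {G} {H} {c} {c′} {x} {x′} i {a} ag ec ex =
      trans (row-same (centre G c i a) refl) (cong (rowFrom H x′ a) (findFirst-cong same-selects (allFin n)))
      where
      R≤ : R ≤ reach
      R≤ = ℕₚ.m≤m+n R (suc R)
      same-selects : ∀ v → selects G c i a v ≡ selects H c′ i a v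
      same-selects v with ball G R a v in e | agree-ball {G = G} {H} R≤ ag v
      ... | false | e′ = cong (_∧ (c′ v ≡ᵇ i)) (trans (sym e) (trans e e′))
      ... | true  | e′ = trans (cong (_≡ᵇ i) (ec (path-mono R≤ (ball⇒path R e)))) (cong (_∧ (c′ v ≡ᵇ i)) (trans (sym e) (trans e e′)))
      row-same : ∀ m → centre G c i a ≡ m → rowFrom G x a m ≡ rowFrom H x′ a m
      row-same nothing _ = ex stop
      row-same (just v) e = cong₂ (λ W N → lookup (repair W N v) a) window≡ nearby≡
        where
        near : Path G a R v
        near = ball⇒path R (proj₁ (∧-true {ball G R a v} (findFirst-just _ (allFin n) e)))
        ag′ : Agree (suc R) G H v
        ag′ = agree-at {G = G} {H} R ag near
        nearby≡ : nearby G v ≡ nearby H v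
        nearby≡ = Vecₚ.tabulate-cong (agree-ball {G = G} {H} (ℕₚ.n≤1+n R) ag′)
        window≡ : window G x v ≡ window H x′ v
        window≡ = Vecₚ.tabulate-cong λ p → Vecₚ.tabulate-cong λ q → entry p q
          where
          entry : ∀ p q → (if adj (restrict G (inside G v)) p q then just (lookup (x p) q) else nothing) ≡
            (if adj (restrict H (inside H v)) p q then just (lookup (x′ p) q) else nothing)
          entry p q = by-membership (inside G v p) refl
            where
            same-inside : ∀ z → inside G v z ≡ inside H v z
            same-inside = agree-ball {G = G} {H} {suc R} ℕₚ.≤-refl ag′
            outside : ∀ {b s} {m : Maybe Colour} → b ≡ false → (if b ∧ s then m else nothing) ≡ nothing
            outside refl = refl
            by-membership : ∀ b → inside G v p ≡ b → (if adj (restrict G (inside G v)) p q then just (lookup (x p) q) else nothing) ≡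
              (if adj (restrict H (inside H v)) p q then just (lookup (x′ p) q) else nothing)
            by-membership false e = trans (outside e) (sym (outside (trans (sym (same-inside p)) e)))
            by-membership true e = cong₂ (λ z w → if z then just (lookup w q) else nothing)
              (cong₂ _∧_ (same-inside p) (cong₂ _∧_ (same-inside q) (ag′ (ball⇒path (suc R) e) q)))
              (ex (path-trans R near (ball⇒path (suc R) e)))

    vertexColour : Graph n → Fin n → ℕ
    vertexColour G v = toℕ (colourAt (logStar n) G v)

    rows : ℕ → Graph n → Fin n → Row
    rows zero    G a = blank
    rows (suc i) G a = recolourClass G (vertexColour G) i (rows i G) a

    depth : ℕ → ℕ
    depth zero    = logStar n * δ
    depth (suc i) = reach + depth i

    depth≥ : ∀ i → logStar n * δ ≤ depth i
    depth≥ zero = ℕₚ.≤-refl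
    depth≥ (suc i) = ℕₚ.≤-trans (depth≥ i) (ℕₚ.m≤n+m (depth i) reach)

    rows-local : ∀ i {G H : Graph n} {a} → Agree (depth i) G H a → rows i G a ≡ rows i H a
    rows-local zero ag = refl
    rows-local (suc i) {G} {H} ag = recolourClass-local {G} {H} {vertexColour G} {vertexColour H} {rows i G} {rows i H} i
      (agree-mono {G = G} {H} (ℕₚ.m≤m+n reach (depth i)) ag)
      (λ p → cong toℕ (colourAt-local (logStar n) {G} {H} (agree-mono {G = G} {H} (depth≥ i) (agree-at {G = G} {H} reach ag p))))
      (λ p → rows-local i (agree-at {G = G} {H} reach ag p))

    finalRows : Graph n → Fin n → Row
    finalRows = rows finalPalette

    finalRows-local : ∀ {G H : Graph n} {a} → Agree (depth finalPalette) G H a → finalRows G a ≡ finalRows H a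
    finalRows-local {G} {H} = rows-local finalPalette {G} {H}

    module _ {G : Graph n} (deg : DegreeAtMost d G) (growth : GrowthAtMost f G) where

      private
        spread : ∀ {u v} → Path G v δ u → vertexColour G u ≡ vertexColour G v → u ≡ v
        spread {u} {v} p e with u ≟ᶠ v
        ... | yes u≡v = u≡v
        ... | no u≢v = ⊥-elim (colourAt-≢ (logStar n) {G} (growth δ) p u≢v (Finₚ.toℕ-injective (sym e)))

        blank-nothing : ∀ b → lookup blank b ≡ nothing
        blank-nothing = Vecₚ.lookup∘tabulate (λ _ → nothing)

      rows-proper : ∀ i → Proper G (rowsOf (rows i G))
      sym-col (rows-proper zero) a b = trans (blank-nothing b) (sym (blank-nothing a))
      edge-col (rows-proper zero) {b = b} e = case trans (sym (blank-nothing b)) e of λ ()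
      matching (rows-proper zero) {b = b} e _ = case trans (sym (blank-nothing b)) e of λ ()
      rows-proper (suc i) = recolourClass-proper {G} {vertexColour G} i (rows i G) deg growth (rows-proper i) spread

      rows-complete : ∀ i {a b} → adj G a b ≡ true → vertexColour G a < i → rowsOf (rows i G) a b ≢ nothing
      rows-complete (suc i) {a} ab (s≤s le) e with ℕₚ.m≤n⇒m<n∨m≡n le
      ... | inj₁ lt = rows-complete i ab lt (recolourClass-keeps {G} {vertexColour G} i (rows i G) deg growth (rows-proper i) spread ab e)
      ... | inj₂ eq = recolourClass-star {G} {vertexColour G} i (rows i G) deg growth (rows-proper i) spread ab eq e

      finalRows-proper : Proper G (rowsOf (finalRows G))
      finalRows-proper = rows-proper finalPalette

      finalRows-total : ∀ {a b} → adj G a b ≡ true → rowsOf (finalRows G) a b ≢ nothing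
      finalRows-total ab = rows-complete finalPalette ab (ℕₚ.<-≤-trans (Finₚ.toℕ<n _) (palettes-logStar n))

  depth-bound : ∀ n i → depth {n} i ≡ i * reach + logStar n * δ
  depth-bound n zero = refl
  depth-bound n (suc i) = trans (cong (reach +_) (depth-bound n i)) (sym (ℕₚ.+-assoc reach (i * reach) _))

  finalDepth : ℕ → ℕ
  finalDepth n = depth {n} finalPalette

  -- Made from `f` and `D` alone, not from `d`: this is what frees the final constant from Δ.
  totalFactor : ℕ
  totalFactor = suc (finalPalette * reach + δ)

  -- Learning the rows at distance `r` takes `r + 1` rounds, hence the `suc`; `1 ≤ logStar n`
  -- absorbs the additive terms.
  depth-total : ∀ n → 1 ≤ logStar n → suc (finalDepth n) ≤ totalFactor * logStar n
  depth-total n 1≤l = begin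
    suc (finalDepth n) ≡⟨ cong suc (depth-bound n finalPalette) ⟩
    suc (finalPalette * reach + l * δ) ≤⟨ ℕₚ.+-mono-≤ 1≤l (ℕₚ.+-mono-≤ (ℕₚ.m≤m*n (finalPalette * reach) l {{>-nonZero 1≤l}}) (ℕₚ.≤-reflexive (ℕₚ.*-comm l δ))) ⟩
    l + (finalPalette * reach * l + δ * l) ≡⟨ cong (l +_) (sym (ℕₚ.*-distribʳ-+ l (finalPalette * reach) δ)) ⟩
    totalFactor * l ∎
    where
    open ℕₚ.≤-Reasoning
    l : ℕ
    l = logStar n

-- The LOCAL algorithm

module Relabelling {n : ℕ} (G : Graph n) (ident : Fin n → Fin n) (injective : Injective _≡_ _≡_ ident) where

  private
    preimage : ∀ i → ∃ λ v → ident v ≡ i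
    preimage i with Finₚ.any? (λ v → ident v ≟ᶠ i)
    ... | yes e = e
    ... | no none = ⊥-elim (ℕₚ.1+n≰n (ℕₚ.≤-trans (ℕₚ.≤-reflexive (cong suc (sym len)))
      (ℕₚ.≤-trans (unique-⊆-length {xs = i ∷ map ident (allFin n)} {allFin n} unique (λ {x} _ → ∈-allFin x))
        (ℕₚ.≤-reflexive (length-tabulate {n = n} id)))))
      where
      len : length (map ident (allFin n)) ≡ n
      len = trans (length-map ident (allFin n)) (length-tabulate {n = n} id)
      unique : Unique (i ∷ map ident (allFin n))
      unique = All.tabulate (λ x∈ i≡x → let (v , _ , x≡) = ∈-map⁻ ident x∈ in none (v , sym (trans i≡x x≡)))
        ∷ Uniqueₚ.map⁺ injective (Uniqueₚ.allFin⁺ n)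

  inverse : Fin n → Fin n
  inverse i = proj₁ (preimage i)

  ident-inverse : ∀ i → ident (inverse i) ≡ i
  ident-inverse i = proj₂ (preimage i)

  inverse-ident : ∀ v → inverse (ident v) ≡ v
  inverse-ident v = injective (ident-inverse (ident v))

  inverse-injective : ∀ {i j} → inverse i ≡ inverse j → i ≡ j
  inverse-injective {i} {j} e = trans (sym (ident-inverse i)) (trans (cong ident e) (ident-inverse j))

  -- The graph on identifiers, the only one that messages can reveal.
  relabelled : Graph n
  adj    relabelled i j = adj G (inverse i) (inverse j)
  symm   relabelled i j = symm G (inverse i) (inverse j)
  irrefl relabelled i   = irrefl G (inverse i)

  relabelled-adj : ∀ {u v} → adj G u v ≡ true → adj relabelled (ident u) (ident v) ≡ true
  relabelled-adj {u} {v} e = subst₂ (λ a b → adj G a b ≡ true) (sym (inverse-ident u)) (sym (inverse-ident v)) e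

  relabelled-path : ∀ {i r j} → Path relabelled i r j → Path G (inverse i) r (inverse j)
  relabelled-path stop = stop
  relabelled-path (snoc p e) = snoc (relabelled-path p) e

  module _ {Δ : ℕ} {f : ℕ → ℕ} (inClass : InClass Δ f G) where

    relabelled-growth : GrowthAtMost f relabelled
    relabelled-growth r i xs u near = begin
      length xs ≡⟨ sym (length-map inverse xs) ⟩
      length (map inverse xs) ≤⟨ unique-⊆-length (Uniqueₚ.map⁺ inverse-injective u) contained ⟩
      ballSize G r (inverse i) ≤⟨ proj₂ inClass r (inverse i) ⟩
      f r ∎
      where
      open ℕₚ.≤-Reasoning
      contained : ∀ {v} → v ∈ map inverse xs → v ∈ filterᵇ (ball G r (inverse i)) (allFin n)
      contained v∈ with ∈-map⁻ inverse v∈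
      ... | j , j∈ , refl = ∈-filterᵇ⁺ (ball G r (inverse i)) (path⇒ball (relabelled-path (All.lookup near j∈)))

    -- The neighbours of a vertex lie in its ball of radius 1, which has at most `f 1` vertices.
    relabelled-degree : DegreeAtMost (Δ ⊓ f 1) relabelled
    relabelled-degree i xs u all = begin
      length xs ≡⟨ sym (length-map inverse xs) ⟩
      length (map inverse xs) ≤⟨ unique-⊆-length (Uniqueₚ.map⁺ inverse-injective u) contained ⟩
      degree G (inverse i) ≤⟨ ℕₚ.⊓-glb (proj₁ inClass (inverse i)) (ℕₚ.≤-trans in-ball (proj₂ inClass 1 (inverse i))) ⟩
      Δ ⊓ f 1 ∎
      where
      open ℕₚ.≤-Reasoning
      contained : ∀ {v} → v ∈ map inverse xs → v ∈ neighbours G (inverse i)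
      contained v∈ with ∈-map⁻ inverse v∈
      ... | j , j∈ , refl = neighbours⁺ {G = G} (All.lookup all j∈)
      in-ball : degree G (inverse i) ≤ ballSize G 1 (inverse i)
      in-ball = unique-⊆-length (unique-filterᵇ (adj G (inverse i))) (λ v∈ →
        ∈-filterᵇ⁺ (ball G 1 (inverse i)) (path⇒ball (path-edge {G = G} (neighbours⁻ {G = G} v∈))))

-- Knowledge is an arbitrary relation; symmetrising it and dropping loops makes it a `Graph` in
-- every state.
viewGraph : ∀ {n} → (Fin n → Fin n → Bool) → Graph n
adj    (viewGraph k) a b = (k a b ∨ k b a) ∧ not (a == b)
symm   (viewGraph k) a b = cong₂ _∧_ (Boolₚ.∨-comm (k a b) (k b a)) (cong not (==-sym a b))
irrefl (viewGraph k) v rewrite ==-refl v = Boolₚ.∧-zeroʳ (k v v ∨ k v v)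

-- Every vertex floods the edges it knows; in the end it evaluates `answer` on the graph it has seen.
module Flooding (Δ : ℕ) (answer : ∀ n → Graph n → Fin n → Fin n → Fin (suc Δ)) where

  Knowledge : ℕ → Set
  Knowledge n = Fin n × (Fin n → Fin n → Bool)

  heard : ∀ {n} → Maybe (Knowledge n) → Fin n → Fin n → Bool
  heard nothing        a b = false
  heard (just (_ , k)) a b = k a b

  -- That a message came from `b` at all reveals the edge to `b`; its content adds what the sender
  -- knew.
  learn : ∀ {n} → Knowledge n → (Fin n → Maybe (Knowledge n)) → Fin n → Fin n → Bool
  learn {n} (i , k) msgs a b = k a b ∨ (((a == i) ∧ Maybe.is-just (msgs b)) ∨ any (λ j → heard (msgs j) a b) (allFin n))

  flooding : Algorithm Δ
  State  flooding = Knowledge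
  Msg    flooding = Knowledge
  init   flooding n i = i , λ _ _ → false
  send   flooding n s = s
  step   flooding n s msgs = proj₁ s , learn s msgs
  output flooding n (i , k) j = answer n (viewGraph k) i j

  module _ {n : ℕ} (G : Graph n) (ident : Fin n → Fin n) (injective : Injective _≡_ _≡_ ident) where

    open Relabelling G ident injective

    private
      known : ℕ → Fin n → Fin n → Fin n → Bool
      known t v = proj₂ (run flooding G ident t v)

      own-id : ∀ t v → proj₁ (run flooding G ident t v) ≡ ident v
      own-id zero v = refl
      own-id (suc t) v = own-id t v

      message : ℕ → Fin n → Fin n → Maybe (Knowledge n)
      message t v j = Maybe.map (λ u → run flooding G ident t u) (nbrWithId G ident v j)

      nbr⁻ : ∀ {v j u} → nbrWithId G ident v j ≡ just u → adj G v u ≡ true × ident u ≡ j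
      nbr⁻ {v} {j} {u} e with ∧-true {adj G v u} (findFirst-just (λ u → adj G v u ∧ (ident u == j)) (allFin n) e)
      ... | vu , id≡ = vu , ==-true (ident u) j id≡

      nbr⁺ : ∀ {v u} → adj G v u ≡ true → nbrWithId G ident v (ident u) ≡ just u
      nbr⁺ {v} {u} vu with nbrWithId G ident v (ident u) in e
      ... | just u′ = cong just (injective (proj₂ (nbr⁻ {v} {ident u} e)))
      ... | nothing = case trans (sym (findFirst-nothing (λ w → adj G v w ∧ (ident w == ident u)) (allFin n) e (∈-allFin u)))
        (∧-intro vu (==-refl (ident u))) of λ ()

      sound : ∀ t v {a b} → known t v a b ≡ true → adj relabelled a b ≡ true
      sound (suc t) v {a} {b} e with ∨-true {known t v a b} e
      ... | inj₁ old = sound t v old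
      ... | inj₂ fresh with ∨-true {(a == proj₁ (run flooding G ident t v)) ∧ Maybe.is-just (message t v b)} fresh
      ... | inj₁ own = own-edge (proj₁ (∧-true own)) (proj₂ (∧-true {a == proj₁ (run flooding G ident t v)} own))
        where
        own-edge : (a == proj₁ (run flooding G ident t v)) ≡ true → Maybe.is-just (message t v b) ≡ true → adj relabelled a b ≡ true
        own-edge a≡ b-answers with nbrWithId G ident v b in nb
        ... | just u with nbr⁻ {v} {b} nb | trans (==-true a _ a≡) (own-id t v)
        ... | vu , refl | refl = relabelled-adj vu
      ... | inj₂ told with any-true⁻ (λ j → heard (message t v j) a b) (allFin n) told
      ... | j , _ , h = from-message h
        where
        from-message : heard (message t v j) a b ≡ true → adj relabelled a b ≡ true
        from-message h with nbrWithId G ident v j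
        ... | just u = sound t u h

      -- `u` learns its edges in the first round, and this knowledge then travels one edge per
      -- round.
      complete : ∀ t {v u x r} → Path G u r v → suc r ≤ t → adj G u x ≡ true → known t v (ident u) (ident x) ≡ true
      complete (suc t) {v} {u} {x} stop _ ux = ∨-trueʳ (known t v (ident u) (ident x)) (∨-trueˡ _
        (∧-intro (subst (λ i → (ident u == i) ≡ true) (sym (own-id t u)) (==-refl (ident u)))
          (cong (λ m → Maybe.is-just (Maybe.map (λ u → run flooding G ident t u) m)) (nbr⁺ ux))))
      complete (suc t) {v} {u} {x} (snoc {u = w} p wv) (s≤s r≤t) ux = ∨-trueʳ (known t v (ident u) (ident x)) (∨-trueʳ
        ((ident u == proj₁ (run flooding G ident t v)) ∧ Maybe.is-just (message t v (ident x)))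
        (any-true⁺ (λ j → heard (message t v j) (ident u) (ident x)) (∈-allFin (ident w))
          (trans (cong (λ m → heard (Maybe.map (λ u → run flooding G ident t u) m) (ident u) (ident x)) (nbr⁺ (adj-sym {G = G} wv)))
            (complete t p r≤t ux))))

    view-agrees : ∀ t v → Agree t relabelled (viewGraph (known (suc t) v)) (ident v)
    view-agrees t v {w} p x = true-iff to from
      where
      to : adj relabelled w x ≡ true → adj (viewGraph (known (suc t) v)) w x ≡ true
      to e = ∧-intro (∨-trueˡ _ (subst₂ (λ a b → known (suc t) v a b ≡ true) (ident-inverse w) (ident-inverse x)
          (complete (suc t) (path-sym (subst (λ u → Path G u t (inverse w)) (inverse-ident v) (relabelled-path p))) ℕₚ.≤-refl e)))
        distinct
        where
        distinct : not (w == x) ≡ true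
        distinct with w == x in eq
        ... | true = ⊥-elim (adj-≢ {G = relabelled} e (==-true w x eq))
        ... | false = refl
      from : adj (viewGraph (known (suc t) v)) w x ≡ true → adj relabelled w x ≡ true
      from e with ∨-true {known (suc t) v w x} (proj₁ (∧-true e))
      ... | inj₁ k = sound (suc t) v k
      ... | inj₂ k = adj-sym {G = relabelled} (sound (suc t) v k)

    edgeColour-flooding : ∀ {r t} → (∀ {H H′ i j} → Agree r H H′ i → answer n H i j ≡ answer n H′ i j) → suc r ≤ t →
      ∀ v u → edgeColour flooding G ident t v u ≡ answer n relabelled (ident v) (ident u)
    edgeColour-flooding {r} {suc t} local (s≤s r≤t) v u = trans
      (cong (λ i → answer n (viewGraph (known (suc t) v)) i (ident u)) (own-id (suc t) v))
      (sym (local (agree-mono {G = relabelled} {viewGraph (known (suc t) v)} r≤t (view-agrees t v))))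

module EdgeColouring (f : ℕ → ℕ) (subexponential : Subexponential f) (Δ : ℕ) where

  open Procedure f subexponential (f 1) (Δ ⊓ f 1) (ℕₚ.m⊓n≤n Δ (f 1))

  private
    embed : Maybe (Fin (suc (Δ ⊓ f 1))) → Fin (suc Δ)
    -- A default that no edge receives, by `finalRows-total`.
    embed nothing  = zero
    embed (just c) = inject≤ c (s≤s (ℕₚ.m⊓n≤m Δ (f 1)))

    embed-injective : ∀ {m m′} → m ≢ nothing → m′ ≢ nothing → embed m ≡ embed m′ → m ≡ m′
    embed-injective {nothing} ne _ _ = ⊥-elim (ne refl)
    embed-injective {just _} {nothing} _ ne _ = ⊥-elim (ne refl)
    embed-injective {just c} {just c′} _ _ e = cong just (Finₚ.inject≤-injective _ _ c c′ e)

    colours : ∀ {n} → Graph n → PartialColouring n (suc (Δ ⊓ f 1))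
    colours H = rowsOf (finalRows H)

    answer : ∀ n → Graph n → Fin n → Fin n → Fin (suc Δ)
    answer n H i j = embed (colours H i j)

  algorithm : Algorithm Δ
  algorithm = Flooding.flooding Δ answer

  rounds : ℕ
  rounds = totalFactor

  -- `logStar 1` is 0 and allows no round, but a graph with an edge has two vertices.
  1≤logStar : ∀ {n} {u v : Fin n} → u ≢ v → 1 ≤ logStar n
  1≤logStar {suc zero} {zero} {zero} u≢v = ⊥-elim (u≢v refl)
  1≤logStar {suc (suc n)} _ = s≤s z≤n

  algorithm-correct : ∀ n (G : Graph n) → InClass Δ f G → (ident : Fin n → Fin n) → Injective _≡_ _≡_ ident →
    ProperEdgeColouring G (edgeColour algorithm G ident (rounds * logStar n))
  algorithm-correct n G inClass ident injective = symmetric , proper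
    where
    open Relabelling G ident injective

    H : Graph n
    H = relabelled

    coloured : Proper H (colours H)
    coloured = finalRows-proper (relabelled-degree inClass) (relabelled-growth inClass)

    total : ∀ {u v} → adj G u v ≡ true → colours H (ident u) (ident v) ≢ nothing
    total e = finalRows-total (relabelled-degree inClass) (relabelled-growth inClass) (relabelled-adj e)

    computed : ∀ {u v} → adj G u v ≡ true → edgeColour algorithm G ident (rounds * logStar n) u v ≡ embed (colours H (ident u) (ident v))
    computed {u} {v} e = Flooding.edgeColour-flooding Δ answer G ident injective {r = finalDepth n}
      (λ {K} {K′} {i} {j} ag → cong (λ row → embed (lookup row j)) (finalRows-local {n} {K} {K′} ag))
      (depth-total n (1≤logStar (adj-≢ {G = G} e))) u v

    symmetric : ∀ u v → adj G u v ≡ true →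
      edgeColour algorithm G ident (rounds * logStar n) u v ≡ edgeColour algorithm G ident (rounds * logStar n) v u
    symmetric u v e = trans (computed e) (trans (cong embed (sym-col coloured (ident u) (ident v))) (sym (computed (adj-sym {G = G} e))))

    proper : ∀ v u w → adj G v u ≡ true → adj G v w ≡ true → u ≢ w →
      edgeColour algorithm G ident (rounds * logStar n) v u ≢ edgeColour algorithm G ident (rounds * logStar n) v w
    proper v u w vu vw u≢w e = u≢w (injective (same-colour (colours H (ident v) (ident u)) refl))
      where
      agree : colours H (ident v) (ident u) ≡ colours H (ident v) (ident w)
      agree = embed-injective (total vu) (total vw) (trans (sym (computed vu)) (trans e (computed vw)))
      same-colour : ∀ m → colours H (ident v) (ident u) ≡ m → ident u ≡ ident w
      same-colour nothing z = ⊥-elim (total vu z)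
      same-colour (just c) z = matching coloured z (trans (sym agree) z)

theorem1p8 : (f : ℕ → ℕ) → Subexponential f →
    Σ ℕ λ C → (0 < C) ×
    ((Δ : ℕ) → Σ (Algorithm Δ) λ A →
    (n : ℕ) (G : Graph n) → InClass Δ f G →
    (ident : Fin n → Fin n) → Injective _≡_ _≡_ ident →
    ProperEdgeColouring G (edgeColour A G ident (C * logStar n)))
theorem1p8 f subexponential =
  -- Every Δ gives this number, as `totalFactor` unfolds to an expression without Δ.
  EdgeColouring.rounds f subexponential 0 , s≤s z≤n ,
  λ Δ → EdgeColouring.algorithm f subexponential Δ , EdgeColouring.algorithm-correct f subexponential Δ
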